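{- For all integers $n\geq 1$: (a) $\mathrm{num}(n,-1)=n!$; (b) $\lvert\mathrm{num}(n,\mathrm{i})\rvert=\lvert\mathrm{num}(n,-\mathrm{i})\rvert=2^{\lfloor n/2\rfloor}\lfloor n/2\rfloor!$, where $\mathrm{i}$ is the imaginary unit; (c) for a primitive sixth root of unity $\zeta_6$, \[\lvert\mathrm{num}(n,\zeta_6)\rvert=\begin{cases}3^{\lfloor n/3\rfloor}\lfloor n/3\rfloor! & n\not\equiv 2 \pmod 3,\\ 4\cdot 3^{\lfloor n/3\rfloor}\lfloor n/3\rfloor! & n\equiv 2\pmod 3.\end{cases}\]
   Context: For a partition $\lambda$ of $n$ (written $\lambda\vdash n$) let $m_\lambda(i)$ be the number of parts of $\lambda$ equal to $i$. Define $h_\lambda(x)=\prod_{i\geq 1}(1+x^i)^{\lfloor n/i\rfloor-m_\lambda(i)}$, $\mathrm{num}^*(n,x)=\sum_{\lambda\vdash n}h_\lambda(x)$, $\mathrm{den}^*(n,x)=\prod_{i\geq1}(1+x^i)^{\lfloor n/i\rfloor}$ (so that $\sum_{\lambda\vdash n}\prod_{j}(1+x^{\lambda_j})^{ -1}=\mathrm{num}^*(n,x)/\mathrm{den}^*(n,x)$). Let $G(n,x)=\gcd\{h_\lambda(x)\mid\lambda\vdash n\}$ (the monic gcd in $\mathbb{Z}[x]$), and set $\mathrm{num}(n,x)=\mathrm{num}^*(n,x)/G(n,x)$ and $\mathrm{den}(n,x)=\mathrm{den}^*(n,x)/G(n,x)$. -}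

module Defs where

open import Data.Nat as ℕ using (ℕ; zero; suc; _∸_; _<_; _≡ᵇ_)
open import Data.Nat.DivMod using (_/_)
open import Data.Integer as ℤ using (ℤ; 0ℤ; 1ℤ; -1ℤ; +_; _+_; _*_; -_)
open import Data.List using (List; []; _∷_; map; foldr; upTo; replicate; _++_; concatMap)
open import Data.List.Relation.Unary.All using (All)
open import Data.Product using (_×_; _,_; ∃)
open import Data.Bool using (if_then_else_)
open import Relation.Binary.PropositionalEquality using (_≡_)

-- Polynomials in ℤ[x] as coefficient lists (constant term first).
-- Equality is coefficientwise (so trailing zeros are irrelevant).

Poly : Set
Poly = List ℤ

coeff : Poly → ℕ → ℤ
coeff []      _       = 0ℤ
coeff (a ∷ p) zero    = a
coeff (a ∷ p) (suc k) = coeff p k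

infix 4 _≈P_
_≈P_ : Poly → Poly → Set
p ≈P q = ∀ k → coeff p k ≡ coeff q k

infixl 6 _+P_
_+P_ : Poly → Poly → Poly
[]      +P q       = q
(a ∷ p) +P []      = a ∷ p
(a ∷ p) +P (b ∷ q) = (a + b) ∷ (p +P q)

scaleP : ℤ → Poly → Poly
scaleP a p = map (a *_) p

infixl 7 _*P_
_*P_ : Poly → Poly → Poly
[]      *P q = []
(a ∷ p) *P q = scaleP a q +P (0ℤ ∷ (p *P q))

oneP : Poly
oneP = 1ℤ ∷ []

_^P_ : Poly → ℕ → Poly
p ^P zero  = oneP
p ^P suc k = p *P (p ^P k)

sumP : List Poly → Poly
sumP = foldr _+P_ []

prodP : List Poly → Poly
prodP = foldr _*P_ oneP

xPow : ℕ → Poly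
xPow i = replicate i 0ℤ ++ (1ℤ ∷ [])

onePlusXPow : ℕ → Poly
onePlusXPow i = oneP +P xPow i

infix 4 _∣P_
_∣P_ : Poly → Poly → Set
d ∣P p = ∃ λ q → q *P d ≈P p

Monic : Poly → Set
Monic p = ∃ λ d → coeff p d ≡ 1ℤ × (∀ k → d < k → coeff p k ≡ 0ℤ)

IsMonicGcd : Poly → List Poly → Set
IsMonicGcd G hs = Monic G × All (G ∣P_) hs × (∀ D → All (D ∣P_) hs → D ∣P G)

-- partsLe n m : all partitions of n with all parts ≤ m, each listed once as
-- a weakly decreasing list of positive parts (k = multiplicity of part suc m).
partsLe : ℕ → ℕ → List (List ℕ)
partsLe n zero    = if n ≡ᵇ 0 then [] ∷ [] else []
partsLe n (suc m) =
  concatMap (λ k → map (replicate k (suc m) ++_) (partsLe (n ∸ k ℕ.* suc m) m))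
            (upTo (suc (n / suc m)))

partitions : ℕ → List (List ℕ)
partitions n = partsLe n n

mult : List ℕ → ℕ → ℕ
mult []      i = 0
mult (j ∷ l) i = if j ≡ᵇ i then suc (mult l i) else mult l i

-- h_λ(x) = ∏_{i ≥ 1} (1+x^i)^{⌊n/i⌋ - m_λ(i)}; factors with i > n are 1.
hPoly : ℕ → List ℕ → Poly
hPoly n l = prodP (map (λ j → onePlusXPow (suc j) ^P (n / suc j ∸ mult l (suc j))) (upTo n))

hList : ℕ → List Poly
hList n = map (hPoly n) (partitions n)

numStar : ℕ → Poly
numStar n = sumP (hList n)

evalℤ : Poly → ℤ → ℤ
evalℤ []      x = 0ℤ
evalℤ (a ∷ p) x = a + x * evalℤ p x

ℤ[i] : Set
ℤ[i] = ℤ × ℤ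

_*G_ : ℤ[i] → ℤ[i] → ℤ[i]
(a , b) *G (c , d) = (a * c + - (b * d)) , (a * d + b * c)

evalG : Poly → ℤ[i] → ℤ[i]
evalG []      z = 0ℤ , 0ℤ
evalG (a ∷ p) z with z *G evalG p z
... | (u , v) = (a + u) , v

normG : ℤ[i] → ℤ
normG (a , b) = a * a + b * b

imagUnit negImagUnit : ℤ[i]
imagUnit    = 0ℤ , 1ℤ
negImagUnit = 0ℤ , -1ℤ

-- Eisenstein-type integers a + b ζ with ζ = e^{iπ/3}, ζ² = ζ - 1
ℤ[ζ₆] : Set
ℤ[ζ₆] = ℤ × ℤ

_*E_ : ℤ[ζ₆] → ℤ[ζ₆] → ℤ[ζ₆]
(a , b) *E (c , d) = (a * c + - (b * d)) , (a * d + b * c + b * d)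

evalE : Poly → ℤ[ζ₆] → ℤ[ζ₆]
evalE []      z = 0ℤ , 0ℤ
evalE (a ∷ p) z with z *E evalE p z
... | (u , v) = (a + u) , v

-- |a + b ζ|^2 = a² + ab + b²
normE : ℤ[ζ₆] → ℤ
normE (a , b) = a * a + a * b + b * b

-- the two primitive sixth roots of unity: ζ and ζ⁵ = conj ζ = 1 - ζ
ζ₆ ζ₆⁵ : ℤ[ζ₆]
ζ₆  = 0ℤ , 1ℤ
ζ₆⁵ = 1ℤ , -1ℤ

{-# OPTIONS --safe #-}
-- Write Ψₑ for the cyclotomic polynomial Φ₂ₑ, so that 1 + xⁱ = ∏ Ψₑ over the e ◁ i, i.e. the e
-- with i/e an odd integer.  If Aₑ(λ) is the number of parts p of λ with e ◁ p, then
-- ∏ⱼ (1 + x^λⱼ) = ∏ₑ Ψₑ^Aₑ(λ) and Aₑ(λ) ≤ ⌊n/e⌋, with equality for e^⌊n/e⌋ completed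
-- arbitrarily.  Hence den = ∏ₑ Ψₑ^⌊n/e⌋ and num = ∑_λ q_λ with q_λ = ∏ₑ Ψₑ^(⌊n/e⌋ - Aₑ(λ)): the
-- q_λ have no common factor because distinct Ψₑ are coprime up to an integer constant.
-- At a primitive 2e-th root of unity z (e = 1, 2, 3) only the λ with Aₑ(λ) = ⌊n/e⌋ survive,
-- namely ⌊n/e⌋ parts e together with a partition of n mod e.  Their values follow from
-- ∏_{h≠e} Ψₕ^⌊n/h⌋ = ∏_{m≤n} Qₘ with Qₘ = ∏_{h∣m, h≠e} Ψₕ.  Up to powers of Ψₑ one has Qₘ = 1 + xᵐ
-- for odd m and Q₂ₖ = (1 + x²ᵏ) Qₖ, so |Qₘ(z)| is a constant, multiplied by m/e when e ∣ m.
module Submission where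

open import Defs
open import Algebra.Bundles using (CommutativeRing)
open import Data.Bool using (true; false; if_then_else_)
open import Data.Empty using (⊥-elim)
open import Data.Fin using (zero; suc)
open import Data.Integer as ℤ using (ℤ; 0ℤ; 1ℤ; -1ℤ; +_)
import Data.Integer.Properties as ℤₚ
import Data.Integer.Tactic.RingSolver as ℤSolver
open import Data.List using (List; []; _∷_; map; upTo; replicate; _++_; concatMap; applyUpTo)
open import Data.List.Membership.Propositional using (_∈_; lose)
open import Data.List.Membership.Propositional.Properties using (∈-map⁺; ∈-concatMap⁺; ∈-upTo⁺)
import Data.List.Properties as Listₚ
open import Data.List.Relation.Unary.All as All using (All; []; _∷_)
import Data.List.Relation.Unary.All.Properties as Allₚ
open import Data.List.Relation.Unary.Any using (here)
open import Data.Nat as ℕ using (ℕ; zero; suc; _<_; _≤_; s≤s; z≤n; _∸_; _/_; _%_; _≡ᵇ_; _!)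
open import Data.Nat.Divisibility using (_∣_; divides; _∣?_; ∣⇒≤; ∣m+n∣m⇒∣n; n∣m*n; ∣-trans; ∣n⇒∣m*n; 1∣_)
import Data.Nat.DivMod as DivMod
open import Data.Nat.GCD using (gcd; gcd-GCD; gcd[m,n]∣m; gcd[m,n]∣n; module Bézout)
open import Data.Nat.ListAction using (sum)
open import Data.Nat.ListAction.Properties using (sum-++)
import Data.Nat.Properties as ℕₚ
import Data.Nat.Tactic.RingSolver as ℕSolver
open import Data.Product using (∃; ∃₂; _×_; _,_; proj₁; proj₂)
open import Data.Sum using (_⊎_; inj₁; inj₂)
open import Level using (0ℓ)
open import Relation.Binary.PropositionalEquality as ≡ using (_≡_; _≢_)
import Relation.Binary.Reasoning.Setoid as SetoidReasoning
open import Relation.Nullary using (Dec; yes; no; ¬_; does)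
open import Relation.Nullary.Decidable using (toWitnessFalse)

-- Over ℤ distinct Ψ are not coprime in the strict sense: `1 + x` and `1 - x + x^2` generate an
-- ideal that contains 3 but not 1. Every Bézout identity therefore ends in a positive integer, and
-- monicity removes it: a monic polynomial dividing a constant is 1, and one dividing a constant
-- multiple of p divides p. The Ψ are not taken from complex roots of unity but built by recursion:
-- the next one is the quotient of `1 + x^(N+1)` by the earlier Ψₕ with h ◁ N+1, and that this
-- division is exact rests on their coprimality. Coprimality itself is proved in the quotient of
-- ℤ[x] by the two polynomials, where it says that some positive integer vanishes. Absolute values
-- appear only through a multiplicative norm with integer values: the identity of ℤ for (a), so that
-- the sign is kept, and the squared absolute value in ℤ[i] and ℤ[ζ₆] for (b) and (c). Division by
-- zero at the root is avoided by deleting Ψₑ from all exponents beforehand.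

parity : ∀ k → (∃ λ j → k ≡ 2 ℕ.* j) ⊎ (∃ λ j → k ≡ suc (2 ℕ.* j))
parity zero = inj₁ (0 , ≡.refl)
parity (suc k) with parity k
... | inj₁ (j , k≡2j)   = inj₂ (j , ≡.cong suc k≡2j)
... | inj₂ (j , k≡2j+1) =
  inj₁ (suc j , ≡.trans (≡.cong suc k≡2j+1) (≡.sym (ℕₚ.*-suc 2 j)))

-- Signs, alternating sums, and divisibility up to integer constants in a commutative ring

module RingTheory (R : CommutativeRing 0ℓ 0ℓ) where
  open CommutativeRing R hiding (zero)
  open import Algebra.Properties.CommutativeSemiring.Exp commutativeSemiring public
  open import Algebra.Properties.Semiring.Mult semiring public
    using (×1-homo-*) renaming (_×_ to _⊗_)
  open import Algebra.Properties.Ring ring public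
    using (-‿distribˡ-*; -‿distribʳ-*; -‿involutive; x+x≈x⇒x≈0; -‿+-comm; +-cancelʳ)
  open import Algebra.Solver.Ring.NaturalCoefficients.Default commutativeSemiring public
    using (solve; _:=_; _:+_; _:*_; con)
  open SetoidReasoning setoid

  1^≈1 : ∀ n → 1# ^ n ≈ 1#
  1^≈1 zero    = refl
  1^≈1 (suc n) = trans (*-identityˡ _) (1^≈1 n)

  neg*neg : ∀ y → - y * - y ≈ y * y
  neg*neg y = begin
    - y * - y     ≈⟨ -‿distribˡ-* y (- y) ⟨
    - (y * - y)   ≈⟨ -‿cong (sym (-‿distribʳ-* y y)) ⟩
    - (- (y * y)) ≈⟨ -‿involutive _ ⟩
    y * y         ∎

  neg-^-even : ∀ y j → (- y) ^ (2 ℕ.* j) ≈ y ^ (2 ℕ.* j)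
  neg-^-even y j = begin
    (- y) ^ (2 ℕ.* j) ≈⟨ ^-assocʳ (- y) 2 j ⟨
    ((- y) ^ 2) ^ j   ≈⟨ ^-congˡ j square ⟩
    (y ^ 2) ^ j       ≈⟨ ^-assocʳ y 2 j ⟩
    y ^ (2 ℕ.* j)     ∎
    where
    square : (- y) ^ 2 ≈ y ^ 2
    square = begin
      - y * (- y * 1#) ≈⟨ *-congˡ (*-identityʳ _) ⟩
      - y * - y        ≈⟨ neg*neg y ⟩
      y * y            ≈⟨ *-congˡ (*-identityʳ _) ⟨
      y * (y * 1#)     ∎

  neg-^-odd : ∀ y j → (- y) ^ suc (2 ℕ.* j) ≈ - (y ^ suc (2 ℕ.* j))
  neg-^-odd y j = trans (*-congˡ (neg-^-even y j)) (sym (-‿distribˡ-* y _))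

  -1^even : ∀ {y} → y ≈ - 1# → ∀ j → y ^ (2 ℕ.* j) ≈ 1#
  -1^even y≈-1 j = trans (^-congˡ (2 ℕ.* j) y≈-1) (trans (neg-^-even 1# j) (1^≈1 (2 ℕ.* j)))

  -1^odd : ∀ {y} → y ≈ - 1# → ∀ j → y ^ suc (2 ℕ.* j) ≈ - 1#
  -1^odd {y} y≈-1 j =
    trans (*-congˡ (-1^even y≈-1 j)) (trans (*-identityʳ y) y≈-1)

  -- The alternating sum `1 - y + y^2 - ...` with `k` terms; for odd `k` it is the cofactor of
  -- `1 + y` in `1 + y^k`.
  alt : ℕ → Carrier → Carrier
  alt zero    y = 0#
  alt (suc k) y = 1# + - y * alt k y

  alt-geometric : ∀ k y → (1# + y) * alt k y + (- y) ^ k ≈ 1#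
  alt-geometric zero    y = trans (+-congʳ (zeroʳ _)) (+-identityˡ 1#)
  alt-geometric (suc k) y = begin
    (1# + y) * (1# + - y * alt k y) + - y * (- y) ^ k
      ≈⟨ solve 4 (λ y n a p → (con 1 :+ y) :* (con 1 :+ n :* a) :+ n :* p
                           := con 1 :+ (y :+ n :* ((con 1 :+ y) :* a :+ p))) refl
           y (- y) (alt k y) ((- y) ^ k) ⟩
    1# + (y + - y * ((1# + y) * alt k y + (- y) ^ k))
      ≈⟨ +-congˡ (+-congˡ (*-congˡ (alt-geometric k y))) ⟩
    1# + (y + - y * 1#) ≈⟨ +-congˡ (+-congˡ (*-identityʳ _)) ⟩
    1# + (y + - y)      ≈⟨ +-congˡ (-‿inverseʳ y) ⟩
    1# + 0#             ≈⟨ +-identityʳ 1# ⟩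
    1#                  ∎

  1+^odd : ∀ y j → 1# + y ^ suc (2 ℕ.* j) ≈ (1# + y) * alt (suc (2 ℕ.* j)) y
  1+^odd y j = begin
    1# + y ^ k                                   ≈⟨ +-congʳ (alt-geometric k y) ⟨
    ((1# + y) * alt k y + (- y) ^ k) + y ^ k     ≈⟨ +-congʳ (+-congˡ (neg-^-odd y j)) ⟩
    ((1# + y) * alt k y + - (y ^ k)) + y ^ k     ≈⟨ +-assoc _ _ _ ⟩
    (1# + y) * alt k y + (- (y ^ k) + y ^ k)     ≈⟨ +-congˡ (-‿inverseˡ _) ⟩
    (1# + y) * alt k y + 0#                      ≈⟨ +-identityʳ _ ⟩
    (1# + y) * alt k y                           ∎
    where k = suc (2 ℕ.* j)

  -- Every term of the alternating sum becomes 1. This is the origin both of the integer that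
  -- vanishes in the coprimality argument and of the factors m/e in the norms.
  alt-at-neg1 : ∀ {y} → y ≈ - 1# → ∀ k → alt k y ≈ k ⊗ 1#
  alt-at-neg1 y≈-1 zero    = refl
  alt-at-neg1 {y} y≈-1 (suc k) = +-congˡ (begin
    - y * alt k y ≈⟨ *-cong (trans (-‿cong y≈-1) (-‿involutive 1#)) (alt-at-neg1 y≈-1 k) ⟩
    1# * (k ⊗ 1#) ≈⟨ *-identityˡ _ ⟩
    k ⊗ 1#        ∎)

  -- In a quotient by an ideal this says that the ideal contains a positive integer; `suc c` keeps
  -- that integer nonzero.
  Torsion : Set
  Torsion = ∃ λ c → suc c ⊗ 1# ≈ 0#

  1≈-1⇒Torsion : 1# ≈ - 1# → Torsion
  1≈-1⇒Torsion 1≈-1 = 1 , trans (+-congˡ (trans (+-identityʳ 1#) 1≈-1)) (-‿inverseʳ 1#)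

  IsSign : Carrier → Set
  IsSign y = y ≈ 1# ⊎ y ≈ - 1#

  sign-^ : ∀ {y} → y ≈ - 1# → ∀ k → IsSign (y ^ k)
  sign-^ y≈-1 k with parity k
  ... | inj₁ (j , ≡.refl) = inj₁ (-1^even y≈-1 j)
  ... | inj₂ (j , ≡.refl) = inj₂ (-1^odd y≈-1 j)

  sign-cancel : ∀ {y s t} → IsSign s → IsSign t → y * s ≈ t → IsSign y
  sign-cancel {y} {s} {t} (inj₁ s≈1) ist ys≈t = go ist
    where
    y≈t : y ≈ t
    y≈t = trans (trans (sym (*-identityʳ y)) (*-congˡ (sym s≈1))) ys≈t
    go : IsSign t → IsSign y
    go (inj₁ t≈1)  = inj₁ (trans y≈t t≈1)
    go (inj₂ t≈-1) = inj₂ (trans y≈t t≈-1)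
  sign-cancel {y} {s} {t} (inj₂ s≈-1) ist ys≈t = go ist
    where
    y≈-t : y ≈ - t
    y≈-t = begin
      y            ≈⟨ *-identityʳ y ⟨
      y * 1#       ≈⟨ -‿involutive _ ⟨
      - (- (y * 1#)) ≈⟨ -‿cong (-‿distribʳ-* y 1#) ⟩
      - (y * - 1#) ≈⟨ -‿cong (*-congˡ (sym s≈-1)) ⟩
      - (y * s)    ≈⟨ -‿cong ys≈t ⟩
      - t          ∎
    go : IsSign t → IsSign y
    go (inj₁ t≈1)  = inj₂ (trans y≈-t (-‿cong t≈1))
    go (inj₂ t≈-1) = inj₁ (trans y≈-t (trans (-‿cong t≈-1) (-‿involutive 1#)))

  ^-shift : ∀ x u v e f g → g ℕ.+ v ℕ.* f ≡ u ℕ.* e → x ^ g * (x ^ f) ^ v ≈ (x ^ e) ^ u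
  ^-shift x u v e f g eq = begin
    x ^ g * (x ^ f) ^ v   ≈⟨ *-congˡ (^-assocʳ x f v) ⟩
    x ^ g * x ^ (f ℕ.* v) ≈⟨ ^-homo-* x g _ ⟨
    x ^ (g ℕ.+ f ℕ.* v)
      ≈⟨ ^-congʳ x (≡.trans (≡.cong (g ℕ.+_) (ℕₚ.*-comm f v)) (≡.trans eq (ℕₚ.*-comm u e))) ⟩
    x ^ (e ℕ.* u)         ≈⟨ ^-assocʳ x e u ⟨
    (x ^ e) ^ u           ∎

  -- Bézout over the naturals gives `g + v f = u e`, or the same with e and f exchanged. Hence `x^g`
  -- times a sign is a sign, and signs can be cancelled.
  ^-gcd-sign : ∀ x e f → x ^ e ≈ - 1# → x ^ f ≈ - 1# → IsSign (x ^ gcd e f)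
  ^-gcd-sign x e f xᵉ≈-1 xᶠ≈-1 with Bézout.identity (gcd-GCD e f)
  ... | Bézout.+- u v g+vf≡ue =
    sign-cancel (sign-^ xᶠ≈-1 v) (sign-^ xᵉ≈-1 u) (^-shift x u v e f (gcd e f) g+vf≡ue)
  ... | Bézout.-+ u v g+ue≡vf =
    sign-cancel (sign-^ xᵉ≈-1 u) (sign-^ xᶠ≈-1 v) (^-shift x v u f e (gcd e f) g+ue≡vf)

  -- The trace, modulo `Ψ e`, of the fact that `Ψ e` divides `(1 + x^e) / (1 + x^g)` for every g ◁ e
  -- other than e. The quotient e/g is written as an odd number from 3 on, because for quotient 1
  -- the sum is 1.
  AltVanishes : Carrier → ℕ → Set
  AltVanishes x e = ∀ g j → e ≡ g ℕ.* suc (2 ℕ.* suc j) → alt (suc (2 ℕ.* suc j)) (x ^ g) ≈ 0#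

  alt-torsion : ∀ x {e} → AltVanishes x e → ∀ g → x ^ g ≈ - 1# → ∀ j →
                e ≡ g ℕ.* suc (2 ℕ.* suc j) → Torsion
  alt-torsion x van g xᵍ≈-1 j eq =
    2 ℕ.* suc j , trans (sym (alt-at-neg1 xᵍ≈-1 (suc (2 ℕ.* suc j)))) (van g j eq)

  -- Unless 2 = 0, xᵍ = -1 for g = gcd e f and both e/g, f/g are odd; one of them is some k > 1,
  -- and 0 = alt k (xᵍ) = k.
  distinct-orders-torsion : ∀ x e f → e ≢ f → x ^ e ≈ - 1# → x ^ f ≈ - 1# →
                            AltVanishes x e → AltVanishes x f → Torsion
  distinct-orders-torsion x e f e≢f xᵉ≈-1 xᶠ≈-1 van-e van-f
    with ^-gcd-sign x e f xᵉ≈-1 xᶠ≈-1 | gcd[m,n]∣m e f | gcd[m,n]∣n e f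
  ... | inj₁ xᵍ≈1 | divides k e≡kg | _ =
    1≈-1⇒Torsion (begin
      1#                    ≈⟨ 1^≈1 k ⟨
      1# ^ k                ≈⟨ ^-congˡ k xᵍ≈1 ⟨
      (x ^ gcd e f) ^ k     ≈⟨ ^-assocʳ x (gcd e f) k ⟩
      x ^ (gcd e f ℕ.* k)   ≈⟨ ^-congʳ x (≡.sym (≡.trans e≡kg (ℕₚ.*-comm k _))) ⟩
      x ^ e                 ≈⟨ xᵉ≈-1 ⟩
      - 1#                  ∎)
  ... | inj₂ xᵍ≈-1 | divides k e≡kg | divides l f≡lg =
    go (parity k) (parity l) (≡.trans e≡kg (ℕₚ.*-comm k g)) (≡.trans f≡lg (ℕₚ.*-comm l g))
    where
    g = gcd e f
    even-quotient : ∀ j h → h ≡ g ℕ.* (2 ℕ.* j) → x ^ h ≈ - 1# → Torsion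
    even-quotient j h h≡ xʰ≈-1 = 1≈-1⇒Torsion (begin
      1#                  ≈⟨ -1^even xᵍ≈-1 j ⟨
      (x ^ g) ^ (2 ℕ.* j) ≈⟨ ^-assocʳ x g _ ⟩
      x ^ (g ℕ.* (2 ℕ.* j)) ≈⟨ ^-congʳ x (≡.sym h≡) ⟩
      x ^ h               ≈⟨ xʰ≈-1 ⟩
      - 1#                ∎)
    go : (∃ λ j → k ≡ 2 ℕ.* j) ⊎ (∃ λ j → k ≡ suc (2 ℕ.* j)) →
         (∃ λ j → l ≡ 2 ℕ.* j) ⊎ (∃ λ j → l ≡ suc (2 ℕ.* j)) →
         e ≡ g ℕ.* k → f ≡ g ℕ.* l → Torsion
    go (inj₁ (j , k≡)) _ e≡ _ = even-quotient j e (≡.trans e≡ (≡.cong (g ℕ.*_) k≡)) xᵉ≈-1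
    go (inj₂ _) (inj₁ (j , l≡)) _ f≡ = even-quotient j f (≡.trans f≡ (≡.cong (g ℕ.*_) l≡)) xᶠ≈-1
    go (inj₂ (suc j , k≡)) (inj₂ _) e≡ _ =
      alt-torsion x van-e g xᵍ≈-1 j (≡.trans e≡ (≡.cong (g ℕ.*_) k≡))
    go (inj₂ (0 , _)) (inj₂ (suc j , l≡)) _ f≡ =
      alt-torsion x van-f g xᵍ≈-1 j (≡.trans f≡ (≡.cong (g ℕ.*_) l≡))
    go (inj₂ (0 , k≡)) (inj₂ (0 , l≡)) e≡ f≡ =
      ⊥-elim (e≢f (≡.trans e≡ (≡.trans (≡.cong (g ℕ.*_) (≡.trans k≡ (≡.sym l≡))) (≡.sym f≡))))

  infix 4 _∥_ _⊥_

  _∥_ : Carrier → Carrier → Set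
  a ∥ b = ∃ λ q → q * a ≈ b

  -- Coprimality after tensoring with ℚ.
  _⊥_ : Carrier → Carrier → Set
  a ⊥ b = ∃ λ c → ∃₂ λ u v → u * a + v * b ≈ suc c ⊗ 1#

  ∥-trans : ∀ {a b c} → a ∥ b → b ∥ c → a ∥ c
  ∥-trans {a} (q , qa≈b) (r , rb≈c) = r * q , trans (*-assoc r q a) (trans (*-congˡ qa≈b) rb≈c)

  ∥-respʳ : ∀ {a b c} → b ≈ c → a ∥ b → a ∥ c
  ∥-respʳ b≈c (q , qa≈b) = q , trans qa≈b b≈c

  ⊥-sym : ∀ {a b} → a ⊥ b → b ⊥ a
  ⊥-sym (c , u , v , eq) = c , v , u , trans (+-comm _ _) eq

  ⊥-1 : ∀ a → a ⊥ 1#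
  ⊥-1 a = 0 , 0# , 1# , (begin
    0# * a + 1# * 1# ≈⟨ +-cong (zeroˡ a) (*-identityˡ 1#) ⟩
    0# + 1#          ≈⟨ +-comm 0# 1# ⟩
    1# + 0#          ∎)

  ⊥-* : ∀ {a b d} → a ⊥ b → a ⊥ d → a ⊥ b * d
  ⊥-* {a} {b} {d} (c , u , v , eq) (c′ , u′ , v′ , eq′) =
    -- The predecessor of `suc c * suc c′`: the two constants multiply.
    c′ ℕ.+ c ℕ.* suc c′ , u * (u′ * a + v′ * d) + v * b * u′ , v * v′ , (begin
      (u * (u′ * a + v′ * d) + v * b * u′) * a + v * v′ * (b * d)
        ≈⟨ solve 7 (λ u u′ a v′ d v b →
             (u :* (u′ :* a :+ v′ :* d) :+ v :* b :* u′) :* a :+ v :* v′ :* (b :* d)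
             := (u :* a :+ v :* b) :* (u′ :* a :+ v′ :* d)) refl u u′ a v′ d v b ⟩
      (u * a + v * b) * (u′ * a + v′ * d) ≈⟨ *-cong eq eq′ ⟩
      (suc c ⊗ 1#) * (suc c′ ⊗ 1#)         ≈⟨ ×1-homo-* (suc c) (suc c′) ⟨
      (suc c ℕ.* suc c′) ⊗ 1#              ∎)

  ⊥-^ : ∀ {a b} → a ⊥ b → ∀ k → a ⊥ b ^ k
  ⊥-^ a⊥b zero    = ⊥-1 _
  ⊥-^ a⊥b (suc k) = ⊥-* a⊥b (⊥-^ a⊥b k)

  ⊥-∥ : ∀ {a b d} → d ∥ b → a ⊥ b → a ⊥ d
  ⊥-∥ {a} {b} {d} (q , qd≈b) (c , u , v , eq) = c , u , v * q ,
    trans (+-congˡ (trans (*-assoc v q d) (*-congˡ qd≈b))) eq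

  self-⊥ : ∀ {a} → a ⊥ a → ∃ λ c → a ∥ suc c ⊗ 1#
  self-⊥ {a} (c , u , v , eq) = c , u + v , trans (distribʳ a u v) eq

  -- Multiply the Bézout identity by `d`, writing `d` as `r * b` in the term with `a` and as `q * a`
  -- in the term with `b`. The constant stays; it can be removed only for monic polynomials.
  coprime-∥ : ∀ {a b d} → a ⊥ b → a ∥ d → b ∥ d → ∃ λ c → a * b ∥ (suc c ⊗ 1#) * d
  coprime-∥ {a} {b} {d} (c , u , v , eq) (q , qa≈d) (r , rb≈d) = c , u * r + v * q , (begin
    (u * r + v * q) * (a * b)
      ≈⟨ solve 6 (λ u r v q a b → (u :* r :+ v :* q) :* (a :* b)
                               := u :* a :* (r :* b) :+ v :* b :* (q :* a)) refl u r v q a b ⟩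
    u * a * (r * b) + v * b * (q * a) ≈⟨ +-cong (*-congˡ rb≈d) (*-congˡ qa≈d) ⟩
    u * a * d + v * b * d             ≈⟨ distribʳ d _ _ ⟨
    (u * a + v * b) * d               ≈⟨ *-congʳ eq ⟩
    (suc c ⊗ 1#) * d                  ∎)

-- The quotient ring by an ideal with two generators

module _ (R : CommutativeRing 0ℓ 0ℓ) (A B : CommutativeRing.Carrier R) where
  open CommutativeRing R hiding (zero)
  open RingTheory R
  open SetoidReasoning setoid

  private
    comb : Carrier → Carrier → Carrier
    comb u v = u * A + v * B

  -- Congruence modulo the ideal (A, B), on the carrier of R. The ring laws lift with zero
  -- cofactors, and an equality in the quotient carries its Bézout coefficients.
  _≈ᴵ_ : Carrier → Carrier → Set
  p ≈ᴵ q = ∃₂ λ u v → p ≈ q + comb u v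

  private
    ≈⇒≈ᴵ : ∀ {p q} → p ≈ q → p ≈ᴵ q
    ≈⇒≈ᴵ {p} {q} p≈q = 0# , 0# , trans p≈q (sym
      (solve 3 (λ q A B → q :+ (con 0 :* A :+ con 0 :* B) := q) refl q A B))

    comb-neg : ∀ u v → comb (- u) (- v) ≈ - comb u v
    comb-neg u v = begin
      - u * A + - v * B     ≈⟨ +-cong (-‿distribˡ-* u A) (-‿distribˡ-* v B) ⟨
      - (u * A) + - (v * B) ≈⟨ -‿+-comm _ _ ⟩
      - comb u v            ∎

    ≈ᴵ-sym : ∀ {p q} → p ≈ᴵ q → q ≈ᴵ p
    ≈ᴵ-sym {p} {q} (u , v , eq) = - u , - v , sym (begin
      p + comb (- u) (- v)        ≈⟨ +-cong eq (comb-neg u v) ⟩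
      (q + comb u v) + - comb u v ≈⟨ +-assoc _ _ _ ⟩
      q + (comb u v + - comb u v) ≈⟨ +-congˡ (-‿inverseʳ _) ⟩
      q + 0#                      ≈⟨ +-identityʳ q ⟩
      q                           ∎)

    comb-+ : ∀ u v u′ v′ → comb u v + comb u′ v′ ≈ comb (u + u′) (v + v′)
    comb-+ u v u′ v′ = begin
      (u * A + v * B) + (u′ * A + v′ * B)
        ≈⟨ solve 4 (λ a b c d → (a :+ b) :+ (c :+ d) := (a :+ c) :+ (b :+ d)) refl
             (u * A) (v * B) (u′ * A) (v′ * B) ⟩
      (u * A + u′ * A) + (v * B + v′ * B) ≈⟨ +-cong (distribʳ A u u′) (distribʳ B v v′) ⟨
      comb (u + u′) (v + v′)              ∎

    comb-* : ∀ t u v → t * comb u v ≈ comb (t * u) (t * v)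
    comb-* t u v = trans (distribˡ t _ _) (sym (+-cong (*-assoc t u A) (*-assoc t v B)))

    ≈ᴵ-trans : ∀ {p q r} → p ≈ᴵ q → q ≈ᴵ r → p ≈ᴵ r
    ≈ᴵ-trans {p} {q} {r} (u , v , eq) (u′ , v′ , eq′) = u′ + u , v′ + v , (begin
      p                             ≈⟨ eq ⟩
      q + comb u v                  ≈⟨ +-congʳ eq′ ⟩
      r + comb u′ v′ + comb u v     ≈⟨ +-assoc _ _ _ ⟩
      r + (comb u′ v′ + comb u v)   ≈⟨ +-congˡ (comb-+ u′ v′ u v) ⟩
      r + comb (u′ + u) (v′ + v)    ∎)

    +-congᴵ : ∀ {p q r s} → p ≈ᴵ q → r ≈ᴵ s → (p + r) ≈ᴵ (q + s)
    +-congᴵ {p} {q} {r} {s} (u , v , eq) (u′ , v′ , eq′) = u + u′ , v + v′ , (begin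
      p + r                               ≈⟨ +-cong eq eq′ ⟩
      (q + comb u v) + (s + comb u′ v′)
        ≈⟨ solve 4 (λ a b c d → (a :+ b) :+ (c :+ d) := (a :+ c) :+ (b :+ d)) refl
             q (comb u v) s (comb u′ v′) ⟩
      (q + s) + (comb u v + comb u′ v′)   ≈⟨ +-congˡ (comb-+ u v u′ v′) ⟩
      (q + s) + comb (u + u′) (v + v′)    ∎)

    *-congᴵ : ∀ {p q r s} → p ≈ᴵ q → r ≈ᴵ s → (p * r) ≈ᴵ (q * s)
    *-congᴵ {p} {q} {r} {s} (u , v , eq) (u′ , v′ , eq′) =
      r * u + q * u′ , r * v + q * v′ , (begin
      p * r                                           ≈⟨ *-congʳ eq ⟩
      (q + comb u v) * r
        ≈⟨ solve 3 (λ q i r → (q :+ i) :* r := q :* r :+ r :* i) refl q (comb u v) r ⟩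
      q * r + r * comb u v                            ≈⟨ +-congʳ (*-congˡ eq′) ⟩
      q * (s + comb u′ v′) + r * comb u v
        ≈⟨ solve 4 (λ q s i j → q :* (s :+ i) :+ j := q :* s :+ (j :+ q :* i)) refl
             q s (comb u′ v′) (r * comb u v) ⟩
      q * s + (r * comb u v + q * comb u′ v′)
        ≈⟨ +-congˡ (+-cong (comb-* r u v) (comb-* q u′ v′)) ⟩
      q * s + (comb (r * u) (r * v) + comb (q * u′) (q * v′))
        ≈⟨ +-congˡ (comb-+ _ _ _ _) ⟩
      q * s + comb (r * u + q * u′) (r * v + q * v′)  ∎)

    -‿congᴵ : ∀ {p q} → p ≈ᴵ q → (- p) ≈ᴵ (- q)
    -‿congᴵ {p} {q} (u , v , eq) = - u , - v ,
      trans (-‿cong eq) (trans (sym (-‿+-comm _ _)) (+-congˡ (sym (comb-neg u v))))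

  quotientRing : CommutativeRing 0ℓ 0ℓ
  quotientRing = record
    { Carrier = Carrier ; _≈_ = _≈ᴵ_ ; _+_ = _+_ ; _*_ = _*_ ; -_ = -_ ; 0# = 0# ; 1# = 1#
    ; isCommutativeRing = record
      { isRing = record
        { +-isAbelianGroup = record
          { isGroup = record
            { isMonoid = record
              { isSemigroup = record
                { isMagma = record
                  { isEquivalence = record { refl = ≈⇒≈ᴵ refl ; sym = ≈ᴵ-sym ; trans = ≈ᴵ-trans }
                  ; ∙-cong = +-congᴵ }
                ; assoc = λ x y z → ≈⇒≈ᴵ (+-assoc x y z) }
              ; identity = (λ x → ≈⇒≈ᴵ (+-identityˡ x)) , (λ x → ≈⇒≈ᴵ (+-identityʳ x)) }
            ; inverse = (λ x → ≈⇒≈ᴵ (-‿inverseˡ x)) , (λ x → ≈⇒≈ᴵ (-‿inverseʳ x))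
            ; ⁻¹-cong = -‿congᴵ }
          ; comm = λ x y → ≈⇒≈ᴵ (+-comm x y) }
        ; *-cong = *-congᴵ
        ; *-assoc = λ x y z → ≈⇒≈ᴵ (*-assoc x y z)
        ; *-identity = (λ x → ≈⇒≈ᴵ (*-identityˡ x)) , (λ x → ≈⇒≈ᴵ (*-identityʳ x))
        ; distrib = (λ x y z → ≈⇒≈ᴵ (distribˡ x y z)) , (λ x y z → ≈⇒≈ᴵ (distribʳ x y z)) }
      ; *-comm = λ x y → ≈⇒≈ᴵ (*-comm x y) } }

  private
    module Q = RingTheory quotientRing

    ^≡ : ∀ x k → x Q.^ k ≡ x ^ k
    ^≡ x zero    = ≡.refl
    ^≡ x (suc k) = ≡.cong (x *_) (^≡ x k)

    ⊗≡ : ∀ k x → k Q.⊗ x ≡ k ⊗ x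
    ⊗≡ zero    x = ≡.refl
    ⊗≡ (suc k) x = ≡.cong (λ y → x + y) (⊗≡ k x)

    alt≡ : ∀ k x → Q.alt k x ≡ alt k x
    alt≡ zero    x = ≡.refl
    alt≡ (suc k) x = ≡.cong (λ y → 1# + - x * y) (alt≡ k x)

    ∥A⇒≈ᴵ0 : ∀ {p} → A ∥ p → p ≈ᴵ 0#
    ∥A⇒≈ᴵ0 (q , qA≈p) = q , 0# ,
      trans (sym qA≈p) (solve 3 (λ q A B → q :* A := con 0 :+ (q :* A :+ con 0 :* B)) refl q A B)

    ∥B⇒≈ᴵ0 : ∀ {p} → B ∥ p → p ≈ᴵ 0#
    ∥B⇒≈ᴵ0 (q , qB≈p) = 0# , q ,
      trans (sym qB≈p) (solve 3 (λ q A B → q :* B := con 0 :+ (con 0 :* A :+ q :* B)) refl q A B)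

    root : ∀ x e → (1# + x ^ e) ≈ᴵ 0# → (x Q.^ e) ≈ᴵ (- 1#)
    root x e h = ≈ᴵ-trans (≈⇒≈ᴵ (reflexive (^≡ x e)))
      (≈ᴵ-trans (≈⇒≈ᴵ (begin
          x ^ e                ≈⟨ +-identityˡ _ ⟨
          0# + x ^ e           ≈⟨ +-congʳ (-‿inverseˡ 1#) ⟨
          - 1# + 1# + x ^ e    ≈⟨ +-assoc _ _ _ ⟩
          - 1# + (1# + x ^ e)  ∎))
        (≈ᴵ-trans (+-congᴵ (≈⇒≈ᴵ refl) h) (≈⇒≈ᴵ (+-identityʳ _))))

  -- In the quotient by (A, B) both A and B vanish, so `x^e` and `x^f` become -1 and the alternating
  -- sums become 0. A positive integer that is 0 there is a combination of A and B.
  distinct-orders-⊥ : ∀ x e f → e ≢ f → A ∥ 1# + x ^ e → B ∥ 1# + x ^ f →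
    (∀ g j → e ≡ g ℕ.* suc (2 ℕ.* suc j) → A ∥ alt (suc (2 ℕ.* suc j)) (x ^ g)) →
    (∀ g j → f ≡ g ℕ.* suc (2 ℕ.* suc j) → B ∥ alt (suc (2 ℕ.* suc j)) (x ^ g)) →
    A ⊥ B
  distinct-orders-⊥ x e f e≢f A∥ B∥ altA altB = constant
    (Q.distinct-orders-torsion x e f e≢f (root x e (∥A⇒≈ᴵ0 A∥)) (root x f (∥B⇒≈ᴵ0 B∥))
      (λ g j eq → vanish g j (∥A⇒≈ᴵ0 (altA g j eq)))
      (λ g j eq → vanish g j (∥B⇒≈ᴵ0 (altB g j eq))))
    where
    vanish : ∀ g j → let k = suc (2 ℕ.* suc j) in alt k (x ^ g) ≈ᴵ 0# → Q.alt k (x Q.^ g) ≈ᴵ 0#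
    vanish g j h rewrite ^≡ x g | alt≡ (suc (2 ℕ.* suc j)) (x ^ g) = h
    constant : Q.Torsion → A ⊥ B
    constant (c , u , v , eq) = c , u , v , (begin
      u * A + v * B        ≈⟨ +-identityˡ _ ⟨
      0# + (u * A + v * B) ≈⟨ eq ⟨
      suc c Q.⊗ 1#         ≈⟨ reflexive (⊗≡ (suc c) 1#) ⟩
      suc c ⊗ 1#           ∎)

-- The ring ℤ[x]: ring laws, degrees and monic divisors

module Polynomials where
  open import Data.Integer using (_+_; _*_; -_)

  -- A record, unlike the function type _≈P_, lets Agda infer p and q from p ≋ q.
  infix 4 _≋_
  record _≋_ (p q : Poly) : Set where
    constructor coeffwise
    field coeff≡ : p ≈P q
  open _≋_

  ≋-refl : ∀ {p} → p ≋ p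
  ≋-refl = coeffwise λ _ → ≡.refl

  ≋-sym : ∀ {p q} → p ≋ q → q ≋ p
  ≋-sym p≋q = coeffwise λ k → ≡.sym (coeff≡ p≋q k)

  ≋-trans : ∀ {p q r} → p ≋ q → q ≋ r → p ≋ r
  ≋-trans p≋q q≋r = coeffwise λ k → ≡.trans (coeff≡ p≋q k) (coeff≡ q≋r k)

  coeff-map : ∀ (f : ℤ → ℤ) → f 0ℤ ≡ 0ℤ → ∀ p k → coeff (map f p) k ≡ f (coeff p k)
  coeff-map f f0≡0 []      k       = ≡.sym f0≡0
  coeff-map f f0≡0 (a ∷ p) zero    = ≡.refl
  coeff-map f f0≡0 (a ∷ p) (suc k) = coeff-map f f0≡0 p k

  coeff-scale : ∀ a p k → coeff (scaleP a p) k ≡ a * coeff p k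
  coeff-scale a = coeff-map (a *_) (ℤₚ.*-zeroʳ a)

  coeff-+ : ∀ p q k → coeff (p +P q) k ≡ coeff p k + coeff q k
  coeff-+ []      q       k       = ≡.sym (ℤₚ.+-identityˡ _)
  coeff-+ (a ∷ p) []      k       = ≡.sym (ℤₚ.+-identityʳ _)
  coeff-+ (a ∷ p) (b ∷ q) zero    = ≡.refl
  coeff-+ (a ∷ p) (b ∷ q) (suc k) = coeff-+ p q k

  negP : Poly → Poly
  negP = map (-_)

  ∷-cong : ∀ {a b p q} → a ≡ b → p ≋ q → (a ∷ p) ≋ (b ∷ q)
  ∷-cong a≡b p≋q = coeffwise λ { zero → a≡b ; (suc k) → coeff≡ p≋q k }

  0∷[]≋[] : (0ℤ ∷ []) ≋ []
  0∷[]≋[] = coeffwise λ { zero → ≡.refl ; (suc k) → ≡.refl }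

  +P-cong : ∀ {p p′ q q′} → p ≋ p′ → q ≋ q′ → (p +P q) ≋ (p′ +P q′)
  +P-cong {p} {p′} {q} {q′} p≋ q≋ = coeffwise λ k →
    ≡.trans (coeff-+ p q k)
      (≡.trans (≡.cong₂ _+_ (coeff≡ p≋ k) (coeff≡ q≋ k)) (≡.sym (coeff-+ p′ q′ k)))

  +P-assoc : ∀ p q r → ((p +P q) +P r) ≋ (p +P (q +P r))
  +P-assoc p q r = coeffwise eq
    where
    eq : ((p +P q) +P r) ≈P (p +P (q +P r))
    eq k rewrite coeff-+ (p +P q) r k | coeff-+ p q k | coeff-+ p (q +P r) k | coeff-+ q r k
      = ℤₚ.+-assoc (coeff p k) _ _

  +P-comm : ∀ p q → (p +P q) ≋ (q +P p)
  +P-comm p q = coeffwise eq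
    where
    eq : (p +P q) ≈P (q +P p)
    eq k rewrite coeff-+ p q k | coeff-+ q p k = ℤₚ.+-comm (coeff p k) _

  +P-identityʳ : ∀ p → (p +P []) ≋ p
  +P-identityʳ p = +P-comm p []

  negP-cong : ∀ {p q} → p ≋ q → negP p ≋ negP q
  negP-cong {p} {q} p≋q = coeffwise λ k → ≡.trans (coeff-map -_ ≡.refl p k)
    (≡.trans (≡.cong -_ (coeff≡ p≋q k)) (≡.sym (coeff-map -_ ≡.refl q k)))

  +P-inverseʳ : ∀ p → (p +P negP p) ≋ []
  +P-inverseʳ p = coeffwise λ k → ≡.trans (coeff-+ p (negP p) k)
    (≡.trans (≡.cong (λ z → coeff p k + z) (coeff-map -_ ≡.refl p k)) (ℤₚ.+-inverseʳ (coeff p k)))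

  +P-interchange : ∀ p q r s → ((p +P q) +P (r +P s)) ≋ ((p +P r) +P (q +P s))
  +P-interchange p q r s = coeffwise eq
    where
    comm4 : ∀ a b c d → (a + b) + (c + d) ≡ (a + c) + (b + d)
    comm4 = ℤSolver.solve-∀
    eq : ((p +P q) +P (r +P s)) ≈P ((p +P r) +P (q +P s))
    eq k rewrite coeff-+ (p +P q) (r +P s) k | coeff-+ p q k | coeff-+ r s k
               | coeff-+ (p +P r) (q +P s) k | coeff-+ p r k | coeff-+ q s k
      = comm4 (coeff p k) (coeff q k) (coeff r k) (coeff s k)

  scale-cong : ∀ {a b p q} → a ≡ b → p ≋ q → scaleP a p ≋ scaleP b q
  scale-cong {a} {b} {p} {q} a≡b p≋q = coeffwise λ k → ≡.trans (coeff-scale a p k)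
    (≡.trans (≡.cong₂ _*_ a≡b (coeff≡ p≋q k)) (≡.sym (coeff-scale b q k)))

  scale-+ˡ : ∀ a b p → scaleP (a + b) p ≋ (scaleP a p +P scaleP b p)
  scale-+ˡ a b p = coeffwise eq
    where
    eq : scaleP (a + b) p ≈P (scaleP a p +P scaleP b p)
    eq k rewrite coeff-+ (scaleP a p) (scaleP b p) k
               | coeff-scale (a + b) p k | coeff-scale a p k | coeff-scale b p k
      = ℤₚ.*-distribʳ-+ (coeff p k) a b

  scale-+ʳ : ∀ a p q → scaleP a (p +P q) ≋ (scaleP a p +P scaleP a q)
  scale-+ʳ a p q = coeffwise eq
    where
    eq : scaleP a (p +P q) ≈P (scaleP a p +P scaleP a q)
    eq k rewrite coeff-+ (scaleP a p) (scaleP a q) k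
               | coeff-scale a (p +P q) k | coeff-+ p q k | coeff-scale a p k | coeff-scale a q k
      = ℤₚ.*-distribˡ-+ a (coeff p k) (coeff q k)

  scale-scale : ∀ a b p → scaleP (a * b) p ≋ scaleP a (scaleP b p)
  scale-scale a b p = coeffwise eq
    where
    eq : scaleP (a * b) p ≈P scaleP a (scaleP b p)
    eq k rewrite coeff-scale (a * b) p k | coeff-scale a (scaleP b p) k | coeff-scale b p k
      = ℤₚ.*-assoc a b (coeff p k)

  scale-0 : ∀ p → scaleP 0ℤ p ≋ []
  scale-0 p = coeffwise (coeff-scale 0ℤ p)

  scale-1 : ∀ p → scaleP 1ℤ p ≋ p
  scale-1 p = coeffwise λ k → ≡.trans (coeff-scale 1ℤ p k) (ℤₚ.*-identityˡ _)

  *P-congˡ : ∀ p {q r} → q ≋ r → (p *P q) ≋ (p *P r)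
  *P-congˡ []      q≋r = ≋-refl
  *P-congˡ (a ∷ p) q≋r = +P-cong (scale-cong {a} ≡.refl q≋r) (∷-cong ≡.refl (*P-congˡ p q≋r))

  0∷-*P : ∀ p q → ((0ℤ ∷ p) *P q) ≋ (0ℤ ∷ (p *P q))
  0∷-*P p q = +P-cong {scaleP 0ℤ q} {[]} (scale-0 q) ≋-refl

  *P-[] : ∀ p → (p *P []) ≋ []
  *P-[] []      = ≋-refl
  *P-[] (a ∷ p) = ≋-trans (∷-cong ≡.refl (*P-[] p)) 0∷[]≋[]

  *P-∷ : ∀ q a p → (q *P (a ∷ p)) ≋ (scaleP a q +P (0ℤ ∷ (q *P p)))
  *P-∷ []      a p = ≋-sym 0∷[]≋[]
  *P-∷ (b ∷ q) a p = ∷-cong (≡.cong (_+ 0ℤ) (ℤₚ.*-comm b a)) (≋-trans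
    (+P-cong {scaleP b p} ≋-refl (*P-∷ q a p))
    (≋-trans (≋-sym (+P-assoc (scaleP b p) (scaleP a q) (0ℤ ∷ (q *P p))))
    (≋-trans (+P-cong (+P-comm (scaleP b p) (scaleP a q)) ≋-refl)
             (+P-assoc (scaleP a q) (scaleP b p) (0ℤ ∷ (q *P p))))))

  *P-comm : ∀ p q → (p *P q) ≋ (q *P p)
  *P-comm []      q = ≋-sym (*P-[] q)
  *P-comm (a ∷ p) q = ≋-trans (+P-cong {scaleP a q} ≋-refl (∷-cong ≡.refl (*P-comm p q)))
                              (≋-sym (*P-∷ q a p))

  *P-cong : ∀ {p p′ q q′} → p ≋ p′ → q ≋ q′ → (p *P q) ≋ (p′ *P q′)
  *P-cong {p} {p′} {q} {q′} p≋ q≋ = ≋-trans (*P-congˡ p q≋)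
    (≋-trans (*P-comm p q′) (≋-trans (*P-congˡ q′ p≋) (*P-comm q′ p′)))

  *P-distribʳ : ∀ r p q → ((p +P q) *P r) ≋ ((p *P r) +P (q *P r))
  *P-distribʳ r []      q       = ≋-refl
  *P-distribʳ r (a ∷ p) []      = ≋-sym (+P-identityʳ _)
  *P-distribʳ r (a ∷ p) (b ∷ q) = ≋-trans
    (+P-cong (scale-+ˡ a b r) (∷-cong {0ℤ} ≡.refl (*P-distribʳ r p q)))
    (+P-interchange (scaleP a r) (scaleP b r) (0ℤ ∷ (p *P r)) (0ℤ ∷ (q *P r)))

  *P-distribˡ : ∀ r p q → (r *P (p +P q)) ≋ ((r *P p) +P (r *P q))
  *P-distribˡ r p q = ≋-trans (*P-comm r (p +P q))
    (≋-trans (*P-distribʳ r p q) (+P-cong (*P-comm p r) (*P-comm q r)))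

  scale-*P : ∀ a q r → (scaleP a q *P r) ≋ scaleP a (q *P r)
  scale-*P a []      r = ≋-refl
  scale-*P a (b ∷ q) r = ≋-trans
    (+P-cong (scale-scale a b r) (∷-cong (≡.sym (ℤₚ.*-zeroʳ a)) (scale-*P a q r)))
    (≋-sym (scale-+ʳ a (scaleP b r) (0ℤ ∷ (q *P r))))

  *P-assoc : ∀ p q r → ((p *P q) *P r) ≋ (p *P (q *P r))
  *P-assoc []      q r = ≋-refl
  *P-assoc (a ∷ p) q r = ≋-trans (*P-distribʳ r (scaleP a q) (0ℤ ∷ (p *P q)))
    (+P-cong (scale-*P a q r)
      (≋-trans (0∷-*P (p *P q) r) (∷-cong ≡.refl (*P-assoc p q r))))

  *P-identityˡ : ∀ p → (oneP *P p) ≋ p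
  *P-identityˡ p = ≋-trans (+P-cong (scale-1 p) 0∷[]≋[]) (+P-identityʳ p)

  polyRing : CommutativeRing 0ℓ 0ℓ
  polyRing = record
    { Carrier = Poly ; _≈_ = _≋_ ; _+_ = _+P_ ; _*_ = _*P_ ; -_ = negP ; 0# = [] ; 1# = oneP
    ; isCommutativeRing = record
      { isRing = record
        { +-isAbelianGroup = record
          { isGroup = record
            { isMonoid = record
              { isSemigroup = record
                { isMagma = record
                  { isEquivalence = record { refl = ≋-refl ; sym = ≋-sym ; trans = ≋-trans }
                  ; ∙-cong = +P-cong }
                ; assoc = +P-assoc }
              ; identity = (λ _ → ≋-refl) , +P-identityʳ }
            ; inverse = (λ p → ≋-trans (+P-comm (negP p) p) (+P-inverseʳ p)) , +P-inverseʳ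
            ; ⁻¹-cong = negP-cong }
          ; comm = +P-comm }
        ; *-cong = *P-cong
        ; *-assoc = *P-assoc
        ; *-identity = *P-identityˡ , (λ p → ≋-trans (*P-comm p oneP) (*P-identityˡ p))
        ; distrib = *P-distribˡ , *P-distribʳ }
      ; *-comm = *P-comm } }

  module 𝐏 where
    open CommutativeRing polyRing public hiding (zero)
    open RingTheory polyRing public
  open 𝐏 using (_^_; _⊗_; alt; _∥_; _⊥_)

  ^P≡^ : ∀ p k → p ^P k ≡ p ^ k
  ^P≡^ p zero    = ≡.refl
  ^P≡^ p (suc k) = ≡.cong (p *P_) (^P≡^ p k)

  X : Poly
  X = 0ℤ ∷ oneP

  X*P : ∀ p → (X *P p) ≋ (0ℤ ∷ p)
  X*P p = ≋-trans (0∷-*P oneP p) (∷-cong ≡.refl (*P-identityˡ p))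

  xPow≋X^ : ∀ i → xPow i ≋ X ^ i
  xPow≋X^ zero    = ≋-refl
  xPow≋X^ (suc i) = ≋-trans (∷-cong ≡.refl (xPow≋X^ i)) (≋-sym (X*P (X ^ i)))

  onePlusXPow≋ : ∀ i → onePlusXPow i ≋ oneP +P X ^ i
  onePlusXPow≋ i = +P-cong {oneP} ≋-refl (xPow≋X^ i)

  -- The coefficient `a` may be 0, so `d` is only a bound on the degree. This makes `Top`
  -- multiplicative without conditions.
  Top : Poly → ℕ → ℤ → Set
  Top p d a = coeff p d ≡ a × (∀ k → d < k → coeff p k ≡ 0ℤ)

  Top-resp : ∀ {p q d a} → p ≋ q → Top p d a → Top q d a
  Top-resp p≋q (top , above) =
    ≡.trans (≡.sym (coeff≡ p≋q _)) top , λ k d<k → ≡.trans (≡.sym (coeff≡ p≋q k)) (above k d<k)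

  Top-* : ∀ p q {d d′ a a′} → Top p d a → Top q d′ a′ → Top (p *P q) (d ℕ.+ d′) (a * a′)
  Top-* [] q (≡.refl , _) _ = ≡.refl , λ _ _ → ≡.refl
  Top-* (b ∷ p) q {zero} {d′} {a} {a′} (≡.refl , above) (top , above′) =
    Top-resp (≋-sym product) (≡.trans (coeff-scale b q d′) (≡.cong (b *_) top) ,
      λ k d′<k → ≡.trans (coeff-scale b q k) (≡.trans (≡.cong (b *_) (above′ k d′<k)) (ℤₚ.*-zeroʳ b)))
    where
    p≋0 : p ≋ []
    p≋0 = coeffwise λ k → above (suc k) (s≤s z≤n)
    product : ((b ∷ p) *P q) ≋ scaleP b q
    product = ≋-trans
      (+P-cong {scaleP b q} ≋-refl (≋-trans (∷-cong ≡.refl (*P-cong p≋0 (≋-refl {q}))) 0∷[]≋[]))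
      (+P-identityʳ _)
  Top-* (b ∷ p) q {suc d} {d′} {a} {a′} (top , above) (top′ , above′)
    with Top-* p q {d} {d′} {a} {a′} (top , λ k d<k → above (suc k) (s≤s d<k)) (top′ , above′)
  ... | topₚ , aboveₚ =
    ≡.trans (sum-coeff (d ℕ.+ d′) (s≤s (ℕₚ.m≤n+m d′ d))) topₚ , high
    where
    sum-coeff : ∀ k → d′ < suc k → coeff ((b ∷ p) *P q) (suc k) ≡ coeff (p *P q) k
    sum-coeff k d′<k = ≡.trans (coeff-+ (scaleP b q) (0ℤ ∷ (p *P q)) (suc k))
      (≡.trans (≡.cong (_+ coeff (p *P q) k) (≡.trans (coeff-scale b q (suc k))
        (≡.trans (≡.cong (b *_) (above′ (suc k) d′<k)) (ℤₚ.*-zeroʳ b)))) (ℤₚ.+-identityˡ _))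
    high : ∀ k → suc (d ℕ.+ d′) < k → coeff ((b ∷ p) *P q) k ≡ 0ℤ
    high (suc k) (s≤s lt) =
      ≡.trans (sum-coeff k (s≤s (ℕₚ.≤-trans (ℕₚ.m≤n+m d′ d) (ℕₚ.<⇒≤ lt)))) (aboveₚ k lt)

  Nonzero : Poly → Set
  Nonzero p = ∃₂ λ d a → a ≢ 0ℤ × Top p d a

  -- Finds the true leading coefficient: a list may end in zeros, so its length does not give the
  -- degree.
  zero-or-nonzero : ∀ p → p ≋ [] ⊎ Nonzero p
  zero-or-nonzero [] = inj₁ ≋-refl
  zero-or-nonzero (b ∷ p) with zero-or-nonzero p
  ... | inj₂ (d , a , a≢0 , top , above) =
    inj₂ (suc d , a , a≢0 , top , λ { (suc k) (s≤s lt) → above k lt })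
  ... | inj₁ p≋0 with b ℤ.≟ 0ℤ
  ...   | yes ≡.refl = inj₁ (≋-trans (∷-cong ≡.refl p≋0) 0∷[]≋[])
  ...   | no b≢0     = inj₂ (0 , b , b≢0 , ≡.refl , λ { (suc k) _ → coeff≡ p≋0 k })

  Top-degree-unique : ∀ {p d d′ a a′} → a ≢ 0ℤ → a′ ≢ 0ℤ → Top p d a → Top p d′ a′ → d ≡ d′
  Top-degree-unique a≢0 a′≢0 (top , above) (top′ , above′) = ℕₚ.≤-antisym
    (ℕₚ.≮⇒≥ λ d′<d → a≢0 (≡.trans (≡.sym top) (above′ _ d′<d)))
    (ℕₚ.≮⇒≥ λ d<d′ → a′≢0 (≡.trans (≡.sym top′) (above _ d<d′)))

  *≢0 : ∀ {a b} → a ≢ 0ℤ → b ≢ 0ℤ → a * b ≢ 0ℤ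
  *≢0 {a} a≢0 b≢0 ab≡0 with ℤₚ.i*j≡0⇒i≡0∨j≡0 a ab≡0
  ... | inj₁ a≡0 = a≢0 a≡0
  ... | inj₂ b≡0 = b≢0 b≡0

  1≢0 : 1ℤ ≢ 0ℤ
  1≢0 ()

  *P-nonzero : ∀ p q → Nonzero p → Nonzero q → Nonzero (p *P q)
  *P-nonzero p q (d , a , a≢0 , t) (d′ , a′ , a′≢0 , t′) =
    d ℕ.+ d′ , a * a′ , *≢0 a≢0 a′≢0 , Top-* p q {a = a} {a′ = a′} t t′

  nonzero-absurd : ∀ {p} → Nonzero p → p ≋ [] → ∀ {A : Set} → A
  nonzero-absurd (d , a , a≢0 , top , _) p≋0 = ⊥-elim (a≢0 (≡.trans (≡.sym top) (coeff≡ p≋0 d)))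

  Monic⇒Nonzero : ∀ {p} → Monic p → Nonzero p
  Monic⇒Nonzero (d , top) = d , 1ℤ , 1≢0 , top

  Monic-* : ∀ p q → Monic p → Monic q → Monic (p *P q)
  Monic-* p q (d , t) (d′ , t′) = d ℕ.+ d′ , Top-* p q {a = 1ℤ} {a′ = 1ℤ} t t′

  Monic-1 : Monic oneP
  Monic-1 = 0 , ≡.refl , λ { (suc k) _ → ≡.refl }

  Monic-^ : ∀ p → Monic p → ∀ k → Monic (p ^ k)
  Monic-^ p mp zero    = Monic-1
  Monic-^ p mp (suc k) = Monic-* p (p ^ k) mp (Monic-^ p mp k)

  difference-zero : ∀ {p q} → (p +P negP q) ≋ [] → p ≋ q
  difference-zero {p} {q} p-q≋0 = begin
    p                    ≈⟨ +P-identityʳ p ⟨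
    p +P []              ≈⟨ 𝐏.+-congˡ (𝐏.-‿inverseˡ q) ⟨
    p +P (negP q +P q)   ≈⟨ +P-assoc p (negP q) q ⟨
    (p +P negP q) +P q   ≈⟨ 𝐏.+-congʳ p-q≋0 ⟩
    q                    ∎
    where open SetoidReasoning 𝐏.setoid

  -- ℤ[x] is a domain: if `p - q` had a nonzero leading coefficient, then so would its product with
  -- `m`.
  *P-cancelʳ : ∀ {m p q} → Nonzero m → (p *P m) ≋ (q *P m) → p ≋ q
  *P-cancelʳ {m} {p} {q} m≢0 pm≋qm with zero-or-nonzero (p +P negP q)
  ... | inj₁ p-q≋0 = difference-zero p-q≋0
  ... | inj₂ p-q≢0 = nonzero-absurd (*P-nonzero (p +P negP q) m p-q≢0 m≢0) (begin
    (p +P negP q) *P m          ≈⟨ 𝐏.distribʳ m p (negP q) ⟩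
    (p *P m) +P (negP q *P m)   ≈⟨ 𝐏.+-cong pm≋qm (≋-sym (𝐏.-‿distribˡ-* q m)) ⟩
    (q *P m) +P negP (q *P m)   ≈⟨ +P-inverseʳ (q *P m) ⟩
    []                          ∎)
    where open SetoidReasoning 𝐏.setoid

  ⊗1≋ : ∀ k → (k ⊗ oneP) ≋ (+ k ∷ [])
  ⊗1≋ zero    = ≋-sym 0∷[]≋[]
  ⊗1≋ (suc k) = ≋-trans (+P-cong {oneP} ≋-refl (⊗1≋ k)) ≋-refl

  ⊗1-Top : ∀ k → Top (k ⊗ oneP) 0 (+ k)
  ⊗1-Top k = Top-resp (≋-sym (⊗1≋ k)) (≡.refl , λ { (suc k) _ → ≡.refl })

  +suc≢0 : ∀ {c} → + suc c ≢ 0ℤ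
  +suc≢0 ()

  -- Degrees add and the constant has degree 0, so `u` has degree 0 and leading coefficient 1.
  monic-∥-constant : ∀ {u c} → Monic u → u ∥ suc c ⊗ oneP → u ≋ oneP
  monic-∥-constant {u} {c} (d , top , above) (v , vu≋c) with zero-or-nonzero v
  ... | inj₁ v≋0 = nonzero-absurd (0 , + suc c , +suc≢0 , ⊗1-Top (suc c))
                     (≋-trans (≋-sym vu≋c) (*P-cong v≋0 (≋-refl {u})))
  ... | inj₂ (d′ , a , a≢0 , topᵥ) = coeffwise λ
    { zero    → ≡.trans (≡.cong (coeff u) (≡.sym d≡0)) top
    ; (suc k) → above (suc k) (≡.subst (_< suc k) (≡.sym d≡0) (s≤s z≤n)) }
    where
    d≡0 : d ≡ 0
    d≡0 = ℕₚ.m+n≡0⇒n≡0 d′ (Top-degree-unique {suc c ⊗ oneP} (*≢0 a≢0 1≢0) +suc≢0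
            (Top-resp vu≋c (Top-* v u {a = a} {a′ = 1ℤ} topᵥ (top , above))) (⊗1-Top (suc c)))

  Monic-quotient : ∀ {q m} → Monic m → Monic (q *P m) → Monic q
  Monic-quotient {q} {m} (d , tₘ) mqm@(e , t) with zero-or-nonzero q
  ... | inj₁ q≋0 = nonzero-absurd (Monic⇒Nonzero {q *P m} mqm) (*P-cong q≋0 (≋-refl {m}))
  ... | inj₂ (d′ , a , a≢0 , topq , aboveq)
    with Top-* q m {a = a} {a′ = 1ℤ} (topq , aboveq) tₘ
  ...   | tqm with Top-degree-unique {q *P m} (*≢0 a≢0 1≢0) 1≢0 tqm t
  ...     | ≡.refl = d′ ,
    ≡.trans topq (≡.trans (≡.sym (ℤₚ.*-identityʳ a)) (≡.trans (≡.sym (proj₁ tqm)) (proj₁ t))) , aboveq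

  -- No fractions arise because `m` is monic. The recursion is Horner's: divide the tail, multiply
  -- its remainder by x and add the constant term. The result can exceed the bound only in degree
  -- `d`, and a multiple of `m` clears that coefficient.
  divide : ∀ m {d} → Top m d 1ℤ → ∀ p →
           ∃₂ λ s r → p ≋ ((s *P m) +P r) × (∀ k → d ≤ k → coeff r k ≡ 0ℤ)
  divide m topm [] = [] , [] , ≋-refl , λ _ _ → ≡.refl
  divide m {d} topm@(top , above) (a ∷ p) with divide m topm p
  ... | s , r , p≋ , small = (0ℤ ∷ s) +P (b ∷ []) , r′ +P negP (scaleP b m) , eq , small′
    where
    open SetoidReasoning 𝐏.setoid
    r′ = a ∷ r
    b = coeff r′ d
    b*m : ((b ∷ []) *P m) ≋ scaleP b m
    b*m = ≋-trans (+P-cong {scaleP b m} ≋-refl 0∷[]≋[]) (+P-identityʳ _)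
    shifted : (a ∷ p) ≋ ((0ℤ ∷ (s *P m)) +P r′)
    shifted = ∷-cong (≡.sym (ℤₚ.+-identityˡ a)) p≋
    regroup : ∀ u v w → (u +P v) ≋ ((u +P w) +P (v +P negP w))
    regroup u v w = begin
      u +P v                        ≈⟨ +P-identityʳ _ ⟨
      (u +P v) +P []                ≈⟨ 𝐏.+-congˡ (+P-inverseʳ w) ⟨
      (u +P v) +P (w +P negP w)     ≈⟨ +P-interchange u v w (negP w) ⟩
      (u +P w) +P (v +P negP w)     ∎
    eq : (a ∷ p) ≋ ((((0ℤ ∷ s) +P (b ∷ [])) *P m) +P (r′ +P negP (scaleP b m)))
    eq = begin
      a ∷ p                            ≈⟨ shifted ⟩
      (0ℤ ∷ (s *P m)) +P r′            ≈⟨ regroup (0ℤ ∷ (s *P m)) r′ (scaleP b m) ⟩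
      ((0ℤ ∷ (s *P m)) +P scaleP b m) +P (r′ +P negP (scaleP b m))
        ≈⟨ 𝐏.+-congʳ (𝐏.+-cong (0∷-*P s m) b*m) ⟨
      (((0ℤ ∷ s) *P m) +P ((b ∷ []) *P m)) +P (r′ +P negP (scaleP b m))
        ≈⟨ 𝐏.+-congʳ (*P-distribʳ m (0ℤ ∷ s) (b ∷ [])) ⟨
      (((0ℤ ∷ s) +P (b ∷ [])) *P m) +P (r′ +P negP (scaleP b m)) ∎
    coeff-diff : ∀ k → coeff (r′ +P negP (scaleP b m)) k ≡ coeff r′ k + - (b * coeff m k)
    coeff-diff k = ≡.trans (coeff-+ r′ (negP (scaleP b m)) k) (≡.cong (λ z → coeff r′ k + z)
      (≡.trans (coeff-map -_ ≡.refl (scaleP b m) k) (≡.cong -_ (coeff-scale b m k))))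
    small′ : ∀ k → d ≤ k → coeff (r′ +P negP (scaleP b m)) k ≡ 0ℤ
    small′ k d≤k with ℕₚ.m≤n⇒m<n∨m≡n d≤k
    ... | inj₂ ≡.refl = ≡.trans (coeff-diff d) (≡.trans
      (≡.cong (λ z → b + - (b * z)) top) (≡.trans (≡.cong (λ z → b + - z) (ℤₚ.*-identityʳ b)) (ℤₚ.+-inverseʳ b)))
    small′ (suc k) d≤k | inj₁ (s≤s d≤k′) = ≡.trans (coeff-diff (suc k)) (≡.cong₂ (λ y z → y + - z)
      (small k d≤k′) (≡.trans (≡.cong (b *_) (above (suc k) (s≤s d≤k′))) (ℤₚ.*-zeroʳ b)))

  -- Stands in for Gauss's lemma. Let `r` be the remainder of `p` modulo `m`. Then `suc c` times `r`
  -- is a multiple of `m` whose coefficients vanish from the degree of `m` on, hence 0; and ℤ has no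
  -- torsion.
  monic-∥-primitive : ∀ {m c} → Monic m → ∀ p → m ∥ ((suc c ⊗ oneP) *P p) → m ∥ p
  monic-∥-primitive {m} {c} (d , topm) p (t , tm≋cp) with divide m topm p
  ... | s , r , p≋ , small = s , ≋-sym (≋-trans p≋ (≋-trans (𝐏.+-congˡ r≋0) (+P-identityʳ _)))
    where
    open SetoidReasoning 𝐏.setoid
    C = suc c ⊗ oneP
    v = t +P negP (C *P s)
    vm≋Cr : (v *P m) ≋ (C *P r)
    vm≋Cr = begin
      v *P m                                     ≈⟨ *P-distribʳ m t (negP (C *P s)) ⟩
      (t *P m) +P (negP (C *P s) *P m)           ≈⟨ 𝐏.+-cong tm≋cp (≋-sym (𝐏.-‿distribˡ-* (C *P s) m)) ⟩
      (C *P p) +P negP ((C *P s) *P m)           ≈⟨ 𝐏.+-cong (*P-congˡ C p≋) (negP-cong (*P-assoc C s m)) ⟩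
      (C *P ((s *P m) +P r)) +P negP (C *P (s *P m)) ≈⟨ 𝐏.+-congʳ (*P-distribˡ C (s *P m) r) ⟩
      ((C *P (s *P m)) +P (C *P r)) +P negP (C *P (s *P m)) ≈⟨ 𝐏.+-congʳ (+P-comm (C *P (s *P m)) (C *P r)) ⟩
      ((C *P r) +P (C *P (s *P m))) +P negP (C *P (s *P m)) ≈⟨ +P-assoc (C *P r) (C *P (s *P m)) _ ⟩
      (C *P r) +P ((C *P (s *P m)) +P negP (C *P (s *P m))) ≈⟨ 𝐏.+-congˡ (+P-inverseʳ (C *P (s *P m))) ⟩
      (C *P r) +P []                             ≈⟨ +P-identityʳ _ ⟩
      C *P r                                     ∎
    coeff-Cr : ∀ k → coeff (C *P r) k ≡ + suc c * coeff r k
    coeff-Cr k = ≡.trans (coeff≡ {C *P r} {scaleP (+ suc c) r} (≋-trans (*P-cong (⊗1≋ (suc c)) (≋-refl {r}))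
      (≋-trans (+P-cong {scaleP (+ suc c) r} ≋-refl 0∷[]≋[]) (+P-identityʳ _))) k)
      (coeff-scale (+ suc c) r k)
    Cr≋0 : (C *P r) ≋ []
    Cr≋0 with zero-or-nonzero v
    ... | inj₁ v≋0 = ≋-trans (≋-sym vm≋Cr) (*P-cong v≋0 (≋-refl {m}))
    ... | inj₂ (e , a , a≢0 , topv) = ⊥-elim (*≢0 a≢0 1≢0 (≡.trans
      (≡.sym (proj₁ (Top-resp vm≋Cr (Top-* v m {a = a} {a′ = 1ℤ} topv topm))))
      (≡.trans (coeff-Cr (e ℕ.+ d)) (≡.trans (≡.cong (+ suc c *_) (small _ (ℕₚ.m≤n+m d e))) (ℤₚ.*-zeroʳ (+ suc c))))))
    r≋0 : r ≋ []
    r≋0 with zero-or-nonzero r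
    ... | inj₁ r≋0 = r≋0
    ... | inj₂ r≢0 = nonzero-absurd (*P-nonzero C r (0 , + suc c , +suc≢0 , ⊗1-Top (suc c)) r≢0) Cr≋0

open Polynomials

-- Cyclotomic factors of 1 + x^i and their coprimality

module CyclotomicFactors where
  open 𝐏 using (_^_; _⊗_; alt; _∥_; _⊥_)

  even≢odd : ∀ i j → 2 ℕ.* i ≢ suc (2 ℕ.* j)
  even≢odd (suc i) zero    eq with ≡.trans (≡.sym (ℕₚ.+-suc i (i ℕ.+ 0))) (ℕₚ.suc-injective eq)
  ... | ()
  even≢odd (suc i) (suc j) eq = even≢odd i j (ℕₚ.suc-injective (ℕₚ.suc-injective
    (≡.trans (≡.sym (ℕₚ.*-suc 2 i)) (≡.trans eq (≡.cong suc (ℕₚ.*-suc 2 j))))))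

  infix 4 _◁_ _◁?_

  record _◁_ (e i : ℕ) : Set where
    constructor oddMultiple
    field
      half     : ℕ
      multiple : i ≡ e ℕ.* suc (2 ℕ.* half)

  _◁?_ : ∀ e i → Dec (e ◁ i)
  zero  ◁? zero  = yes (oddMultiple 0 ≡.refl)
  zero  ◁? suc i = no λ { (oddMultiple _ ()) }
  suc e ◁? i with suc e ∣? i
  ... | no  e∤i = no λ (oddMultiple j i≡) →
    e∤i (divides (suc (2 ℕ.* j)) (≡.trans i≡ (ℕₚ.*-comm (suc e) (suc (2 ℕ.* j)))))
  ... | yes (divides q i≡qe) with parity q
  ...   | inj₂ (j , q≡) = yes (oddMultiple j (≡.trans i≡qe (≡.trans (≡.cong (ℕ._* suc e) q≡) (ℕₚ.*-comm _ (suc e)))))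
  ...   | inj₁ (j , q≡) = no λ (oddMultiple j′ i≡) → even≢odd j j′ (ℕₚ.*-cancelʳ-≡ _ _ (suc e)
          (≡.trans (≡.cong (ℕ._* suc e) (≡.sym q≡)) (≡.trans (≡.sym i≡qe)
            (≡.trans i≡ (ℕₚ.*-comm (suc e) _)))))

  ◁-refl : ∀ e → e ◁ e
  ◁-refl e = oddMultiple 0 (≡.sym (ℕₚ.*-identityʳ e))

  ◁-trans : ∀ {d e i} → d ◁ e → e ◁ i → d ◁ i
  ◁-trans {d} (oddMultiple j ≡.refl) (oddMultiple k ≡.refl) = oddMultiple (k ℕ.+ j ℕ.* suc (2 ℕ.* k))
    (≡.trans (ℕₚ.*-assoc d (suc (2 ℕ.* j)) (suc (2 ℕ.* k))) (≡.cong (d ℕ.*_) (≡.cong suc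
      (≡.trans (≡.cong (2 ℕ.* k ℕ.+_) (ℕₚ.*-assoc 2 j (suc (2 ℕ.* k)))) (≡.sym (ℕₚ.*-distribˡ-+ 2 k _))))))

  ◁⇒≤ : ∀ {e i} → e ◁ i → e ≤ i
  ◁⇒≤ {e} (oddMultiple j ≡.refl) = ℕₚ.m≤m*n e (suc (2 ℕ.* j))

  indicator : ∀ {P : Set} → Dec P → ℕ
  indicator d = if does d then 1 else 0

  indicator-yes : ∀ {P : Set} (d : Dec P) → P → indicator d ≡ 1
  indicator-yes (yes _) p = ≡.refl
  indicator-yes (no ¬p) p = ⊥-elim (¬p p)

  indicator-no : ∀ {P : Set} (d : Dec P) → ¬ P → indicator d ≡ 0
  indicator-no (yes p) ¬p = ⊥-elim (¬p p)
  indicator-no (no _)  ¬p = ≡.refl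

  indicator-mono : ∀ {P Q : Set} (d : Dec P) (d′ : Dec Q) → (P → Q) → indicator d ≤ indicator d′
  indicator-mono (no _)  d′ P⇒Q = z≤n
  indicator-mono (yes p) d′ P⇒Q rewrite indicator-yes d′ (P⇒Q p) = ℕₚ.≤-refl

  -- The exponent of `Ψ e` in `1 + x^i`.
  χ : ℕ → ℕ → ℕ
  χ e i = indicator (e ◁? i)

  χ-yes : ∀ {e i} → e ◁ i → χ e i ≡ 1
  χ-yes {e} {i} = indicator-yes (e ◁? i)

  χ-no : ∀ {e i} → ¬ e ◁ i → χ e i ≡ 0
  χ-no {e} {i} = indicator-no (e ◁? i)

  ∏ : ℕ → (ℕ → Poly) → Poly
  ∏ zero    F = oneP
  ∏ (suc n) F = ∏ n F *P F (suc n)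

  ∏-cong : ∀ n {F G} → (∀ h → 1 ≤ h → h ≤ n → F h ≋ G h) → ∏ n F ≋ ∏ n G
  ∏-cong zero    F≋G = ≋-refl
  ∏-cong (suc n) F≋G =
    *P-cong (∏-cong n λ h 1≤h h≤n → F≋G h 1≤h (ℕₚ.m≤n⇒m≤1+n h≤n)) (F≋G (suc n) (s≤s z≤n) ℕₚ.≤-refl)

  ∏-* : ∀ n F G → (∏ n F *P ∏ n G) ≋ ∏ n (λ h → F h *P G h)
  ∏-* zero    F G = ≋-refl
  ∏-* (suc n) F G = ≋-trans
    (𝐏.solve 4 (λ a b c d → (a 𝐏.:* b) 𝐏.:* (c 𝐏.:* d) 𝐏.:= (a 𝐏.:* c) 𝐏.:* (b 𝐏.:* d)) ≋-refl
      (∏ n F) (F (suc n)) (∏ n G) (G (suc n)))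
    (𝐏.*-congʳ (∏-* n F G))

  ∏-1 : ∀ n → ∏ n (λ _ → oneP) ≋ oneP
  ∏-1 zero    = ≋-refl
  ∏-1 (suc n) = ≋-trans (𝐏.*-identityʳ _) (∏-1 n)

  ∏-^ : ∀ n F k → (∏ n F ^ k) ≋ ∏ n (λ h → F h ^ k)
  ∏-^ n F zero    = ≋-sym (∏-1 n)
  ∏-^ n F (suc k) = ≋-trans (*P-congˡ (∏ n F) (∏-^ n F k)) (∏-* n F (λ h → F h ^ k))

  ∥-∏ : ∀ n F {h} → 1 ≤ h → h ≤ n → F h ∥ ∏ n F
  ∥-∏ zero    F (s≤s z≤n) ()
  ∥-∏ (suc n) F {h} 1≤h h≤n with ℕₚ.m≤n⇒m<n∨m≡n h≤n
  ... | inj₂ ≡.refl     = ∏ n F , ≋-refl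
  ... | inj₁ (s≤s h≤n′) = 𝐏.∥-trans (∥-∏ n F 1≤h h≤n′) (F (suc n) , *P-comm (F (suc n)) _)

  ∏-Monic : ∀ n F → (∀ h → Monic (F h)) → Monic (∏ n F)
  ∏-Monic zero    F mF = Monic-1
  ∏-Monic (suc n) F mF = Monic-* (∏ n F) (F (suc n)) (∏-Monic n F mF) (mF (suc n))

  ⊥-∏ : ∀ n F {a} → (∀ h → 1 ≤ h → h ≤ n → a ⊥ F h) → a ⊥ ∏ n F
  ⊥-∏ zero    F a⊥F = 𝐏.⊥-1 _
  ⊥-∏ (suc n) F a⊥F = 𝐏.⊥-* (⊥-∏ n F λ h 1≤h h≤n → a⊥F h 1≤h (ℕₚ.m≤n⇒m≤1+n h≤n))
                              (a⊥F (suc n) (s≤s z≤n) ℕₚ.≤-refl)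

  xPow-Top : ∀ i → Top (xPow i) i 1ℤ
  xPow-Top zero    = ≡.refl , λ { (suc k) _ → ≡.refl }
  xPow-Top (suc i) with xPow-Top i
  ... | top , above = top , λ { (suc k) (s≤s lt) → above k lt }

  Monic-resp : ∀ {p q} → p ≋ q → Monic p → Monic q
  Monic-resp p≋q (d , top) = d , Top-resp p≋q top

  1+X^-Monic : ∀ i → 1 ≤ i → Monic (oneP +P X ^ i)
  1+X^-Monic (suc i) _ with xPow-Top i
  ... | top , above = Monic-resp (onePlusXPow≋ (suc i))
    (suc i , top , λ { (suc k) (s≤s lt) → above k lt })

  1+X^-∥ : ∀ {e i} → e ◁ i → (oneP +P X ^ e) ∥ (oneP +P X ^ i)
  1+X^-∥ {e} (oddMultiple j ≡.refl) = alt k (X ^ e) , (begin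
    alt k (X ^ e) *P (oneP +P X ^ e) ≈⟨ *P-comm (alt k (X ^ e)) _ ⟩
    (oneP +P X ^ e) *P alt k (X ^ e) ≈⟨ 𝐏.1+^odd (X ^ e) j ⟨
    oneP +P (X ^ e) ^ k              ≈⟨ 𝐏.+-congˡ {oneP} (𝐏.^-assocʳ X e k) ⟩
    oneP +P X ^ (e ℕ.* k)            ∎)
    where
    open SetoidReasoning 𝐏.setoid
    k = suc (2 ℕ.* j)

  -- Ψ e is the cyclotomic polynomial Φ₂ₑ: as Φ_d ∣ 1+xⁱ iff d ∣ 2i and d ∤ i, the factors
  -- of 1+xⁱ are the Φ₂ₑ with e ◁ i.
  record Cyclotomic (N : ℕ) : Set where
    field
      Ψ       : ℕ → Poly
      Ψ-Monic : ∀ h → Monic (Ψ h)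
    W : (ℕ → ℕ) → Poly
    W f = ∏ N (λ h → Ψ h ^ f h)
    field
      -- Besides monicity, this factorisation is all that is assumed of `Ψ`. Divisibility and
      -- coprimality are drawn from it, without irreducibility or complex roots.
      1+X^≋W  : ∀ i → 1 ≤ i → i ≤ N → (oneP +P X ^ i) ≋ W (λ h → χ h i)

    W-cong : ∀ {f g} → (∀ h → 1 ≤ h → h ≤ N → f h ≡ g h) → W f ≋ W g
    W-cong f≡g = ∏-cong N λ h 1≤h h≤N → 𝐏.^-congʳ (Ψ h) (f≡g h 1≤h h≤N)

    W-+ : ∀ f g → (W f *P W g) ≋ W (λ h → f h ℕ.+ g h)
    W-+ f g = ≋-trans (∏-* N _ _) (∏-cong N λ h _ _ → ≋-sym (𝐏.^-homo-* (Ψ h) (f h) (g h)))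

    W-* : ∀ f k → (W f ^ k) ≋ W (λ h → f h ℕ.* k)
    W-* f k = ≋-trans (∏-^ N _ k) (∏-cong N λ h _ _ → 𝐏.^-assocʳ (Ψ h) (f h) k)

    W-0 : ∀ {f} → (∀ h → 1 ≤ h → h ≤ N → f h ≡ 0) → W f ≋ oneP
    W-0 f≡0 = ≋-trans (W-cong f≡0) (∏-1 N)

    W-Monic : ∀ f → Monic (W f)
    W-Monic f = ∏-Monic N _ λ h → Monic-^ (Ψ h) (Ψ-Monic h) (f h)

    W-Nonzero : ∀ f → Nonzero (W f)
    W-Nonzero f = Monic⇒Nonzero {W f} (W-Monic f)

    Ψ-∥-W : ∀ f {h} → 1 ≤ h → h ≤ N → 1 ≤ f h → Ψ h ∥ W f
    Ψ-∥-W f {h} 1≤h h≤N 1≤fh with f h in eq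
    Ψ-∥-W f {h} 1≤h h≤N () | zero
    ... | suc k = 𝐏.∥-trans (Ψ h ^ k , *P-comm (Ψ h ^ k) (Ψ h))
      (≡.subst (λ m → (Ψ h ^ m) ∥ W f) eq (∥-∏ N (λ i → Ψ i ^ f i) 1≤h h≤N))

    Ψ-∥-1+X^ : ∀ {e} → 1 ≤ e → e ≤ N → Ψ e ∥ (oneP +P X ^ e)
    Ψ-∥-1+X^ {e} 1≤e e≤N = 𝐏.∥-respʳ (≋-sym (1+X^≋W e 1≤e e≤N))
      (Ψ-∥-W (λ h → χ h e) 1≤e e≤N (ℕₚ.≤-reflexive (≡.sym (χ-yes (◁-refl e)))))

    -- The sum is `(1 + x^e) / (1 + x^g)`, in which `Ψ h` has exponent `χ h e - χ h g`. At `h = e`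
    -- this is 1, because `g < e` excludes `e ◁ g`.
    Ψ-∥-alt : ∀ {e} → 1 ≤ e → e ≤ N → ∀ g j → e ≡ g ℕ.* suc (2 ℕ.* suc j) →
              Ψ e ∥ alt (suc (2 ℕ.* suc j)) (X ^ g)
    Ψ-∥-alt {e} 1≤e e≤N zero j e≡0 = ⊥-elim (ℕₚ.<⇒≢ 1≤e (≡.sym e≡0))
    Ψ-∥-alt {e} 1≤e e≤N g@(suc _) j e≡ = 𝐏.∥-respʳ quotient≋
      (Ψ-∥-W f 1≤e e≤N (ℕₚ.≤-reflexive (≡.sym (≡.cong₂ _∸_ (χ-yes (◁-refl e)) (χ-no {e} {g} λ e◁g → ℕₚ.<⇒≱ g<e (◁⇒≤ e◁g))))))
      where
      open SetoidReasoning 𝐏.setoid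
      k = suc (2 ℕ.* suc j)
      f : ℕ → ℕ
      f h = χ h e ∸ χ h g
      g◁e : g ◁ e
      g◁e = oddMultiple (suc j) e≡
      g<e : g < e
      g<e = ≡.subst (g <_) (≡.sym e≡) (ℕₚ.m<m*n g k (s≤s (s≤s z≤n)))
      g≤N = ℕₚ.≤-trans (ℕₚ.<⇒≤ g<e) e≤N
      quotient≋ : W f ≋ alt k (X ^ g)
      quotient≋ = *P-cancelʳ {W (λ h → χ h g)} (W-Nonzero (λ h → χ h g)) (begin
        W f *P W (λ h → χ h g)        ≈⟨ W-+ f _ ⟩
        W (λ h → f h ℕ.+ χ h g)
          -- The subtraction in `f` does not truncate: `h ◁ g` and `g ◁ e` give `h ◁ e`.
          ≈⟨ W-cong (λ h _ _ → ℕₚ.m∸n+n≡m (indicator-mono (h ◁? g) (h ◁? e) λ h◁g → ◁-trans h◁g g◁e)) ⟩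
        W (λ h → χ h e)               ≈⟨ 1+X^≋W e 1≤e e≤N ⟨
        oneP +P X ^ e                 ≈⟨ 𝐏.+-congˡ {oneP} (𝐏.^-congʳ X e≡) ⟩
        oneP +P X ^ (g ℕ.* k)         ≈⟨ 𝐏.+-congˡ {oneP} (𝐏.^-assocʳ X g k) ⟨
        oneP +P (X ^ g) ^ k           ≈⟨ 𝐏.1+^odd (X ^ g) (suc j) ⟩
        (oneP +P X ^ g) *P alt k (X ^ g) ≈⟨ *P-comm (oneP +P X ^ g) _ ⟩
        alt k (X ^ g) *P (oneP +P X ^ g) ≈⟨ *P-congˡ (alt k (X ^ g)) (1+X^≋W g (s≤s z≤n) g≤N) ⟩
        alt k (X ^ g) *P W (λ h → χ h g) ∎)

    Ψ-⊥ : ∀ {e f} → 1 ≤ e → e ≤ N → 1 ≤ f → f ≤ N → e ≢ f → Ψ e ⊥ Ψ f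
    Ψ-⊥ {e} {f} 1≤e e≤N 1≤f f≤N e≢f =
      distinct-orders-⊥ polyRing (Ψ e) (Ψ f) X e f e≢f (Ψ-∥-1+X^ 1≤e e≤N) (Ψ-∥-1+X^ 1≤f f≤N)
        (Ψ-∥-alt 1≤e e≤N) (Ψ-∥-alt 1≤f f≤N)

    -- Needed for `i = N + 1`, which the factorisation does not cover yet. Each `Ψ h` with `h ◁ i`
    -- divides `1 + x^h`, hence `1 + x^i`. By pairwise coprimality the product of these `Ψ h`
    -- divides a constant multiple of `1 + x^i`, and monicity drops the constant.
    W-∥-1+X^ : ∀ i → 1 ≤ i → W (λ h → χ h i) ∥ (oneP +P X ^ i)
    W-∥-1+X^ i 1≤i = go N ℕₚ.≤-refl
      where
      F : ℕ → Poly
      F h = Ψ h ^ χ h i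
      F-∥ : ∀ h → 1 ≤ h → h ≤ N → F h ∥ (oneP +P X ^ i)
      F-∥ h 1≤h h≤N with h ◁? i
      ... | no  _   = (oneP +P X ^ i) , 𝐏.*-identityʳ (oneP +P X ^ i)
      ... | yes h◁i = 𝐏.∥-trans (oneP , ≋-trans (*P-identityˡ (Ψ h ^ 1)) (𝐏.*-identityʳ (Ψ h)))
                        (𝐏.∥-trans (Ψ-∥-1+X^ 1≤h h≤N) (1+X^-∥ h◁i))
      go : ∀ k → k ≤ N → ∏ k F ∥ (oneP +P X ^ i)
      go zero    _   = (oneP +P X ^ i) , 𝐏.*-identityʳ (oneP +P X ^ i)
      go (suc k) k<N = combine (𝐏.coprime-∥ ∏k⊥F (go k (ℕₚ.<⇒≤ k<N)) (F-∥ (suc k) (s≤s z≤n) k<N))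
        where
        ∏k⊥F : ∏ k F ⊥ F (suc k)
        ∏k⊥F = 𝐏.⊥-sym (⊥-∏ k F λ h 1≤h h≤k →
          𝐏.⊥-^ (𝐏.⊥-sym (𝐏.⊥-^ (Ψ-⊥ 1≤h (ℕₚ.≤-trans h≤k (ℕₚ.<⇒≤ k<N)) (s≤s z≤n) k<N
            (ℕₚ.<⇒≢ (s≤s h≤k))) (χ (suc k) i))) (χ h i))
        combine : (∃ λ c → ∏ (suc k) F ∥ ((suc c ⊗ oneP) *P (oneP +P X ^ i))) →
                  ∏ (suc k) F ∥ (oneP +P X ^ i)
        combine (c , divides-multiple) = monic-∥-primitive {∏ (suc k) F} {c}
          (∏-Monic (suc k) F λ h → Monic-^ (Ψ h) (Ψ-Monic h) (χ h i)) (oneP +P X ^ i) divides-multiple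

  -- The new polynomial is whatever is missing: the quotient of `1 + x^(N+1)` by the product of the
  -- earlier `Ψ h` with `h ◁ N + 1`. The old factorisations persist, since `N + 1 ◁ i` fails for
  -- `i ≤ N`.
  cyclotomic-suc : ∀ {N} → Cyclotomic N → Cyclotomic (suc N)
  cyclotomic-suc {N} C = record
    { Ψ = Ψ′
    ; Ψ-Monic = Ψ′-Monic
    ; 1+X^≋W = factorisation }
    where
    open Cyclotomic C
    open SetoidReasoning 𝐏.setoid
    M = W (λ h → χ h (suc N))
    new = proj₁ (W-∥-1+X^ (suc N) (s≤s z≤n))
    new*M : (new *P M) ≋ (oneP +P X ^ suc N)
    new*M = proj₂ (W-∥-1+X^ (suc N) (s≤s z≤n))
    new-Monic : Monic new
    new-Monic = Monic-quotient {new} {M} (W-Monic (λ h → χ h (suc N)))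
      (Monic-resp (≋-sym new*M) (1+X^-Monic (suc N) (s≤s z≤n)))
    Ψ′ : ℕ → Poly
    Ψ′ h with h ℕ.≟ suc N
    ... | yes _ = new
    ... | no  _ = Ψ h
    Ψ′-Monic : ∀ h → Monic (Ψ′ h)
    Ψ′-Monic h with h ℕ.≟ suc N
    ... | yes _ = new-Monic
    ... | no  _ = Ψ-Monic h
    Ψ′-old : ∀ h → h ≤ N → Ψ′ h ≡ Ψ h
    Ψ′-old h h≤N with h ℕ.≟ suc N
    ... | yes ≡.refl = ⊥-elim (ℕₚ.<-irrefl ≡.refl h≤N)
    ... | no  _      = ≡.refl
    Ψ′-new : Ψ′ (suc N) ≡ new
    Ψ′-new with suc N ℕ.≟ suc N
    ... | yes _ = ≡.refl
    ... | no  n≢n = ⊥-elim (n≢n ≡.refl)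
    old-part : ∀ i → ∏ N (λ h → Ψ′ h ^ χ h i) ≋ W (λ h → χ h i)
    old-part i = ∏-cong N λ h _ h≤N → 𝐏.reflexive (≡.cong (_^ χ h i) (Ψ′-old h h≤N))
    factorisation : ∀ i → 1 ≤ i → i ≤ suc N → (oneP +P X ^ i) ≋ ∏ (suc N) (λ h → Ψ′ h ^ χ h i)
    factorisation i 1≤i i≤sN with ℕₚ.m≤n⇒m<n∨m≡n i≤sN
    ... | inj₁ (s≤s i≤N) = begin
      oneP +P X ^ i                                      ≈⟨ 1+X^≋W i 1≤i i≤N ⟩
      W (λ h → χ h i)                                    ≈⟨ old-part i ⟨
      ∏ N (λ h → Ψ′ h ^ χ h i)                           ≈⟨ 𝐏.*-identityʳ _ ⟨
      ∏ N (λ h → Ψ′ h ^ χ h i) *P oneP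
        ≈⟨ *P-congˡ (∏ N (λ h → Ψ′ h ^ χ h i)) (𝐏.^-congʳ (Ψ′ (suc N)) (χ-no {suc N} {i} λ N◁i → ℕₚ.<⇒≱ (s≤s i≤N) (◁⇒≤ N◁i))) ⟨
      ∏ N (λ h → Ψ′ h ^ χ h i) *P Ψ′ (suc N) ^ χ (suc N) i ∎
    ... | inj₂ ≡.refl = begin
      oneP +P X ^ i                                      ≈⟨ new*M ⟨
      new *P M                                           ≈⟨ *P-comm new M ⟩
      M *P new                                           ≈⟨ 𝐏.*-cong (old-part i) (𝐏.*-identityʳ new) ⟨
      ∏ N (λ h → Ψ′ h ^ χ h i) *P new ^ 1
        ≈⟨ *P-congˡ (∏ N (λ h → Ψ′ h ^ χ h i)) (𝐏.^-cong (𝐏.reflexive (≡.sym Ψ′-new)) (≡.sym (χ-yes (◁-refl i)))) ⟩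
      ∏ N (λ h → Ψ′ h ^ χ h i) *P Ψ′ (suc N) ^ χ (suc N) i ∎

  cyclotomic : ∀ N → Cyclotomic N
  cyclotomic zero    = record
    { Ψ = λ _ → oneP ; Ψ-Monic = λ _ → Monic-1 ; 1+X^≋W = λ { _ (s≤s z≤n) () } }
  cyclotomic (suc N) = cyclotomic-suc (cyclotomic N)

open CyclotomicFactors

-- Partitions, exponents of the cyclotomic factors, and the monic gcd

module Partitions where
  open 𝐏 using (_^_; _⊗_; _∥_; _⊥_)

  record Partition (n m : ℕ) (l : List ℕ) : Set where
    constructor partition
    field
      sum≡  : sum l ≡ n
      parts : All (λ p → 1 ≤ p × p ≤ m) l

  sum-replicate : ∀ k p → sum (replicate k p) ≡ k ℕ.* p
  sum-replicate zero    p = ≡.refl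
  sum-replicate (suc k) p = ≡.cong (p ℕ.+_) (sum-replicate k p)

  upTo-/-bound : ∀ {n m k} → k < suc (n / suc m) → k ℕ.* suc m ≤ n
  upTo-/-bound {n} {m} (s≤s k≤) = ℕₚ.≤-trans (ℕₚ.*-monoˡ-≤ (suc m) k≤) (DivMod.m/n*n≤m n (suc m))

  Partition-++ : ∀ {n m} k → k ℕ.* suc m ≤ n → ∀ {l} → Partition (n ∸ k ℕ.* suc m) m l →
                 Partition n (suc m) (replicate k (suc m) ++ l)
  Partition-++ {n} {m} k km≤n {l} (partition eq ps) = partition
    (≡.trans (sum-++ (replicate k (suc m)) l)
      (≡.trans (≡.cong₂ ℕ._+_ (sum-replicate k (suc m)) eq) (ℕₚ.m+[n∸m]≡n km≤n)))
    (Allₚ.++⁺ (Allₚ.replicate⁺ k (s≤s z≤n , ℕₚ.≤-refl))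
      (All.map (λ (1≤p , p≤m) → 1≤p , ℕₚ.m≤n⇒m≤1+n p≤m) ps))

  partsLe-Partition : ∀ n m → All (Partition n m) (partsLe n m)
  partsLe-Partition zero    zero = partition ≡.refl [] ∷ []
  partsLe-Partition (suc n) zero = []
  partsLe-Partition n (suc m) = Allₚ.concat⁺ (Allₚ.map⁺ (All.map
    (λ {k} k< → Allₚ.map⁺ (All.map (Partition-++ {n} {m} k (upTo-/-bound {n} {m} k<))
      (partsLe-Partition (n ∸ k ℕ.* suc m) m)))
    (Allₚ.all-upTo (suc (n / suc m)))))

  ∈-partsLe-++ : ∀ {n m l} k → k ≤ n / suc m → l ∈ partsLe (n ∸ k ℕ.* suc m) m →
                 (replicate k (suc m) ++ l) ∈ partsLe n (suc m)
  ∈-partsLe-++ {n} {m} k k≤ l∈ =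
    ∈-concatMap⁺ (λ k → map (replicate k (suc m) ++_) (partsLe (n ∸ k ℕ.* suc m) m))
      (lose (∈-upTo⁺ (s≤s k≤)) (∈-map⁺ (replicate k (suc m) ++_) l∈))

  ∈-partsLe-weaken : ∀ {n m m′ l} → m ≤ m′ → l ∈ partsLe n m → l ∈ partsLe n m′
  ∈-partsLe-weaken {m′ = zero}  z≤n  l∈ = l∈
  ∈-partsLe-weaken {n} {m′ = suc m′} m≤m′ l∈ with ℕₚ.m≤n⇒m<n∨m≡n m≤m′
  ... | inj₂ ≡.refl     = l∈
  ... | inj₁ (s≤s m≤m″) = ∈-partsLe-++ {n} {m′} 0 z≤n (∈-partsLe-weaken m≤m″ l∈)

  partsLe-inhabited : ∀ r m → r ≤ m → ∃ λ l → l ∈ partsLe r m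
  partsLe-inhabited zero    zero    _   = [] , here ≡.refl
  partsLe-inhabited r       (suc m) r≤m with ℕₚ.m≤n⇒m<n∨m≡n r≤m
  ... | inj₁ (s≤s r≤m′) with partsLe-inhabited r m r≤m′
  ...   | l , l∈ = l , ∈-partsLe-weaken (ℕₚ.n≤1+n m) l∈
  partsLe-inhabited r (suc m) r≤m | inj₂ ≡.refl with partsLe-inhabited 0 m z≤n
  ...   | l , l∈ = replicate 1 (suc m) ++ l ,
    ∈-partsLe-++ 1 (ℕₚ.≤-reflexive (≡.sym (DivMod.n/n≡1 (suc m))))
      (≡.subst (λ r → l ∈ partsLe r m)
        (≡.sym (≡.trans (≡.cong (suc m ∸_) (ℕₚ.*-identityˡ (suc m))) (ℕₚ.n∸n≡0 (suc m)))) l∈)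

  -- The remainder `n % suc e` is at most `e`, so parts up to `e` complete the list. These
  -- partitions attain the bound on `A (suc e)` and witness that `Ψ (suc e)` divides no common
  -- factor of the `q l`.
  many-parts : ∀ n e → suc e ≤ n → ∃ λ l → (replicate (n / suc e) (suc e) ++ l) ∈ partitions n
  many-parts n e e<n with partsLe-inhabited (n % suc e) e (ℕₚ.≤-pred (DivMod.m%n<n n (suc e)))
  ... | l , l∈ = l , ∈-partsLe-weaken e<n (∈-partsLe-++ (n / suc e) ℕₚ.≤-refl
    (≡.subst (λ r → l ∈ partsLe r e) (DivMod.m%n≡m∸m/n*n n (suc e)) l∈))

  Σ : ℕ → (ℕ → ℕ) → ℕ
  Σ zero    f = 0
  Σ (suc n) f = Σ n f ℕ.+ f (suc n)

  Σ-cong : ∀ n {f g} → (∀ i → 1 ≤ i → i ≤ n → f i ≡ g i) → Σ n f ≡ Σ n g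
  Σ-cong zero    f≡g = ≡.refl
  Σ-cong (suc n) f≡g = ≡.cong₂ ℕ._+_ (Σ-cong n λ i 1≤i i≤n → f≡g i 1≤i (ℕₚ.m≤n⇒m≤1+n i≤n))
                                     (f≡g (suc n) (s≤s z≤n) ℕₚ.≤-refl)

  Σ-+ : ∀ n f g → Σ n f ℕ.+ Σ n g ≡ Σ n (λ i → f i ℕ.+ g i)
  Σ-+ zero    f g = ≡.refl
  Σ-+ (suc n) f g = ≡.trans (comm4 (Σ n f) (f (suc n)) (Σ n g) (g (suc n)))
                            (≡.cong (ℕ._+ (f (suc n) ℕ.+ g (suc n))) (Σ-+ n f g))
    where
    comm4 : ∀ a b c d → (a ℕ.+ b) ℕ.+ (c ℕ.+ d) ≡ (a ℕ.+ c) ℕ.+ (b ℕ.+ d)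
    comm4 = ℕSolver.solve-∀

  Σ-0 : ∀ n {f} → (∀ i → 1 ≤ i → i ≤ n → f i ≡ 0) → Σ n f ≡ 0
  Σ-0 zero    f≡0 = ≡.refl
  Σ-0 (suc n) f≡0 = ≡.cong₂ ℕ._+_ (Σ-0 n λ i 1≤i i≤n → f≡0 i 1≤i (ℕₚ.m≤n⇒m≤1+n i≤n))
                                  (f≡0 (suc n) (s≤s z≤n) ℕₚ.≤-refl)

  Σ-single : ∀ n {f p} → 1 ≤ p → p ≤ n → (∀ i → i ≢ p → f i ≡ 0) → Σ n f ≡ f p
  Σ-single zero    (s≤s z≤n) () _
  Σ-single (suc n) {f} {p} 1≤p p≤n f≡0 with ℕₚ.m≤n⇒m<n∨m≡n p≤n
  ... | inj₂ ≡.refl     = ≡.cong (ℕ._+ f p) (Σ-0 n λ i _ i≤n → f≡0 i (ℕₚ.<⇒≢ (s≤s i≤n)))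
  ... | inj₁ (s≤s p≤n′) = ≡.trans
    (≡.cong₂ ℕ._+_ (Σ-single n 1≤p p≤n′ f≡0) (f≡0 (suc n) (ℕₚ.>⇒≢ (s≤s p≤n′)))) (ℕₚ.+-identityʳ (f p))

  ≤-Σ : ∀ n f {p} → 1 ≤ p → p ≤ n → f p ≤ Σ n f
  ≤-Σ zero    f (s≤s z≤n) ()
  ≤-Σ (suc n) f {p} 1≤p p≤n with ℕₚ.m≤n⇒m<n∨m≡n p≤n
  ... | inj₂ ≡.refl     = ℕₚ.m≤n+m (f p) (Σ n f)
  ... | inj₁ (s≤s p≤n′) = ℕₚ.≤-trans (≤-Σ n f 1≤p p≤n′) (ℕₚ.m≤m+n (Σ n f) (f (suc n)))

  -- ⌊n/h⌋ made total in `h`, as the exponent functions of `W` take every natural number.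
  quot : ℕ → ℕ → ℕ
  quot n zero    = 0
  quot n (suc h) = n / suc h

  ≤-quot : ∀ {a n h} → 1 ≤ h → h ℕ.* a ≤ n → a ≤ quot n h
  ≤-quot {a} {n} {suc h} _ ha≤n = ℕₚ.≤-trans
    (ℕₚ.≤-reflexive (≡.sym (DivMod.m*n/n≡m a (suc h))))
    (DivMod./-monoˡ-≤ (suc h) (≡.subst (_≤ n) (ℕₚ.*-comm (suc h) a) ha≤n))

  quot-large : ∀ {n h} → n < h → quot n h ≡ 0
  quot-large {h = suc h} n<h = DivMod.m<n⇒m/n≡0 n<h

  A : ℕ → List ℕ → ℕ
  A h l = sum (map (χ h) l)

  A-++ : ∀ h k l → A h (k ++ l) ≡ A h k ℕ.+ A h l
  A-++ h k l = ≡.trans (≡.cong sum (Listₚ.map-++ (χ h) k l)) (sum-++ (map (χ h) k) _)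

  A-replicate : ∀ h k p → A h (replicate k p) ≡ k ℕ.* χ h p
  A-replicate h k p = ≡.trans (≡.cong sum (Listₚ.map-replicate (χ h) k p)) (sum-replicate k (χ h p))

  *χ≤ : ∀ h p → h ℕ.* χ h p ≤ p
  *χ≤ h p with h ◁? p
  ... | yes h◁p = ≡.subst (_≤ p) (≡.sym (ℕₚ.*-identityʳ h)) (◁⇒≤ h◁p)
  ... | no  _   = ≡.subst (_≤ p) (≡.sym (ℕₚ.*-zeroʳ h)) z≤n

  -- Each counted part `p` has `h ◁ p` and so is at least `h`. This yields the bound ⌊n/h⌋ on
  -- `A h l`.
  *A≤sum : ∀ h l → h ℕ.* A h l ≤ sum l
  *A≤sum h []      = ≡.subst (_≤ 0) (≡.sym (ℕₚ.*-zeroʳ h)) z≤n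
  *A≤sum h (p ∷ l) = ≡.subst (_≤ p ℕ.+ sum l) (≡.sym (ℕₚ.*-distribˡ-+ h (χ h p) (A h l)))
    (ℕₚ.+-mono-≤ (*χ≤ h p) (*A≤sum h l))

  mult-∷ : ∀ p l i → mult (p ∷ l) i ≡ (if p ≡ᵇ i then 1 else 0) ℕ.+ mult l i
  mult-∷ p l i with p ≡ᵇ i
  ... | true  = ≡.refl
  ... | false = ≡.refl

  ≡ᵇ-refl : ∀ p → (p ≡ᵇ p) ≡ true
  ≡ᵇ-refl zero    = ≡.refl
  ≡ᵇ-refl (suc p) = ≡ᵇ-refl p

  ≢⇒≡ᵇ : ∀ {p i} → i ≢ p → (p ≡ᵇ i) ≡ false
  ≢⇒≡ᵇ {zero}  {zero}  i≢p = ⊥-elim (i≢p ≡.refl)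
  ≢⇒≡ᵇ {zero}  {suc i} i≢p = ≡.refl
  ≢⇒≡ᵇ {suc p} {zero}  i≢p = ≡.refl
  ≢⇒≡ᵇ {suc p} {suc i} i≢p = ≢⇒≡ᵇ (λ i≡p → i≢p (≡.cong suc i≡p))

  mult≤ : ∀ i l → i ℕ.* mult l i ≤ sum l
  mult≤ i []      = ≡.subst (_≤ 0) (≡.sym (ℕₚ.*-zeroʳ i)) z≤n
  mult≤ i (p ∷ l) with p ℕ.≟ i
  ... | yes ≡.refl rewrite ≡ᵇ-refl p = ≡.subst (_≤ p ℕ.+ sum l) (≡.sym (ℕₚ.*-suc p (mult l p)))
                                         (ℕₚ.+-monoʳ-≤ p (mult≤ p l))
  ... | no p≢i rewrite ≢⇒≡ᵇ {p} {i} (λ i≡p → p≢i (≡.sym i≡p)) = ℕₚ.≤-trans (mult≤ i l) (ℕₚ.m≤n+m (sum l) p)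

  -- Double counting: the parts are grouped by size. It links the multiplicities in the definition
  -- of h_λ with the counts `A`, which run over the list.
  Σ-mult : ∀ n f l → All (λ p → 1 ≤ p × p ≤ n) l → Σ n (λ i → f i ℕ.* mult l i) ≡ sum (map f l)
  Σ-mult n f []      []                   = Σ-0 n λ i _ _ → ℕₚ.*-zeroʳ (f i)
  Σ-mult n f (p ∷ l) ((1≤p , p≤n) ∷ ps) = begin
    Σ n (λ i → f i ℕ.* mult (p ∷ l) i)
      ≡⟨ Σ-cong n (λ i _ _ → ≡.trans (≡.cong (f i ℕ.*_) (mult-∷ p l i)) (ℕₚ.*-distribˡ-+ (f i) (at i) (mult l i))) ⟩
    Σ n (λ i → f i ℕ.* at i ℕ.+ f i ℕ.* mult l i)
      ≡⟨ Σ-+ n (λ i → f i ℕ.* at i) (λ i → f i ℕ.* mult l i) ⟨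
    Σ n (λ i → f i ℕ.* at i) ℕ.+ Σ n (λ i → f i ℕ.* mult l i)
      ≡⟨ ≡.cong₂ ℕ._+_ (Σ-single n 1≤p p≤n off-diagonal) (Σ-mult n f l ps) ⟩
    f p ℕ.* at p ℕ.+ sum (map f l)
      ≡⟨ ≡.cong (ℕ._+ sum (map f l)) (≡.trans (≡.cong (λ b → f p ℕ.* (if b then 1 else 0)) (≡ᵇ-refl p)) (ℕₚ.*-identityʳ (f p))) ⟩
    f p ℕ.+ sum (map f l) ∎
    where
    open ≡.≡-Reasoning
    at : ℕ → ℕ
    at i = if p ≡ᵇ i then 1 else 0
    off-diagonal : ∀ i → i ≢ p → f i ℕ.* at i ≡ 0
    off-diagonal i i≢p = ≡.trans (≡.cong (λ b → f i ℕ.* (if b then 1 else 0)) (≢⇒≡ᵇ i≢p)) (ℕₚ.*-zeroʳ (f i))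

  prodP-++ : ∀ ps q → prodP (ps ++ q ∷ []) ≋ (prodP ps *P q)
  prodP-++ []       q = *P-comm q oneP
  prodP-++ (p ∷ ps) q = ≋-trans (*P-congˡ p (prodP-++ ps q)) (≋-sym (*P-assoc p (prodP ps) q))

  prodP≋∏ : ∀ n (F : ℕ → Poly) → prodP (map (λ j → F (suc j)) (upTo n)) ≋ ∏ n F
  prodP≋∏ zero    F = ≋-refl
  prodP≋∏ (suc n) F = begin
    prodP (map F′ (upTo (suc n)))       ≡⟨ ≡.cong (λ l → prodP (map F′ l)) (Listₚ.upTo-∷ʳ n) ⟨
    prodP (map F′ (upTo n ++ n ∷ []))   ≡⟨ ≡.cong prodP (Listₚ.map-++ F′ (upTo n) (n ∷ [])) ⟩
    prodP (map F′ (upTo n) ++ F′ n ∷ []) ≈⟨ prodP-++ (map F′ (upTo n)) (F′ n) ⟩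
    prodP (map F′ (upTo n)) *P F′ n     ≈⟨ *P-cong (prodP≋∏ n F) ≋-refl ⟩
    ∏ n F *P F (suc n)                  ∎
    where
    open SetoidReasoning 𝐏.setoid
    F′ : ℕ → Poly
    F′ j = F (suc j)

  ∑P : (List ℕ → Poly) → List (List ℕ) → Poly
  ∑P F L = sumP (map F L)

  module Gcd (n N : ℕ) (n≤N : n ≤ N) (C : Cyclotomic N) where
    open Cyclotomic C
    open SetoidReasoning 𝐏.setoid

    -- The exponent of `Ψ h` in den*, the product of the `(1 + x^i)^⌊n/i⌋`.
    E : ℕ → ℕ
    E h = Σ n (λ i → χ h i ℕ.* quot n i)

    -- The expected gcd: what is left of den* when the expected den, the product of the
    -- `Ψ h ^ ⌊n/h⌋`, is divided out.
    G₀ : Poly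
    G₀ = W (λ h → E h ∸ quot n h)

    q : List ℕ → Poly
    q l = W (λ h → quot n h ∸ A h l)

    ∏-1+X^ : ∀ m (k : ℕ → ℕ) → m ≤ N →
             ∏ m (λ i → (oneP +P X ^ i) ^ k i) ≋ W (λ h → Σ m (λ i → χ h i ℕ.* k i))
    ∏-1+X^ zero    k _   = ≋-sym (W-0 {λ _ → 0} λ _ _ _ → ≡.refl)
    ∏-1+X^ (suc m) k m<N = begin
      ∏ m (λ i → (oneP +P X ^ i) ^ k i) *P (oneP +P X ^ suc m) ^ k (suc m)
        ≈⟨ *P-cong (∏-1+X^ m k (ℕₚ.<⇒≤ m<N))
             (≋-trans (𝐏.^-congˡ (k (suc m)) (1+X^≋W (suc m) (s≤s z≤n) m<N)) (W-* (λ h → χ h (suc m)) (k (suc m)))) ⟩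
      W (λ h → Σ m (λ i → χ h i ℕ.* k i)) *P W (λ h → χ h (suc m) ℕ.* k (suc m))
        ≈⟨ W-+ (λ h → Σ m (λ i → χ h i ℕ.* k i)) (λ h → χ h (suc m) ℕ.* k (suc m)) ⟩
      W (λ h → Σ (suc m) (λ i → χ h i ℕ.* k i)) ∎

    A≤quot : ∀ {l m} → Partition n m l → ∀ h → 1 ≤ h → A h l ≤ quot n h
    A≤quot {l} (partition ≡.refl _) h 1≤h = ≤-quot 1≤h (*A≤sum h l)

    quot≤E : ∀ h → 1 ≤ h → quot n h ≤ E h
    quot≤E h 1≤h with h ℕ.≤? n
    ... | yes h≤n = ≡.subst (_≤ E h)
      (≡.trans (≡.cong (ℕ._* quot n h) (χ-yes (◁-refl h))) (ℕₚ.*-identityˡ (quot n h)))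
      (≤-Σ n (λ i → χ h i ℕ.* quot n i) 1≤h h≤n)
    ... | no h≰n = ≡.subst (_≤ E h) (≡.sym (quot-large (ℕₚ.≰⇒> h≰n))) z≤n

    -- In h_λ the exponent of `Ψ h` is `E h - A h l`, split here at ⌊n/h⌋. Adding `A h l` to both
    -- sides turns the truncated subtractions into sums.
    exponent : ∀ {l} → Partition n n l → ∀ h → 1 ≤ h →
               Σ n (λ i → χ h i ℕ.* (quot n i ∸ mult l i)) ≡ (quot n h ∸ A h l) ℕ.+ (E h ∸ quot n h)
    exponent {l} pl@(partition sum≡ ps) h 1≤h = ℕₚ.+-cancelʳ-≡ (A h l) _ _ (≡R.begin
      Σ n (λ i → χ h i ℕ.* (quot n i ∸ mult l i)) ℕ.+ A h l
        ≡R.≡⟨ ≡.cong (Σ n (λ i → χ h i ℕ.* (quot n i ∸ mult l i)) ℕ.+_) (Σ-mult n (χ h) l ps) ⟨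
      Σ n (λ i → χ h i ℕ.* (quot n i ∸ mult l i)) ℕ.+ Σ n (λ i → χ h i ℕ.* mult l i)
        ≡R.≡⟨ Σ-+ n _ _ ⟩
      Σ n (λ i → χ h i ℕ.* (quot n i ∸ mult l i) ℕ.+ χ h i ℕ.* mult l i)
        ≡R.≡⟨ Σ-cong n (λ i 1≤i _ → ≡.trans (≡.sym (ℕₚ.*-distribˡ-+ (χ h i) _ _))
               (≡.cong (χ h i ℕ.*_) (ℕₚ.m∸n+n≡m (≤-quot 1≤i (≡.subst (i ℕ.* mult l i ≤_) sum≡ (mult≤ i l)))))) ⟩
      E h
        ≡R.≡⟨ ℕₚ.m∸n+n≡m (quot≤E h 1≤h) ⟨
      (E h ∸ quot n h) ℕ.+ quot n h
        ≡R.≡⟨ ≡.cong ((E h ∸ quot n h) ℕ.+_) (ℕₚ.m∸n+n≡m (A≤quot pl h 1≤h)) ⟨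
      (E h ∸ quot n h) ℕ.+ ((quot n h ∸ A h l) ℕ.+ A h l)
        ≡R.≡⟨ swap (E h ∸ quot n h) (quot n h ∸ A h l) (A h l) ⟩
      (quot n h ∸ A h l) ℕ.+ (E h ∸ quot n h) ℕ.+ A h l ≡R.∎)
      where
      module ≡R = ≡.≡-Reasoning
      swap : ∀ a b c → a ℕ.+ (b ℕ.+ c) ≡ (b ℕ.+ a) ℕ.+ c
      swap = ℕSolver.solve-∀

    hPoly≋ : ∀ {l} → Partition n n l → hPoly n l ≋ (q l *P G₀)
    hPoly≋ {l} pl = begin
      hPoly n l
        ≈⟨ prodP≋∏ n (λ i → onePlusXPow i ^P (quot n i ∸ mult l i)) ⟩
      ∏ n (λ i → onePlusXPow i ^P (quot n i ∸ mult l i))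
        ≈⟨ ∏-cong n (λ i _ _ → ≋-trans (𝐏.reflexive (^P≡^ (onePlusXPow i) (quot n i ∸ mult l i)))
             (𝐏.^-congˡ (quot n i ∸ mult l i) (onePlusXPow≋ i))) ⟩
      ∏ n (λ i → (oneP +P X ^ i) ^ (quot n i ∸ mult l i))
        ≈⟨ ∏-1+X^ n (λ i → quot n i ∸ mult l i) n≤N ⟩
      W (λ h → Σ n (λ i → χ h i ℕ.* (quot n i ∸ mult l i)))
        ≈⟨ W-cong (λ h 1≤h _ → exponent pl h 1≤h) ⟩
      W (λ h → (quot n h ∸ A h l) ℕ.+ (E h ∸ quot n h))
        ≈⟨ W-+ (λ h → quot n h ∸ A h l) (λ h → E h ∸ quot n h) ⟨
      q l *P G₀ ∎

    numStar≋ : ∀ L → All (Partition n n) L → ∑P (hPoly n) L ≋ (∑P q L *P G₀)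
    numStar≋ []      []        = ≋-refl
    numStar≋ (l ∷ L) (pl ∷ pL) = ≋-trans (+P-cong (hPoly≋ pl) (numStar≋ L pL))
      (≋-sym (*P-distribʳ G₀ (q l) (∑P q L)))

    module _ {G : Poly} (G-gcd : IsMonicGcd G (hList n)) (1≤n : 1 ≤ n) where
      private
        G₀∣G : G₀ ∣P G
        G₀∣G = proj₂ (proj₂ G-gcd) G₀ (Allₚ.map⁺ (All.map
          (λ {l} pl → q l , coeff≡ (≋-sym (hPoly≋ pl))) (partsLe-Partition n n)))
          where open _≋_
        -- The factor by which the given gcd could exceed `G₀`.
        U : Poly
        U = proj₁ G₀∣G
        UG₀≋G : (U *P G₀) ≋ G
        UG₀≋G = coeffwise (proj₂ G₀∣G)

        U∥q : ∀ {l} → l ∈ partitions n → U ∥ q l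
        U∥q {l} l∈ = v , *P-cancelʳ {G₀} (W-Nonzero (λ h → E h ∸ quot n h)) (begin
          (v *P U) *P G₀ ≈⟨ *P-assoc v U G₀ ⟩
          v *P (U *P G₀) ≈⟨ *P-congˡ v UG₀≋G ⟩
          v *P G         ≈⟨ coeffwise (proj₂ G∣h) ⟩
          hPoly n l      ≈⟨ hPoly≋ (All.lookup (partsLe-Partition n n) l∈) ⟩
          q l *P G₀      ∎)
          where
          G∣h : G ∣P hPoly n l
          G∣h = All.lookup (proj₁ (proj₂ G-gcd)) (∈-map⁺ (hPoly n) l∈)
          v = proj₁ G∣h

        -- With ⌊n/e⌋ parts equal to `e`, the exponent of `Ψ e` in `q l` is 0. So `q l` is a product
        -- of powers of other `Ψ`, all coprime to `Ψ e`, and `U` divides `q l`.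
        U⊥Ψ : ∀ e → 1 ≤ e → e ≤ n → U ⊥ Ψ e
        U⊥Ψ (suc e) 1≤e e<n = 𝐏.⊥-sym (𝐏.⊥-∥ (U∥q l∈) (⊥-∏ N _ λ h 1≤h h≤N → Ψ⊥factor h 1≤h h≤N))
          where
          k = n / suc e
          l = replicate k (suc e) ++ proj₁ (many-parts n e e<n)
          l∈ : l ∈ partitions n
          l∈ = proj₂ (many-parts n e e<n)
          k≤A : k ≤ A (suc e) l
          k≤A = ≡.subst (k ≤_) (≡.sym (≡.trans (A-++ (suc e) (replicate k (suc e)) _)
            (≡.cong (ℕ._+ A (suc e) (proj₁ (many-parts n e e<n))) (≡.trans (A-replicate (suc e) k (suc e))
              (≡.trans (≡.cong (k ℕ.*_) (χ-yes (◁-refl (suc e)))) (ℕₚ.*-identityʳ k))))))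
            (ℕₚ.m≤m+n k _)
          Ψ⊥factor : ∀ h → 1 ≤ h → h ≤ N → Ψ (suc e) ⊥ (Ψ h ^ (quot n h ∸ A h l))
          Ψ⊥factor h 1≤h h≤N with h ℕ.≟ suc e
          ... | yes ≡.refl = ≡.subst (λ j → Ψ (suc e) ⊥ (Ψ (suc e) ^ j)) (≡.sym (ℕₚ.m≤n⇒m∸n≡0 k≤A)) (𝐏.⊥-1 _)
          ... | no h≢e = 𝐏.⊥-^ (Ψ-⊥ 1≤e (ℕₚ.≤-trans e<n n≤N) 1≤h h≤N (λ eq → h≢e (≡.sym eq))) (quot n h ∸ A h l)

        U⊥factor : ∀ l h → 1 ≤ h → h ≤ N → U ⊥ (Ψ h ^ (quot n h ∸ A h l))
        U⊥factor l h 1≤h h≤N with h ℕ.≤? n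
        ... | yes h≤n = 𝐏.⊥-^ (U⊥Ψ h 1≤h h≤n) (quot n h ∸ A h l)
        ... | no  h≰n = ≡.subst (λ j → U ⊥ (Ψ h ^ (j ∸ A h l))) (≡.sym (quot-large (ℕₚ.≰⇒> h≰n)))
                          (≡.subst (λ j → U ⊥ (Ψ h ^ j)) (≡.sym (ℕₚ.0∸n≡0 (A h l))) (𝐏.⊥-1 _))

        -- `U` divides some `q l`. The factors `Ψ h` of `q l` with `h > n` have exponent 0, and `U`
        -- is coprime to the others, hence to itself. So it divides a positive integer, and being
        -- monic it is 1.
        U≋1 : U ≋ oneP
        U≋1 = monic-∥-constant {U} {proj₁ U∥constant}
          (Monic-quotient {U} {G₀} (W-Monic (λ h → E h ∸ quot n h))
            (Monic-resp (≋-sym UG₀≋G) (proj₁ G-gcd)))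
          (proj₂ U∥constant)
          where
          -- The partition into ones serves as a member of `partitions n`; it is at hand because
          -- `1 ≤ n`.
          l = replicate (n / 1) 1 ++ proj₁ (many-parts n 0 1≤n)
          U∥constant : ∃ λ c → U ∥ (suc c ⊗ oneP)
          U∥constant = 𝐏.self-⊥ (𝐏.⊥-∥ (U∥q {l} (proj₂ (many-parts n 0 1≤n))) (⊥-∏ N _ (U⊥factor l)))

      num≋ : ∀ {P} → (P *P G) ≈P numStar n → P ≋ ∑P q (partitions n)
      num≋ {P} PG≈ = *P-cancelʳ {G₀} (W-Nonzero (λ h → E h ∸ quot n h)) (begin
        P *P G₀                        ≈⟨ *P-congˡ P (*P-identityˡ G₀) ⟨
        P *P (oneP *P G₀)              ≈⟨ *P-congˡ P (*P-cong U≋1 (≋-refl {G₀})) ⟨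
        P *P (U *P G₀)                 ≈⟨ *P-congˡ P UG₀≋G ⟩
        P *P G                         ≈⟨ coeffwise PG≈ ⟩
        numStar n                      ≈⟨ numStar≋ (partitions n) (partsLe-Partition n n) ⟩
        ∑P q (partitions n) *P G₀      ∎)

open Partitions

-- Values of num and of its factors under an evaluation homomorphism

module Evaluations where
  open 𝐏 using (_^_; alt; _∥_)

  -- The increment of ⌊m/h⌋ from `m - 1` to `m`. It turns the product of the `Ψ h ^ ⌊n/h⌋` into a
  -- product over `m ≤ n`.
  δ : ℕ → ℕ → ℕ
  δ h m = indicator (h ∣? m)

  ◁⇒∣ : ∀ {e i} → e ◁ i → e ∣ i
  ◁⇒∣ {e} (oddMultiple j eq) = divides (suc (2 ℕ.* j)) (≡.trans eq (ℕₚ.*-comm e _))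

  -- The cofactor of a divisor of an odd number is odd.
  δ-odd : ∀ h j → δ h (suc (2 ℕ.* j)) ≡ χ h (suc (2 ℕ.* j))
  δ-odd h j = ℕₚ.≤-antisym
    (indicator-mono (h ∣? m) (h ◁? m) to) (indicator-mono (h ◁? m) (h ∣? m) ◁⇒∣)
    where
    m = suc (2 ℕ.* j)
    to : h ∣ m → h ◁ m
    to (divides k eq) with parity k
    ... | inj₂ (i , ≡.refl) = oddMultiple i (≡.trans eq (ℕₚ.*-comm _ h))
    ... | inj₁ (i , ≡.refl) = ⊥-elim (even≢odd (i ℕ.* h) j (≡.sym (≡.trans eq (ℕₚ.*-assoc 2 i h))))

  -- If `h` divides `2 k`, the cofactor is either odd, meaning `h ◁ 2 k`, or even, meaning that `h`
  -- divides `k`; it is never both.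
  δ-even : ∀ h k → 1 ≤ h → δ h (2 ℕ.* k) ≡ χ h (2 ℕ.* k) ℕ.+ δ h k
  δ-even h k 1≤h with h ∣? k
  ... | yes h∣k@(divides i eq) = ≡.trans (indicator-yes (h ∣? (2 ℕ.* k)) (∣-trans h∣k (n∣m*n 2)))
    (≡.cong (ℕ._+ 1) (≡.sym (χ-no {h} {2 ℕ.* k} not-odd)))
    where
    not-odd : ¬ h ◁ (2 ℕ.* k)
    not-odd (oddMultiple j 2k≡) = even≢odd i j (ℕₚ.*-cancelʳ-≡ _ _ h {{ℕ.>-nonZero 1≤h}}
      (≡.trans (ℕₚ.*-assoc 2 i h) (≡.trans (≡.cong (2 ℕ.*_) (≡.sym eq)) (≡.trans 2k≡ (ℕₚ.*-comm h _)))))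
  ... | no h∤k = ≡.trans (ℕₚ.≤-antisym
    (indicator-mono (h ∣? (2 ℕ.* k)) (h ◁? (2 ℕ.* k)) to)
    (indicator-mono (h ◁? (2 ℕ.* k)) (h ∣? (2 ℕ.* k)) ◁⇒∣)) (≡.sym (ℕₚ.+-identityʳ _))
    where
    to : h ∣ 2 ℕ.* k → h ◁ (2 ℕ.* k)
    to (divides i eq) with parity i
    ... | inj₂ (j , ≡.refl) = oddMultiple j (≡.trans eq (ℕₚ.*-comm _ h))
    ... | inj₁ (j , ≡.refl) =
      ⊥-elim (h∤k (divides j (ℕₚ.*-cancelˡ-≡ k (j ℕ.* h) 2 (≡.trans eq (ℕₚ.*-assoc 2 j h)))))

  quot-exact : ∀ h k → 1 ≤ h → quot (k ℕ.* h) h ≡ k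
  quot-exact (suc h) k _ = DivMod.m*n/n≡m k (suc h)

  quot-remainder : ∀ h r k → r < h → quot (r ℕ.+ k ℕ.* h) h ≡ k
  quot-remainder (suc h) r k r<h = ≡.trans (DivMod.+-distrib-/-∣ʳ r (divides k ≡.refl))
    (≡.cong₂ ℕ._+_ (DivMod.m<n⇒m/n≡0 r<h) (DivMod.m*n/n≡m k (suc h)))

  quot-suc : ∀ n h → 1 ≤ h → quot (suc n) h ≡ quot n h ℕ.+ δ h (suc n)
  quot-suc n (suc h) _ with ℕₚ.m≤n⇒m<n∨m≡n (DivMod.m%n<n n (suc h))
  ... | inj₁ r<h = ≡.trans (≡.cong (λ m → quot m (suc h)) sn≡) (≡.trans (quot-remainder (suc h) (suc r) k r<h)
    (≡.sym (≡.trans (≡.cong (k ℕ.+_) (indicator-no (suc h ∣? suc n) not-divisible)) (ℕₚ.+-identityʳ k))))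
    where
    r = n % suc h
    k = n / suc h
    sn≡ : suc n ≡ suc r ℕ.+ k ℕ.* suc h
    sn≡ = ≡.cong suc (DivMod.m≡m%n+[m/n]*n n (suc h))
    not-divisible : ¬ suc h ∣ suc n
    not-divisible h∣ = ℕₚ.<⇒≱ r<h (∣⇒≤ (∣m+n∣m⇒∣n
      (≡.subst (suc h ∣_) (≡.trans sn≡ (ℕₚ.+-comm (suc r) _)) h∣) (n∣m*n k)))
  ... | inj₂ r≡h = ≡.trans (≡.cong (λ m → quot m (suc h)) sn≡) (≡.trans (quot-exact (suc h) (suc k) (s≤s z≤n))
    (≡.sym (≡.trans (≡.cong (k ℕ.+_) (indicator-yes (suc h ∣? suc n) (divides (suc k) sn≡))) (ℕₚ.+-comm k 1))))
    where
    k = n / suc h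
    sn≡ : suc n ≡ suc k ℕ.* suc h
    sn≡ = ≡.trans (≡.cong suc (DivMod.m≡m%n+[m/n]*n n (suc h))) (≡.cong (ℕ._+ k ℕ.* suc h) r≡h)

  -- t = 1 when N is the identity of ℤ, and t = 2 when N is the norm of a quadratic ring.
  record Evaluation : Set₁ where
    field
      ring : CommutativeRing 0ℓ 0ℓ
    open CommutativeRing ring public hiding (zero; ring)
    module T = RingTheory ring
    field
      φ      : Poly → Carrier
      φ-cong : ∀ {p q} → p ≋ q → φ p ≈ φ q
      φ-+    : ∀ p q → φ (p +P q) ≈ φ p + φ q
      φ-*    : ∀ p q → φ (p *P q) ≈ φ p * φ q
      φ-1    : φ oneP ≈ 1#
      N      : Carrier → ℤ
      N-cong : ∀ {x y} → x ≈ y → N x ≡ N y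
      N-*    : ∀ x y → N (x * y) ≡ N x ℤ.* N y
      t      : ℕ
      N-⊗    : ∀ k → N (k T.⊗ 1#) ≡ + (k ℕ.^ t)

    open SetoidReasoning setoid

    z : Carrier
    z = φ X

    φ-0 : φ [] ≈ 0#
    φ-0 = T.x+x≈x⇒x≈0 (φ []) (sym (φ-+ [] []))

    φ-neg : ∀ p → φ (negP p) ≈ - φ p
    φ-neg p = T.+-cancelʳ (φ p) _ _ (begin
      φ (negP p) + φ p   ≈⟨ φ-+ (negP p) p ⟨
      φ (negP p +P p)    ≈⟨ φ-cong (𝐏.-‿inverseˡ p) ⟩
      φ []               ≈⟨ φ-0 ⟩
      0#                 ≈⟨ -‿inverseˡ (φ p) ⟨
      - φ p + φ p        ∎)

    φ-^ : ∀ p k → φ (p ^ k) ≈ φ p T.^ k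
    φ-^ p zero    = φ-1
    φ-^ p (suc k) = trans (φ-* p (p ^ k)) (*-congˡ (φ-^ p k))

    φ-alt : ∀ k p → φ (alt k p) ≈ T.alt k (φ p)
    φ-alt zero    p = φ-0
    φ-alt (suc k) p = trans (φ-+ oneP (negP p *P alt k p))
      (+-cong φ-1 (trans (φ-* (negP p) (alt k p)) (*-cong (φ-neg p) (φ-alt k p))))

    φ-1+X^ : ∀ i → φ (oneP +P X ^ i) ≈ 1# + z T.^ i
    φ-1+X^ i = trans (φ-+ oneP (X ^ i)) (+-cong φ-1 (φ-^ X i))

    ∑ : (List ℕ → Carrier) → List (List ℕ) → Carrier
    ∑ F []      = 0#
    ∑ F (l ∷ L) = F l + ∑ F L

    φ-∑P : ∀ F L → φ (∑P F L) ≈ ∑ (λ l → φ (F l)) L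
    φ-∑P F []      = φ-0
    φ-∑P F (l ∷ L) = trans (φ-+ (F l) (∑P F L)) (+-congˡ (φ-∑P F L))

    ∑-++ : ∀ F L M → ∑ F (L ++ M) ≈ ∑ F L + ∑ F M
    ∑-++ F []      M = sym (+-identityˡ _)
    ∑-++ F (l ∷ L) M = trans (+-congˡ (∑-++ F L M)) (sym (+-assoc _ _ _))

    ∑-0 : ∀ F L → All (λ l → F l ≈ 0#) L → ∑ F L ≈ 0#
    ∑-0 F []      []        = refl
    ∑-0 F (l ∷ L) (eq ∷ eqs) = trans (+-cong eq (∑-0 F L eqs)) (+-identityˡ 0#)

    ∑-map : ∀ F g L → ∑ F (map g L) ≡ ∑ (λ l → F (g l)) L
    ∑-map F g []      = ≡.refl
    ∑-map F g (l ∷ L) = ≡.cong (λ y → F (g l) + y) (∑-map F g L)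

    -- Partitions without a part `suc m` form the block `k = 0` of `partsLe n (suc m)`, with an
    -- empty prefix; the lists of every other block start with that part.
    ∑-partsLe-drop : ∀ F n m → (∀ l → Partition n (suc m) (suc m ∷ l) → F (suc m ∷ l) ≈ 0#) →
                     ∑ F (partsLe n (suc m)) ≈ ∑ F (partsLe n m)
    ∑-partsLe-drop F n m vanish = begin
      ∑ F (map (λ l → l) (partsLe n m) ++ rest)      ≈⟨ ∑-++ F (map (λ l → l) (partsLe n m)) rest ⟩
      ∑ F (map (λ l → l) (partsLe n m)) + ∑ F rest   ≈⟨ +-cong (reflexive (∑-map F (λ l → l) (partsLe n m)))
        (∑-0 F rest (Allₚ.concat⁺ (Allₚ.map⁺ (Allₚ.applyUpTo⁺₁ suc (n / suc m) λ {k} k< →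
          Allₚ.map⁺ (All.map (λ {l} pl → vanish (replicate k (suc m) ++ l)
              (Partition-++ {n} {m} (suc k) (upTo-/-bound {n} {m} (s≤s k<)) {l} pl))
            (partsLe-Partition (n ∸ suc k ℕ.* suc m) m)))))) ⟩
      ∑ F (partsLe n m) + 0#                         ≈⟨ +-identityʳ _ ⟩
      ∑ F (partsLe n m)                              ∎
      where
      rest = concatMap (λ k → map (replicate k (suc m) ++_) (partsLe (n ∸ k ℕ.* suc m) m))
                       (applyUpTo suc (n / suc m))

    -- Only the last block remains, with the largest possible number of parts `suc e`; what is then
    -- left to partition is `n % suc e`.
    ∑-partsLe-last : ∀ F n e →
      (∀ k → k < n / suc e → All (λ l → F (replicate k (suc e) ++ l) ≈ 0#) (partsLe (n ∸ k ℕ.* suc e) e)) →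
      ∑ F (partsLe n (suc e)) ≈ ∑ (λ l → F (replicate (n / suc e) (suc e) ++ l)) (partsLe (n % suc e) e)
    ∑-partsLe-last F n e vanish = begin
      ∑ F (concatMap g (upTo (suc K)))
        ≡⟨ ≡.cong (λ ks → ∑ F (concatMap g ks)) (Listₚ.upTo-∷ʳ K) ⟨
      ∑ F (concatMap g (upTo K ++ K ∷ []))
        ≡⟨ ≡.cong (∑ F) (Listₚ.concatMap-++ g (upTo K) (K ∷ [])) ⟩
      ∑ F (concatMap g (upTo K) ++ (g K ++ []))
        ≈⟨ ∑-++ F (concatMap g (upTo K)) (g K ++ []) ⟩
      ∑ F (concatMap g (upTo K)) + ∑ F (g K ++ [])
        ≈⟨ +-congʳ (∑-0 F (concatMap g (upTo K)) (Allₚ.concat⁺ (Allₚ.map⁺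
             (All.map (λ {k} k<K → Allₚ.map⁺ (vanish k k<K)) (Allₚ.all-upTo K))))) ⟩
      0# + ∑ F (g K ++ [])
        ≈⟨ +-identityˡ _ ⟩
      ∑ F (g K ++ [])
        ≡⟨ ≡.cong (∑ F) (Listₚ.++-identityʳ (g K)) ⟩
      ∑ F (g K)
        ≡⟨ ∑-map F (replicate K (suc e) ++_) (partsLe (n ∸ K ℕ.* suc e) e) ⟩
      ∑ F′ (partsLe (n ∸ K ℕ.* suc e) e)
        ≡⟨ ≡.cong (λ r → ∑ F′ (partsLe r e)) (DivMod.m%n≡m∸m/n*n n (suc e)) ⟨
      ∑ F′ (partsLe (n % suc e) e) ∎
      where
      K = n / suc e
      g : ℕ → List (List ℕ)
      g k = map (replicate k (suc e) ++_) (partsLe (n ∸ k ℕ.* suc e) e)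
      F′ : List ℕ → Carrier
      F′ l = F (replicate K (suc e) ++ l)

  select : ∀ {P : Set} → Dec P → ℕ → ℕ → ℕ
  select (yes _) a b = a
  select (no  _) a b = b

  module Off (M : ℕ) (C : Cyclotomic M) (e : ℕ) (1≤e : 1 ≤ e) (e≤M : e ≤ M) where
    open Cyclotomic C
    open SetoidReasoning 𝐏.setoid

    -- Deletes the exponent of `Ψ e`. The evaluation point will be a root of `Ψ e`, so values are
    -- informative only once this factor is gone.
    off : (ℕ → ℕ) → ℕ → ℕ
    off f h = select (h ℕ.≟ e) 0 (f h)

    off-0 : ∀ f {h} → f h ≡ 0 → off f h ≡ f h
    off-0 f {h} fh≡0 with h ℕ.≟ e
    ... | yes _ = ≡.sym fh≡0
    ... | no  _ = ≡.refl

    off-cong : ∀ {f g : ℕ → ℕ} {h} → (h ≢ e → f h ≡ g h) → off f h ≡ off g h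
    off-cong {h = h} f≡g with h ℕ.≟ e
    ... | yes _   = ≡.refl
    ... | no  h≢e = f≡g h≢e

    off-+ : ∀ f g h → off f h ℕ.+ off g h ≡ off (λ h → f h ℕ.+ g h) h
    off-+ f g h with h ℕ.≟ e
    ... | yes _ = ≡.refl
    ... | no  _ = ≡.refl

    V : (ℕ → ℕ) → Poly
    V f = W (off f)

    V-cong : ∀ {f g} → (∀ h → 1 ≤ h → h ≤ M → h ≢ e → f h ≡ g h) → V f ≋ V g
    V-cong {f} {g} f≡g = W-cong λ h 1≤h h≤M → off-cong {f} {g} (f≡g h 1≤h h≤M)

    V-+ : ∀ f g → (V f *P V g) ≋ V (λ h → f h ℕ.+ g h)
    V-+ f g = ≋-trans (W-+ (off f) (off g)) (W-cong λ h _ _ → off-+ f g h)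

    V≋W : ∀ {f} → f e ≡ 0 → V f ≋ W f
    V≋W {f} fe≡0 = W-cong λ h _ _ → eq h
      where
      eq : ∀ h → off f h ≡ f h
      eq h with h ℕ.≟ e
      ... | yes ≡.refl = ≡.sym fe≡0
      ... | no  _      = ≡.refl

    V-0 : ∀ {f} → (∀ h → 1 ≤ h → h ≤ M → h ≢ e → f h ≡ 0) → V f ≋ oneP
    V-0 {f} f≡0 = ≋-trans (V-cong {f} {λ _ → 0} f≡0) (W-0 {off (λ _ → 0)} λ h _ _ → off-0 (λ _ → 0) ≡.refl)

    ∏-single : ∀ k F → e ≤ k → (∀ h → h ≢ e → F h ≋ oneP) → ∏ k F ≋ F e
    ∏-single zero    F e≤0 _ = ⊥-elim (ℕₚ.<⇒≱ 1≤e e≤0)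
    ∏-single (suc k) F e≤k F≋1 with ℕₚ.m≤n⇒m<n∨m≡n e≤k
    ... | inj₂ ≡.refl = ≋-trans (*P-cong (≋-trans (∏-cong k λ h _ h≤k → F≋1 h (ℕₚ.<⇒≢ (s≤s h≤k))) (∏-1 k)) (≋-refl {F e}))
                                (*P-identityˡ (F e))
    ... | inj₁ (s≤s e≤k′) = ≋-trans (*P-cong (∏-single k F e≤k′ F≋1) (F≋1 (suc k) (ℕₚ.>⇒≢ (s≤s e≤k′))))
                                    (𝐏.*-identityʳ (F e))

    V-*-Ψ : ∀ f → (V f *P Ψ e ^ f e) ≋ W f
    V-*-Ψ f = begin
      V f *P Ψ e ^ f e                 ≈⟨ *P-congˡ (V f) (≋-sym only≋) ⟩
      V f *P W only                    ≈⟨ W-+ (off f) only ⟩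
      W (λ h → off f h ℕ.+ only h)     ≈⟨ W-cong (λ h _ _ → total h) ⟩
      W f                              ∎
      where
      only : ℕ → ℕ
      only h = select (h ℕ.≟ e) (f e) 0
      total : ∀ h → off f h ℕ.+ only h ≡ f h
      total h with h ℕ.≟ e
      ... | yes ≡.refl = ≡.refl
      ... | no  _      = ℕₚ.+-identityʳ (f h)
      only-≢ : ∀ h → h ≢ e → only h ≡ 0
      only-≢ h h≢e with h ℕ.≟ e
      ... | yes h≡e = ⊥-elim (h≢e h≡e)
      ... | no  _   = ≡.refl
      only-e : only e ≡ f e
      only-e with e ℕ.≟ e
      ... | yes _   = ≡.refl
      ... | no  e≢e = ⊥-elim (e≢e ≡.refl)
      only≋ : W only ≋ Ψ e ^ f e
      only≋ = ≋-trans (∏-single M (λ h → Ψ h ^ only h) e≤M λ h h≢e → 𝐏.^-congʳ (Ψ h) (only-≢ h h≢e))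
                      (𝐏.^-congʳ (Ψ e) only-e)

    -- For `1 ≤ p ≤ M` this is `1 + x^p` without its factor `Ψ e`, if it has one.
    w : ℕ → Poly
    w p = V (λ h → χ h p)

    w-other : ∀ p → 1 ≤ p → p ≤ M → ¬ e ◁ p → w p ≋ (oneP +P X ^ p)
    w-other p 1≤p p≤M ¬e◁p = ≋-trans (V≋W {λ h → χ h p} (χ-no ¬e◁p)) (≋-sym (1+X^≋W p 1≤p p≤M))

    w-*-Ψ : ∀ p → 1 ≤ p → p ≤ M → e ◁ p → (w p *P Ψ e) ≋ (oneP +P X ^ p)
    w-*-Ψ p 1≤p p≤M e◁p = begin
      w p *P Ψ e               ≈⟨ *P-congˡ (w p) (≋-trans (≋-sym (𝐏.*-identityʳ (Ψ e))) (𝐏.^-congʳ (Ψ e) (≡.sym (χ-yes e◁p)))) ⟩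
      w p *P Ψ e ^ χ e p       ≈⟨ V-*-Ψ (λ h → χ h p) ⟩
      W (λ h → χ h p)          ≈⟨ 1+X^≋W p 1≤p p≤M ⟨
      oneP +P X ^ p            ∎

    -- Cancel `Ψ e` in the factorisation of `1 + x^(e k)` as `1 + x^e` times `alt k (x^e)`. Where
    -- `x^e = -1`, the second factor becomes `k`.
    w-odd-multiple : ∀ j → let k = suc (2 ℕ.* j) in e ℕ.* k ≤ M → w (e ℕ.* k) ≋ (w e *P alt k (X ^ e))
    w-odd-multiple j ek≤M = *P-cancelʳ {Ψ e} (Monic⇒Nonzero {Ψ e} (Ψ-Monic e)) (begin
      w (e ℕ.* k) *P Ψ e              ≈⟨ w-*-Ψ (e ℕ.* k) 1≤ek ek≤M (oddMultiple j ≡.refl) ⟩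
      oneP +P X ^ (e ℕ.* k)           ≈⟨ 𝐏.+-congˡ {oneP} (𝐏.^-assocʳ X e k) ⟨
      oneP +P (X ^ e) ^ k             ≈⟨ 𝐏.1+^odd (X ^ e) j ⟩
      (oneP +P X ^ e) *P a            ≈⟨ *P-cong (w-*-Ψ e 1≤e e≤M (◁-refl e)) (≋-refl {a}) ⟨
      (w e *P Ψ e) *P a               ≈⟨ *P-assoc (w e) (Ψ e) a ⟩
      w e *P (Ψ e *P a)               ≈⟨ *P-congˡ (w e) (*P-comm (Ψ e) a) ⟩
      w e *P (a *P Ψ e)               ≈⟨ *P-assoc (w e) a (Ψ e) ⟨
      (w e *P a) *P Ψ e               ∎)
      where
      k = suc (2 ℕ.* j)
      a = alt k (X ^ e)
      1≤ek : 1 ≤ e ℕ.* k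
      1≤ek = ℕₚ.≤-trans 1≤e (ℕₚ.m≤m*n e k)

    Q : ℕ → Poly
    Q m = V (λ h → δ h m)

    Q-odd : ∀ j → Q (suc (2 ℕ.* j)) ≋ w (suc (2 ℕ.* j))
    Q-odd j = V-cong {λ h → δ h m} {λ h → χ h m} λ h _ _ _ → δ-odd h j
      where m = suc (2 ℕ.* j)

    Q-even : ∀ k → Q (2 ℕ.* k) ≋ (w (2 ℕ.* k) *P Q k)
    Q-even k = ≋-trans (V-cong {λ h → δ h (2 ℕ.* k)} {λ h → χ h (2 ℕ.* k) ℕ.+ δ h k} λ h 1≤h _ _ → δ-even h k 1≤h)
      (≋-sym (V-+ (λ h → χ h (2 ℕ.* k)) (λ h → δ h k)))

    -- For `m = n` this is den without its power of `Ψ e`.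
    D : ℕ → Poly
    D m = V (quot m)

    D-0 : D 0 ≋ oneP
    D-0 = V-0 {quot 0} λ h 1≤h _ _ → quot-large 1≤h

    D-suc : ∀ m → D (suc m) ≋ (D m *P Q (suc m))
    D-suc m = ≋-trans (V-cong {quot (suc m)} {λ h → quot m h ℕ.+ δ h (suc m)} λ h 1≤h _ _ → quot-suc m h 1≤h)
      (≋-sym (V-+ (quot m) (λ h → δ h (suc m))))

    V-A : ∀ l → V (λ h → A h l) ≋ prodP (map w l)
    V-A []      = V-0 {λ h → A h []} λ _ _ _ _ → ≡.refl
    V-A (p ∷ l) = ≋-trans (≋-sym (V-+ (λ h → χ h p) (λ h → A h l))) (*P-congˡ (w p) (V-A l))

  ^-distribʳ-* : ∀ t a b → (a ℕ.* b) ℕ.^ t ≡ a ℕ.^ t ℕ.* b ℕ.^ t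
  ^-distribʳ-* zero    a b = ≡.refl
  ^-distribʳ-* (suc t) a b = ≡.trans (≡.cong (a ℕ.* b ℕ.*_) (^-distribʳ-* t a b)) (comm4 a b (a ℕ.^ t) (b ℕ.^ t))
    where
    comm4 : ∀ a b c d → a ℕ.* b ℕ.* (c ℕ.* d) ≡ a ℕ.* c ℕ.* (b ℕ.* d)
    comm4 = ℕSolver.solve-∀

  A-small : ∀ e l → All (λ p → 1 ≤ p × p ≤ e) l → A (suc e) l ≡ 0
  A-small e []      []               = ≡.refl
  A-small e (p ∷ l) ((_ , p≤e) ∷ ps) =
    ≡.cong₂ ℕ._+_ (χ-no {suc e} {p} λ e◁p → ℕₚ.<⇒≱ (s≤s p≤e) (◁⇒≤ e◁p)) (A-small e l ps)

  A-replicate-self : ∀ e k l → A e (replicate k e ++ l) ≡ k ℕ.+ A e l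
  A-replicate-self e k l = ≡.trans (A-++ e (replicate k e) l) (≡.cong (ℕ._+ A e l)
    (≡.trans (A-replicate e k e) (≡.trans (≡.cong (k ℕ.*_) (χ-yes (◁-refl e))) (ℕₚ.*-identityʳ k))))

  -- A part larger than `e` is wasteful: if not counted it uses up more than `e` for nothing, and if
  -- counted it is at least `3 e` where `e` would do. Hence a partition with such a part stays below
  -- the maximum of `A e`.
  *χ+≤ : ∀ e p → e < p → e ℕ.* suc (χ e p) ≤ p
  *χ+≤ e p e<p with e ◁? p
  ... | no _ = ≡.subst (_≤ p) (≡.sym (ℕₚ.*-identityʳ e)) (ℕₚ.<⇒≤ e<p)
  ... | yes (oddMultiple zero    p≡) = ⊥-elim (ℕₚ.<-irrefl (≡.sym (≡.trans p≡ (ℕₚ.*-identityʳ e))) e<p)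
  ... | yes (oddMultiple (suc j) p≡) = ≡.subst (e ℕ.* 2 ≤_) (≡.sym p≡)
    (ℕₚ.*-monoʳ-≤ e {2} {suc (2 ℕ.* suc j)} (s≤s (s≤s z≤n)))

  A<quot : ∀ {n m} e p l → 1 ≤ e → e < p → Partition n m (p ∷ l) → A e (p ∷ l) < quot n e
  A<quot e p l 1≤e e<p (partition ≡.refl _) = ≤-quot 1≤e (≡.subst (_≤ p ℕ.+ sum l)
    (≡.sym (ℕₚ.*-distribˡ-+ e (suc (χ e p)) (A e l))) (ℕₚ.+-mono-≤ (*χ+≤ e p e<p) (*A≤sum e l)))

  pos-^ : ∀ a k → (+ a) ℤ.^ k ≡ + (a ℕ.^ k)
  pos-^ a zero    = ≡.refl
  pos-^ a (suc k) = ≡.trans (≡.cong (+ a ℤ.*_) (pos-^ a k)) (≡.sym (ℤₚ.pos-* a (a ℕ.^ k)))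

  cancel-norm : ∀ x a k b r → 1 ≤ a → 1 ≤ b →
    x ℤ.* ((+ a) ℤ.^ k ℤ.* + b) ≡ + (r ℕ.* (a ℕ.^ k ℕ.* b)) → x ≡ + r
  cancel-norm x (suc a) k (suc b) r _ _ eq = ℤₚ.*-cancelʳ-≡ x (+ r) (+ d) {{nonZero}} (≡.trans
    (≡.cong (x ℤ.*_) (≡.trans (ℤₚ.pos-* (suc a ℕ.^ k) (suc b)) (≡.cong (ℤ._* + suc b) (≡.sym (pos-^ (suc a) k)))))
    (≡.trans eq (ℤₚ.pos-* r d)))
    where
    d = suc a ℕ.^ k ℕ.* suc b
    nonZero : ℤ.NonZero (+ d)
    nonZero = ℕₚ.m*n≢0 (suc a ℕ.^ k) (suc b) {{ℕₚ.m^n≢0 (suc a) k}}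

  module AtRoot (𝓔 : Evaluation) (n M : ℕ) (n≤M : n ≤ M) (C : Cyclotomic M)
                (e′ : ℕ) (e≤M : suc e′ ≤ M) where
    open Evaluation 𝓔 public
    open Cyclotomic C public
    open Gcd n M n≤M C public using (q; A≤quot)
    open Off M C (suc e′) (s≤s z≤n) e≤M public
    open SetoidReasoning setoid

    e K : ℕ
    e = suc e′
    K = n / e

    Nφ : Poly → ℤ
    Nφ p = N (φ p)

    Nφ-* : ∀ p q → Nφ (p *P q) ≡ Nφ p ℤ.* Nφ q
    Nφ-* p q = ≡.trans (N-cong (φ-* p q)) (N-* (φ p) (φ q))

    Nφ-cong : ∀ {p q} → p ≋ q → Nφ p ≡ Nφ q
    Nφ-cong p≋q = N-cong (φ-cong p≋q)

    N-1 : N 1# ≡ 1ℤ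
    N-1 = ≡.trans (N-cong (sym (+-identityʳ 1#))) (≡.trans (N-⊗ 1) (≡.cong +_ (ℕₚ.^-zeroˡ t)))

    Nφ-1 : Nφ oneP ≡ 1ℤ
    Nφ-1 = ≡.trans (N-cong φ-1) N-1

    Nφ-w-other : ∀ p → 1 ≤ p → p ≤ M → ¬ e ◁ p → Nφ (w p) ≡ N (1# + z T.^ p)
    Nφ-w-other p 1≤p p≤M ¬e◁p = N-cong (trans (φ-cong (w-other p 1≤p p≤M ¬e◁p)) (φ-1+X^ p))

    z-period : ∀ {k} → z T.^ k ≈ 1# → ∀ r i → z T.^ (r ℕ.+ i ℕ.* k) ≈ z T.^ r
    z-period {k} zᵏ≈1 r i = begin
      z T.^ (r ℕ.+ i ℕ.* k)           ≈⟨ T.^-homo-* z r (i ℕ.* k) ⟩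
      z T.^ r * z T.^ (i ℕ.* k)       ≈⟨ *-congˡ (T.^-congʳ z (ℕₚ.*-comm i k)) ⟩
      z T.^ r * z T.^ (k ℕ.* i)       ≈⟨ *-congˡ (sym (T.^-assocʳ z k i)) ⟩
      z T.^ r * (z T.^ k) T.^ i       ≈⟨ *-congˡ (trans (T.^-congˡ i zᵏ≈1) (T.1^≈1 i)) ⟩
      z T.^ r * 1#                    ≈⟨ *-identityʳ _ ⟩
      z T.^ r                         ∎

    N-2 : ∀ {y} → y ≈ 1# → N (1# + y) ≡ + (2 ℕ.^ t)
    N-2 y≈1 = ≡.trans (N-cong (+-congˡ (trans y≈1 (sym (+-identityʳ 1#))))) (N-⊗ 2)

    Nφ-w-odd-multiple : z T.^ e ≈ - 1# → ∀ j → let k = suc (2 ℕ.* j) in e ℕ.* k ≤ M →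
                        Nφ (w (e ℕ.* k)) ≡ Nφ (w e) ℤ.* + (k ℕ.^ t)
    Nφ-w-odd-multiple zᵉ≈-1 j ek≤M = ≡.trans (Nφ-cong (w-odd-multiple j ek≤M))
      (≡.trans (Nφ-* (w e) (alt k (X ^ e))) (≡.cong (Nφ (w e) ℤ.*_) (≡.trans (N-cong (begin
        φ (alt k (X ^ e))       ≈⟨ φ-alt k (X ^ e) ⟩
        T.alt k (φ (X ^ e))     ≈⟨ T.alt-at-neg1 (trans (φ-^ X e) zᵉ≈-1) k ⟩
        k T.⊗ 1#                ∎)) (N-⊗ k))))
      where k = suc (2 ℕ.* j)

    -- The common shape of the norms of `Q m`: a constant `c`, and the power `(m/e)^t` when `e`
    -- divides `m`. The constant turns out to be `c = e` for `e = 1, 2, 3`.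
    NormQ : ℕ → ℕ → Set
    NormQ c m = (¬ e ∣ m → Nφ (Q m) ≡ + c) × (∀ k → m ≡ k ℕ.* e → Nφ (Q m) ≡ + (c ℕ.* k ℕ.^ t))

    -- `D m` is the product of `Q 1` up to `Q m`. The indices divisible by `e` contribute 1, 2, ...,
    -- ⌊m/e⌋, whence the factorial.
    norm-D : ∀ {c} → (∀ m → 1 ≤ m → m ≤ M → NormQ c m) →
             ∀ m → m ≤ M → Nφ (D m) ≡ + (c ℕ.^ m ℕ.* (quot m e !) ℕ.^ t)
    norm-D normQ zero _ = ≡.trans (Nφ-cong D-0) (≡.trans Nφ-1
      (≡.sym (≡.cong +_ (≡.trans (ℕₚ.+-identityʳ _) (ℕₚ.^-zeroˡ t)))))
    norm-D {c} normQ (suc m) m<M = ≡.trans (Nφ-cong (D-suc m)) (≡.trans (Nφ-* (D m) (Q (suc m)))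
      (≡.trans (≡.cong (ℤ._* Nφ (Q (suc m))) (norm-D normQ m (ℕₚ.<⇒≤ m<M))) step))
      where
      k = quot m e
      rearrange : ∀ a b c d → (a ℕ.* b) ℕ.* (c ℕ.* d) ≡ (c ℕ.* a) ℕ.* (d ℕ.* b)
      rearrange = ℕSolver.solve-∀
      rearrange′ : ∀ a b c → (a ℕ.* b) ℕ.* c ≡ (c ℕ.* a) ℕ.* b
      rearrange′ = ℕSolver.solve-∀
      step : + (c ℕ.^ m ℕ.* (k !) ℕ.^ t) ℤ.* Nφ (Q (suc m)) ≡ + (c ℕ.^ suc m ℕ.* (quot (suc m) e !) ℕ.^ t)
      step with e ∣? suc m
      ... | no e∤m = ≡.trans (≡.cong (+ (c ℕ.^ m ℕ.* (k !) ℕ.^ t) ℤ.*_) (proj₁ (normQ (suc m) (s≤s z≤n) m<M) e∤m))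
        (≡.trans (≡.sym (ℤₚ.pos-* (c ℕ.^ m ℕ.* (k !) ℕ.^ t) c)) (≡.cong +_ (≡.trans (rearrange′ (c ℕ.^ m) ((k !) ℕ.^ t) c)
          (≡.cong (λ j → c ℕ.^ suc m ℕ.* (j !) ℕ.^ t) (≡.sym (≡.trans (quot-suc m e (s≤s z≤n))
            (≡.trans (≡.cong (k ℕ.+_) (indicator-no (e ∣? suc m) e∤m)) (ℕₚ.+-identityʳ k))))))))
      ... | yes e∣m@(divides j m≡je) = ≡.trans
        (≡.cong (+ (c ℕ.^ m ℕ.* (k !) ℕ.^ t) ℤ.*_) (proj₂ (normQ (suc m) (s≤s z≤n) m<M) j m≡je))
        (≡.trans (≡.sym (ℤₚ.pos-* (c ℕ.^ m ℕ.* (k !) ℕ.^ t) (c ℕ.* j ℕ.^ t))) (≡.cong +_ (≡.trans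
          (rearrange (c ℕ.^ m) ((k !) ℕ.^ t) c (j ℕ.^ t))
          (≡.cong (c ℕ.^ suc m ℕ.*_) (≡.trans (≡.sym (^-distribʳ-* t j (k !)))
            (≡.cong (ℕ._^ t) (≡.trans (≡.cong (ℕ._* k !) (≡.sym sk≡j)) (≡.cong _! (≡.sym quot≡)))))))))
        where
        quot≡ : quot (suc m) e ≡ suc k
        quot≡ = ≡.trans (quot-suc m e (s≤s z≤n)) (≡.trans (≡.cong (k ℕ.+_) (indicator-yes (e ∣? suc m) e∣m)) (ℕₚ.+-comm k 1))
        sk≡j : suc k ≡ j
        sk≡j = ≡.trans (≡.sym quot≡) (≡.trans (≡.cong (λ i → quot i e) m≡je) (quot-exact e j (s≤s z≤n)))

    -- When `A e l` is maximal, `q l` contains no `Ψ e`. For the other factors the exponents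
    -- `⌊n/h⌋ - A h l` and `A h l` add up to ⌊n/h⌋.
    q-*-w : ∀ {m l} → Partition n m l → A e l ≡ quot n e → (q l *P prodP (map w l)) ≋ D n
    q-*-w {m} {l} pl full = ≋-trans (*P-cong
        (≋-sym (V≋W {λ h → quot n h ∸ A h l} (≡.trans (≡.cong (quot n e ∸_) full) (ℕₚ.n∸n≡0 (quot n e)))))
        (≋-sym (V-A l)))
      (≋-trans (V-+ (λ h → quot n h ∸ A h l) (λ h → A h l))
        (V-cong {λ h → quot n h ∸ A h l ℕ.+ A h l} {quot n} λ h 1≤h _ _ → ℕₚ.m∸n+n≡m (A≤quot pl h 1≤h)))

    Nφ-prod-w : ∀ k l → Nφ (prodP (map w (replicate k e ++ l))) ≡ Nφ (w e) ℤ.^ k ℤ.* Nφ (prodP (map w l))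
    Nφ-prod-w zero    l = ≡.sym (ℤₚ.*-identityˡ _)
    Nφ-prod-w (suc k) l = ≡.trans (Nφ-* (w e) _)
      (≡.trans (≡.cong (Nφ (w e) ℤ.*_) (Nφ-prod-w k l)) (≡.sym (ℤₚ.*-assoc (Nφ (w e)) _ _)))

    remaining : ∀ {l} → Partition (n % e) e′ l → Partition n e (replicate K e ++ l)
    remaining {l} pl = Partition-++ K (DivMod.m/n*n≤m n e)
      (≡.subst (λ r → Partition r e′ l) (DivMod.m%n≡m∸m/n*n n e) pl)

    -- The norm of a surviving term, left as a product to avoid division: together with the norms
    -- belonging to its parts it gives the norm of `D n`.
    norm-q : ∀ {c} → (∀ m → 1 ≤ m → m ≤ M → NormQ c m) → ∀ {l} → Partition (n % e) e′ l →
      Nφ (q (replicate K e ++ l)) ℤ.* (Nφ (w e) ℤ.^ K ℤ.* Nφ (prodP (map w l))) ≡ + (c ℕ.^ n ℕ.* (K !) ℕ.^ t)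
    norm-q {c} normQ {l} pl@(partition _ ps) = ≡.trans
      (≡.cong (Nφ (q (replicate K e ++ l)) ℤ.*_) (≡.sym (Nφ-prod-w K l)))
      (≡.trans (≡.sym (Nφ-* (q (replicate K e ++ l)) _))
      (≡.trans (Nφ-cong (q-*-w (remaining pl)
        (≡.trans (A-replicate-self e K l) (≡.trans (≡.cong (K ℕ.+_) (A-small e′ l ps)) (ℕₚ.+-identityʳ K)))))
      (norm-D normQ n n≤M)))

    module _ (root : φ (Ψ e) ≈ 0#) where

      q-vanish : ∀ l → A e l < quot n e → φ (q l) ≈ 0#
      q-vanish l A<K = vanish (Ψ-∥-W (λ h → quot n h ∸ A h l) (s≤s z≤n) e≤M (ℕₚ.m<n⇒0<n∸m A<K))
        where
        vanish : Ψ e ∥ q l → φ (q l) ≈ 0#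
        vanish (r , rΨ≋q) = begin
          φ (q l)          ≈⟨ φ-cong rΨ≋q ⟨
          φ (r *P Ψ e)     ≈⟨ φ-* r (Ψ e) ⟩
          φ r * φ (Ψ e)    ≈⟨ *-congˡ root ⟩
          φ r * 0#         ≈⟨ zeroʳ (φ r) ⟩
          0#               ∎

      drop-large : ∀ d → ∑ (λ l → φ (q l)) (partsLe n (d ℕ.+ e)) ≈ ∑ (λ l → φ (q l)) (partsLe n e)
      drop-large zero    = refl
      drop-large (suc d) = trans (∑-partsLe-drop (λ l → φ (q l)) n (d ℕ.+ e) λ l pl →
        q-vanish (suc (d ℕ.+ e) ∷ l) (A<quot e (suc (d ℕ.+ e)) l (s≤s z≤n) (s≤s (ℕₚ.m≤n+m e d)) pl)) (drop-large d)

      -- No partition of `n` has a part above `n`. This serves the case `n < e`, where the bound on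
      -- the parts is raised from `n` to `e`.
      drop-impossible : ∀ F d → ∑ F (partsLe n (d ℕ.+ n)) ≈ ∑ F (partsLe n n)
      drop-impossible F zero    = refl
      drop-impossible F (suc d) = trans (∑-partsLe-drop F n (d ℕ.+ n) λ l (partition sum≡ _) →
        ⊥-elim (ℕₚ.<⇒≱ (s≤s (ℕₚ.m≤n+m n d)) (≡.subst (suc (d ℕ.+ n) ≤_) sum≡ (ℕₚ.m≤m+n _ (sum l)))))
        (drop-impossible F d)

      -- Terms with a part above `e`, or with fewer than `K` parts `e`, contain the factor `Ψ e` and
      -- vanish.
      sum-partitions : φ (∑P q (partitions n)) ≈
                       ∑ (λ l → φ (q (replicate K e ++ l))) (partsLe (n % e) e′)
      sum-partitions = begin
        φ (∑P q (partitions n))    ≈⟨ φ-∑P q (partitions n) ⟩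
        ∑ F (partsLe n n)          ≈⟨ to-e (ℕₚ.≤-total e n) ⟩
        ∑ F (partsLe n e)          ≈⟨ ∑-partsLe-last F n e′ (λ k k<K → All.map (λ {l} (partition _ ps) →
          q-vanish (replicate k e ++ l) (≡.subst (_< quot n e) (≡.sym (≡.trans (A-replicate-self e k l)
            (≡.trans (≡.cong (k ℕ.+_) (A-small e′ l ps)) (ℕₚ.+-identityʳ k)))) k<K)) (partsLe-Partition _ e′)) ⟩
        ∑ (λ l → F (replicate K e ++ l)) (partsLe (n % e) e′) ∎
        where
        F : List ℕ → Carrier
        F l = φ (q l)
        to-e : e ≤ n ⊎ n ≤ e → ∑ F (partsLe n n) ≈ ∑ F (partsLe n e)
        to-e (inj₁ e≤n) = trans (reflexive (≡.cong (λ m → ∑ F (partsLe n m)) (≡.sym (ℕₚ.m∸n+n≡m e≤n)))) (drop-large (n ∸ e))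
        to-e (inj₂ n≤e) = trans (sym (drop-impossible F (e ∸ n)))
          (reflexive (≡.cong (λ m → ∑ F (partsLe n m)) (ℕₚ.m∸n+n≡m n≤e)))

    w-self≋1 : (∀ h → 1 ≤ h → h ≢ e → ¬ h ◁ e) → w e ≋ oneP
    w-self≋1 none = V-0 {λ h → χ h e} λ h 1≤h _ h≢e → χ-no (none h 1≤h h≢e)

    -- If `w e` is 1, then `Ψ e` is `1 + x^e` itself. This covers `e = 1` and `e = 2`, but not
    -- `e = 3`, where `1 + x` is a proper factor.
    Ψ-root : w e ≋ oneP → z T.^ e ≈ - 1# → φ (Ψ e) ≈ 0#
    Ψ-root we≋1 zᵉ≈-1 = begin
      φ (Ψ e)             ≈⟨ φ-cong (*P-identityˡ (Ψ e)) ⟨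
      φ (oneP *P Ψ e)     ≈⟨ φ-cong (*P-cong (≋-sym we≋1) (≋-refl {Ψ e})) ⟩
      φ (w e *P Ψ e)      ≈⟨ φ-cong (w-*-Ψ e (s≤s z≤n) e≤M (◁-refl e)) ⟩
      φ (oneP +P X ^ e)   ≈⟨ φ-1+X^ e ⟩
      1# + z T.^ e        ≈⟨ +-congˡ zᵉ≈-1 ⟩
      1# + - 1#           ≈⟨ -‿inverseʳ 1# ⟩
      0#                  ∎

    num-single : φ (Ψ e) ≈ 0# → ∀ {l} → partsLe (n % e) e′ ≡ l ∷ [] →
                 φ (∑P q (partitions n)) ≈ φ (q (replicate K e ++ l))
    num-single root {l} eq = begin
      φ (∑P q (partitions n))
        ≈⟨ sum-partitions root ⟩
      ∑ (λ l → φ (q (replicate K e ++ l))) (partsLe (n % e) e′)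
        ≡⟨ ≡.cong (∑ (λ l → φ (q (replicate K e ++ l)))) eq ⟩
      φ (q (replicate K e ++ l)) + 0#
        ≈⟨ +-identityʳ _ ⟩
      φ (q (replicate K e ++ l)) ∎

    -- The case of one surviving term. Its norm is that of `D n` divided by `a` for each of the `K`
    -- parts `e` and by `b` for the remaining parts.
    norm-single : ∀ {c a b r l} → φ (Ψ e) ≈ 0# → (∀ m → 1 ≤ m → m ≤ M → NormQ c m) →
      partsLe (n % e) e′ ≡ l ∷ [] → 1 ≤ a → 1 ≤ b → Nφ (w e) ≡ + a → Nφ (prodP (map w l)) ≡ + b →
      c ℕ.^ n ℕ.* (K !) ℕ.^ t ≡ r ℕ.* (a ℕ.^ K ℕ.* b) → Nφ (∑P q (partitions n)) ≡ + r
    norm-single {c} {a} {b} {r} {l} root normQ eq 1≤a 1≤b w≡ prod≡ arith =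
      ≡.trans (N-cong (num-single root eq)) (cancel-norm _ a K b r 1≤a 1≤b (≡.trans
        (≡.cong (Nφ (q (replicate K e ++ l)) ℤ.*_) (≡.sym (≡.cong₂ (λ x y → x ℤ.^ K ℤ.* y) w≡ prod≡)))
        (≡.trans (norm-q normQ pl) (≡.cong +_ arith))))
      where
      pl : Partition (n % e) e′ l
      pl = All.head (≡.subst (All (Partition (n % e) e′)) eq (partsLe-Partition (n % e) e′))

open Evaluations

-- Norms at -1, at ±i and at the primitive sixth roots of unity

module RootsOfUnity where
  open 𝐏 using (_^_; alt)

  -- Makes the descent from `Q (2 k)` to `Q k` structural in the bound `b`.
  half-bounds : ∀ {b k m} → m ≡ 2 ℕ.* k → m ≤ suc b → 1 ≤ m → k ≤ b × 1 ≤ k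
  half-bounds {b} {zero}  ≡.refl _ 1≤m = z≤n , 1≤m
  half-bounds {b} {suc k} ≡.refl m≤sb _ =
    ℕₚ.≤-trans (s≤s (ℕₚ.m≤m+n k _)) (ℕₚ.≤-trans (ℕₚ.≤-reflexive (≡.sym (ℕₚ.+-suc k (k ℕ.+ 0)))) (ℕₚ.≤-pred m≤sb)) , s≤s z≤n

  module One (𝓔 : Evaluation) (n M : ℕ) (n≤M : n ≤ M) (C : Cyclotomic M) (1≤M : 1 ≤ M) where
    open AtRoot 𝓔 n M n≤M C 0 1≤M

    module _ (z≈-1 : z T.^ 1 ≈ - 1#) where

      w₁≋1 : w 1 ≋ oneP
      w₁≋1 = w-self≋1 λ h 1≤h h≢1 h◁1 → h≢1 (ℕₚ.≤-antisym (◁⇒≤ h◁1) 1≤h)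

      -- For odd `m`, `Q m` is `(1 + x^m) / (1 + x)`, with value `m` at -1. For even `m`, the factor
      -- `1 + x^m` has value 2, and `Q (m/2)` supplies the rest.
      norm-Q₁ : ∀ b m → m ≤ b → 1 ≤ m → m ≤ M → Nφ (Q m) ≡ + (m ℕ.^ t)
      norm-Q₁ zero    zero _   () _
      norm-Q₁ (suc b) m m≤b 1≤m m≤M with parity m
      ... | inj₂ (j , ≡.refl) = begin
        Nφ (Q m)                     ≡⟨ Nφ-cong (Q-odd j) ⟩
        Nφ (w m)                     ≡⟨ ≡.cong (λ i → Nφ (w i)) (ℕₚ.*-identityˡ m) ⟨
        Nφ (w (1 ℕ.* m))             ≡⟨ Nφ-w-odd-multiple z≈-1 j (≡.subst (_≤ M) (≡.sym (ℕₚ.*-identityˡ m)) m≤M) ⟩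
        Nφ (w 1) ℤ.* + (m ℕ.^ t)     ≡⟨ ≡.cong (ℤ._* + (m ℕ.^ t)) (≡.trans (Nφ-cong w₁≋1) Nφ-1) ⟩
        1ℤ ℤ.* + (m ℕ.^ t)           ≡⟨ ℤₚ.*-identityˡ _ ⟩
        + (m ℕ.^ t)                  ∎
        where open ≡.≡-Reasoning
      ... | inj₁ (k , m≡2k@≡.refl) = begin
        Nφ (Q m)                              ≡⟨ Nφ-cong (Q-even k) ⟩
        Nφ (w m *P Q k)                       ≡⟨ Nφ-* (w m) (Q k) ⟩
        Nφ (w m) ℤ.* Nφ (Q k)
          ≡⟨ ≡.cong₂ ℤ._*_ (≡.trans (Nφ-w-other m 1≤m m≤M ¬1◁m) (N-2 zᵐ≈1))
               (norm-Q₁ b k (proj₁ bounds) (proj₂ bounds) (ℕₚ.≤-trans (ℕₚ.m≤m+n k _) m≤M)) ⟩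
        + (2 ℕ.^ t) ℤ.* + (k ℕ.^ t)           ≡⟨ ℤₚ.pos-* (2 ℕ.^ t) (k ℕ.^ t) ⟨
        + (2 ℕ.^ t ℕ.* k ℕ.^ t)               ≡⟨ ≡.cong +_ (^-distribʳ-* t 2 k) ⟨
        + (m ℕ.^ t)                           ∎
        where
        open ≡.≡-Reasoning
        bounds = half-bounds {b} {k} m≡2k m≤b 1≤m
        ¬1◁m : ¬ 1 ◁ m
        ¬1◁m (oddMultiple j eq) = even≢odd k j (≡.trans eq (ℕₚ.*-identityˡ _))
        zᵐ≈1 : z T.^ m ≈ 1#
        zᵐ≈1 = T.-1^even (trans (sym (*-identityʳ z)) z≈-1) k

      norm-num₁ : Nφ (∑P q (partitions n)) ≡ + ((n !) ℕ.^ t)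
      norm-num₁ = norm-single {1} {1} {1} {(n !) ℕ.^ t} {[]} (Ψ-root w₁≋1 z≈-1)
        (λ m 1≤m m≤M → (λ 1∤m → ⊥-elim (1∤m (1∣ m))) , λ k m≡k → ≡.trans (norm-Q₁ m m ℕₚ.≤-refl 1≤m m≤M)
          (≡.cong +_ (≡.trans (≡.cong (ℕ._^ t) (≡.trans m≡k (ℕₚ.*-identityʳ k))) (≡.sym (ℕₚ.+-identityʳ _)))))
        (≡.cong (λ r → partsLe r 0) (DivMod.n%1≡0 n)) (s≤s z≤n) (s≤s z≤n)
        (≡.trans (Nφ-cong w₁≋1) Nφ-1) Nφ-1
        (begin
          1 ℕ.^ n ℕ.* (K !) ℕ.^ t             ≡⟨ ≡.cong (ℕ._* (K !) ℕ.^ t) (ℕₚ.^-zeroˡ n) ⟩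
          1 ℕ.* (K !) ℕ.^ t                   ≡⟨ ℕₚ.*-identityˡ _ ⟩
          (K !) ℕ.^ t                         ≡⟨ ≡.cong (λ k → (k !) ℕ.^ t) (DivMod.n/1≡n n) ⟩
          (n !) ℕ.^ t                         ≡⟨ ℕₚ.*-identityʳ _ ⟨
          (n !) ℕ.^ t ℕ.* 1                   ≡⟨ ≡.cong (λ x → (n !) ℕ.^ t ℕ.* (x ℕ.* 1)) (ℕₚ.^-zeroˡ K) ⟨
          (n !) ℕ.^ t ℕ.* (1 ℕ.^ K ℕ.* 1)     ∎)
        where open ≡.≡-Reasoning

  module Two (𝓔 : Evaluation) (n M : ℕ) (n≤M : n ≤ M) (C : Cyclotomic M) (2≤M : 2 ≤ M) where
    open AtRoot 𝓔 n M n≤M C 1 2≤M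

    module _ (z²≈-1 : z T.^ 2 ≈ - 1#) (N[1+z] : N (1# + z T.^ 1) ≡ + 2) (N[1+z³] : N (1# + z T.^ 3) ≡ + 2) where

      z⁴≈1 : z T.^ 4 ≈ 1#
      z⁴≈1 = trans (sym (T.^-assocʳ z 2 2)) (T.-1^even z²≈-1 1)

      w₂≋1 : w 2 ≋ oneP
      w₂≋1 = w-self≋1 none
        where
        none : ∀ h → 1 ≤ h → h ≢ 2 → ¬ h ◁ 2
        none 1 _ _ (oddMultiple j eq) = even≢odd 1 j (≡.trans eq (ℕₚ.*-identityˡ _))
        none 2 _ 2≢2 _ = 2≢2 ≡.refl
        none (suc (suc (suc h))) _ _ h◁2 with ◁⇒≤ h◁2
        ... | s≤s (s≤s ())

      odd-not-multiple : ∀ j → ¬ 2 ∣ suc (2 ℕ.* j)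
      odd-not-multiple j (divides i eq) = even≢odd i j (≡.trans (ℕₚ.*-comm 2 i) (≡.sym eq))

      norm-Q-odd : ∀ j r i → suc (2 ℕ.* j) ≡ r ℕ.+ i ℕ.* 4 → N (1# + z T.^ r) ≡ + 2 →
                   suc (2 ℕ.* j) ≤ M → NormQ 2 (suc (2 ℕ.* j))
      norm-Q-odd j r i eq Nr m≤M = (λ _ → ≡.trans (Nφ-cong (Q-odd j))
          (≡.trans (Nφ-w-other m (s≤s z≤n) m≤M (λ 2◁m → odd-not-multiple j (◁⇒∣ 2◁m)))
          (≡.trans (N-cong (+-congˡ (trans (T.^-congʳ z eq) (z-period z⁴≈1 r i)))) Nr))) ,
        λ k m≡2k → ⊥-elim (odd-not-multiple j (divides k m≡2k))
        where m = suc (2 ℕ.* j)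

      -- By `m` modulo 4. Odd `m`: `1 + z^m` has norm 2. Multiples of 4: `1 + z^m = 2` doubles the
      -- factor `m/4` supplied by `Q (m/2)`. Residue 2: without `Ψ 2` the factor `w m` has value
      -- `m/2`, and `Q (m/2)`, of odd index, has norm 2.
      norm-Q₂ : ∀ b m → m ≤ b → 1 ≤ m → m ≤ M → NormQ 2 m
      norm-Q₂ zero    zero _ () _
      norm-Q₂ (suc b) m m≤b 1≤m m≤M with m DivMod.divMod 4
      ... | DivMod.result i (suc zero) m≡ =
        ≡.subst (NormQ 2) (≡.sym m≡j) (norm-Q-odd (2 ℕ.* i) 1 i (≡.trans (≡.sym m≡j) m≡) N[1+z] (≡.subst (_≤ M) m≡j m≤M))
        where
        m≡j : m ≡ suc (2 ℕ.* (2 ℕ.* i))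
        m≡j = ≡.trans m≡ (arith i)
          where
          arith : ∀ i → 1 ℕ.+ i ℕ.* 4 ≡ 1 ℕ.+ 2 ℕ.* (2 ℕ.* i)
          arith = ℕSolver.solve-∀
      ... | DivMod.result i (suc (suc (suc zero))) m≡ =
        ≡.subst (NormQ 2) (≡.sym m≡j) (norm-Q-odd (1 ℕ.+ 2 ℕ.* i) 3 i (≡.trans (≡.sym m≡j) m≡) N[1+z³] (≡.subst (_≤ M) m≡j m≤M))
        where
        m≡j : m ≡ suc (2 ℕ.* (1 ℕ.+ 2 ℕ.* i))
        m≡j = ≡.trans m≡ (arith i)
          where
          arith : ∀ i → 3 ℕ.+ i ℕ.* 4 ≡ 1 ℕ.+ 2 ℕ.* (1 ℕ.+ 2 ℕ.* i)
          arith = ℕSolver.solve-∀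
      ... | DivMod.result i zero m≡ = (λ 2∤m → ⊥-elim (2∤m (divides (2 ℕ.* i) (≡.trans m≡2k (ℕₚ.*-comm 2 (2 ℕ.* i)))))) , λ k m≡k2 → begin
        Nφ (Q m)                              ≡⟨ ≡.cong (λ x → Nφ (Q x)) m≡2k ⟩
        Nφ (Q (2 ℕ.* (2 ℕ.* i)))              ≡⟨ Nφ-cong (Q-even (2 ℕ.* i)) ⟩
        Nφ (w (2 ℕ.* (2 ℕ.* i)) *P Q (2 ℕ.* i)) ≡⟨ Nφ-* (w (2 ℕ.* (2 ℕ.* i))) (Q (2 ℕ.* i)) ⟩
        Nφ (w (2 ℕ.* (2 ℕ.* i))) ℤ.* Nφ (Q (2 ℕ.* i))
          ≡⟨ ≡.cong₂ ℤ._*_ (≡.trans (≡.cong (λ x → Nφ (w x)) (≡.sym m≡2k))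
               (≡.trans (Nφ-w-other m 1≤m m≤M ¬2◁m) (N-2 (trans (T.^-congʳ z m≡) (z-period z⁴≈1 0 i)))))
               (proj₂ (norm-Q₂ b (2 ℕ.* i) (proj₁ bounds) (proj₂ bounds) k≤M) i (ℕₚ.*-comm 2 i)) ⟩
        + (2 ℕ.^ t) ℤ.* + (2 ℕ.* i ℕ.^ t)     ≡⟨ ℤₚ.pos-* (2 ℕ.^ t) (2 ℕ.* i ℕ.^ t) ⟨
        + (2 ℕ.^ t ℕ.* (2 ℕ.* i ℕ.^ t))       ≡⟨ ≡.cong +_ (arith (2 ℕ.^ t) (i ℕ.^ t)) ⟩
        + (2 ℕ.* (2 ℕ.^ t ℕ.* i ℕ.^ t))       ≡⟨ ≡.cong (λ x → + (2 ℕ.* x)) (^-distribʳ-* t 2 i) ⟨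
        + (2 ℕ.* (2 ℕ.* i) ℕ.^ t)             ≡⟨ ≡.cong (λ x → + (2 ℕ.* x ℕ.^ t))
              (ℕₚ.*-cancelʳ-≡ _ _ 2 (≡.trans (ℕₚ.*-comm (2 ℕ.* i) 2) (≡.trans (≡.sym m≡2k) m≡k2))) ⟩
        + (2 ℕ.* k ℕ.^ t)                     ∎
        where
        open ≡.≡-Reasoning
        arith : ∀ a b → a ℕ.* (2 ℕ.* b) ≡ 2 ℕ.* (a ℕ.* b)
        arith = ℕSolver.solve-∀
        four : ∀ i → i ℕ.* 4 ≡ 2 ℕ.* (2 ℕ.* i)
        four = ℕSolver.solve-∀
        m≡2k : m ≡ 2 ℕ.* (2 ℕ.* i)
        m≡2k = ≡.trans m≡ (four i)
        bounds = half-bounds {b} {2 ℕ.* i} m≡2k m≤b 1≤m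
        k≤M : 2 ℕ.* i ≤ M
        k≤M = ℕₚ.≤-trans (ℕₚ.m≤m+n (2 ℕ.* i) _) (≡.subst (_≤ M) m≡2k m≤M)
        ¬2◁m : ¬ 2 ◁ m
        ¬2◁m (oddMultiple j eq) = even≢odd i j (ℕₚ.*-cancelˡ-≡ _ _ 2 (≡.trans (≡.sym m≡2k) eq))
      ... | DivMod.result i (suc (suc zero)) m≡ = (λ 2∤m → ⊥-elim (2∤m (divides o (≡.trans m≡2o (ℕₚ.*-comm 2 o))))) , λ k m≡k2 → begin
        Nφ (Q m)                       ≡⟨ ≡.cong (λ x → Nφ (Q x)) m≡2o ⟩
        Nφ (Q (2 ℕ.* o))               ≡⟨ Nφ-cong (Q-even o) ⟩
        Nφ (w (2 ℕ.* o) *P Q o)        ≡⟨ Nφ-* (w (2 ℕ.* o)) (Q o) ⟩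
        Nφ (w (2 ℕ.* o)) ℤ.* Nφ (Q o)
          ≡⟨ ≡.cong₂ ℤ._*_ (≡.trans (Nφ-w-odd-multiple z²≈-1 i 2o≤M)
                (≡.trans (≡.cong (ℤ._* + (o ℕ.^ t)) (≡.trans (Nφ-cong w₂≋1) Nφ-1)) (ℤₚ.*-identityˡ _)))
               (proj₁ (norm-Q₂ b o (proj₁ bounds) (s≤s z≤n) (ℕₚ.≤-trans (ℕₚ.m≤m+n o _) 2o≤M)) (odd-not-multiple i)) ⟩
        + (o ℕ.^ t) ℤ.* + 2            ≡⟨ ℤₚ.pos-* (o ℕ.^ t) 2 ⟨
        + (o ℕ.^ t ℕ.* 2)              ≡⟨ ≡.cong +_ (ℕₚ.*-comm (o ℕ.^ t) 2) ⟩
        + (2 ℕ.* o ℕ.^ t)              ≡⟨ ≡.cong (λ x → + (2 ℕ.* x ℕ.^ t))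
              (ℕₚ.*-cancelʳ-≡ _ _ 2 (≡.trans (ℕₚ.*-comm o 2) (≡.trans (≡.sym m≡2o) m≡k2))) ⟩
        + (2 ℕ.* k ℕ.^ t)              ∎
        where
        open ≡.≡-Reasoning
        o = suc (2 ℕ.* i)
        arith : ∀ i → 2 ℕ.+ i ℕ.* 4 ≡ 2 ℕ.* (1 ℕ.+ 2 ℕ.* i)
        arith = ℕSolver.solve-∀
        m≡2o : m ≡ 2 ℕ.* o
        m≡2o = ≡.trans m≡ (arith i)
        2o≤M : 2 ℕ.* o ≤ M
        2o≤M = ≡.subst (_≤ M) m≡2o m≤M
        bounds = half-bounds {b} {o} m≡2o m≤b 1≤m

      -- The norm of `D n` contains `2^n`. The parts 2 take nothing from it, as `w 2` is 1; for odd
      -- `n` the one remaining part 1 takes a single 2. This leaves `2^(2 K)`.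
      norm-num₂ : Nφ (∑P q (partitions n)) ≡ + (2 ℕ.^ (2 ℕ.* K) ℕ.* (K !) ℕ.^ t)
      norm-num₂ = by-remainder (n % 2) ≡.refl (DivMod.m%n<n n 2)
        where
        root = Ψ-root w₂≋1 z²≈-1
        normQ : ∀ m → 1 ≤ m → m ≤ M → NormQ 2 m
        normQ m = norm-Q₂ m m ℕₚ.≤-refl
        w₂≡ : Nφ (w 2) ≡ + 1
        w₂≡ = ≡.trans (Nφ-cong w₂≋1) Nφ-1
        power : ∀ r → n % 2 ≡ r → 2 ℕ.^ n ℕ.* (K !) ℕ.^ t ≡
                2 ℕ.^ (2 ℕ.* K) ℕ.* (K !) ℕ.^ t ℕ.* (1 ℕ.^ K ℕ.* 2 ℕ.^ r)
        power r n%2≡r = begin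
          2 ℕ.^ n ℕ.* F                              ≡⟨ ≡.cong (λ x → 2 ℕ.^ x ℕ.* F) n≡ ⟩
          2 ℕ.^ (r ℕ.+ 2 ℕ.* K) ℕ.* F                ≡⟨ ≡.cong (ℕ._* F) (ℕₚ.^-distribˡ-+-* 2 r (2 ℕ.* K)) ⟩
          2 ℕ.^ r ℕ.* 2 ℕ.^ (2 ℕ.* K) ℕ.* F          ≡⟨ arith (2 ℕ.^ r) (2 ℕ.^ (2 ℕ.* K)) F ⟩
          2 ℕ.^ (2 ℕ.* K) ℕ.* F ℕ.* (1 ℕ.* 2 ℕ.^ r)  ≡⟨ ≡.cong (λ x → 2 ℕ.^ (2 ℕ.* K) ℕ.* F ℕ.* (x ℕ.* 2 ℕ.^ r)) (ℕₚ.^-zeroˡ K) ⟨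
          2 ℕ.^ (2 ℕ.* K) ℕ.* F ℕ.* (1 ℕ.^ K ℕ.* 2 ℕ.^ r) ∎
          where
          open ≡.≡-Reasoning
          F = (K !) ℕ.^ t
          n≡ : n ≡ r ℕ.+ 2 ℕ.* K
          n≡ = ≡.trans (DivMod.m≡m%n+[m/n]*n n 2) (≡.cong₂ ℕ._+_ n%2≡r (ℕₚ.*-comm K 2))
          arith : ∀ a b c → a ℕ.* b ℕ.* c ≡ b ℕ.* c ℕ.* (1 ℕ.* a)
          arith = ℕSolver.solve-∀
        by-remainder : ∀ r → n % 2 ≡ r → r < 2 → Nφ (∑P q (partitions n)) ≡ + (2 ℕ.^ (2 ℕ.* K) ℕ.* (K !) ℕ.^ t)
        by-remainder 0 n%2≡0 _ = norm-single {2} {1} {1} {_} {[]} root normQ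
          (≡.cong (λ r → partsLe r 1) n%2≡0) (s≤s z≤n) (s≤s z≤n) w₂≡ Nφ-1 (power 0 n%2≡0)
        by-remainder 1 n%2≡1 _ = norm-single {2} {1} {2} {_} {1 ∷ []} root normQ
          (≡.cong (λ r → partsLe r 1) n%2≡1) (s≤s z≤n) (s≤s z≤n) w₂≡
          (≡.trans (Nφ-cong (𝐏.*-identityʳ (w 1)))
            (≡.trans (Nφ-w-other 1 (s≤s z≤n) (ℕₚ.≤-trans (s≤s z≤n) 2≤M) (λ 2◁1 → odd-not-multiple 0 (◁⇒∣ 2◁1))) N[1+z]))
          (power 1 n%2≡1)
        by-remainder (suc (suc r)) _ (s≤s (s≤s ()))

  module Three (𝓔 : Evaluation) (n M : ℕ) (n≤M : n ≤ M) (C : Cyclotomic M) (3≤M : 3 ≤ M) where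
    open AtRoot 𝓔 n M n≤M C 2 3≤M

    1≤M : 1 ≤ M
    1≤M = ℕₚ.≤-trans (s≤s z≤n) 3≤M

    -- `1 + x^3` is `Ψ 1 * Ψ 3`, and `Ψ 1` is `1 + x`.
    w₃≋1+X : w 3 ≋ (oneP +P X ^ 1)
    w₃≋1+X = ≋-trans (W-cong {off (λ h → χ h 3)} {λ h → χ h 1} λ h 1≤h _ → exponents h 1≤h)
                     (≋-sym (1+X^≋W 1 (s≤s z≤n) 1≤M))
      where
      exponents : ∀ h → 1 ≤ h → off (λ h → χ h 3) h ≡ χ h 1
      exponents 1 _ = ≡.refl
      exponents 2 _ = ≡.refl
      exponents 3 _ = ≡.refl
      exponents h@(suc (suc (suc (suc _)))) _ = ≡.trans (off-0 (λ h → χ h 3) {h} χ≡0)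
        (≡.trans χ≡0 (≡.sym (χ-no {h} {1} λ h◁1 → ℕₚ.<⇒≱ (s≤s (s≤s z≤n)) (◁⇒≤ h◁1))))
        where
        χ≡0 : χ h 3 ≡ 0
        χ≡0 = χ-no {h} {3} λ h◁3 → ℕₚ.<⇒≱ (s≤s (s≤s (s≤s (s≤s z≤n)))) (◁⇒≤ h◁3)

    Ψ₃≋ : Ψ 3 ≋ alt 3 (X ^ 1)
    Ψ₃≋ = *P-cancelʳ {oneP +P X ^ 1} (Monic⇒Nonzero {oneP +P X ^ 1} (1+X^-Monic 1 (s≤s z≤n))) (begin
      Ψ 3 *P (oneP +P X ^ 1)             ≈⟨ *P-comm (Ψ 3) (oneP +P X ^ 1) ⟩
      (oneP +P X ^ 1) *P Ψ 3             ≈⟨ *P-cong w₃≋1+X (≋-refl {Ψ 3}) ⟨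
      w 3 *P Ψ 3                         ≈⟨ w-*-Ψ 3 (s≤s z≤n) 3≤M (◁-refl 3) ⟩
      oneP +P X ^ (1 ℕ.* 3)              ≈⟨ 𝐏.+-congˡ {oneP} (𝐏.^-assocʳ X 1 3) ⟨
      oneP +P (X ^ 1) ^ 3                ≈⟨ 𝐏.1+^odd (X ^ 1) 1 ⟩
      (oneP +P X ^ 1) *P alt 3 (X ^ 1)   ≈⟨ *P-comm (oneP +P X ^ 1) (alt 3 (X ^ 1)) ⟩
      alt 3 (X ^ 1) *P (oneP +P X ^ 1)   ∎)
      where open SetoidReasoning 𝐏.setoid

    W-A : ∀ l → All (λ p → 1 ≤ p × p ≤ M) l → W (λ h → A h l) ≋ prodP (map (λ p → oneP +P X ^ p) l)
    W-A []      []                  = W-0 {λ h → A h []} λ _ _ _ → ≡.refl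
    W-A (p ∷ l) ((1≤p , p≤M) ∷ ps) = ≋-trans (≋-sym (W-+ (λ h → χ h p) (λ h → A h l)))
      (*P-cong (≋-sym (1+X^≋W p 1≤p p≤M)) (W-A l ps))

    -- Dropping the parts in `l` multiplies `q` by exactly their factors `1 + x^p`. With `k`
    -- consisting of parts 3 this compares the two survivors for `n` congruent to 2 modulo 3 through
    -- the common value `q k`.
    q-++ : ∀ {m} k l → Partition n m (k ++ l) → All (λ p → 1 ≤ p × p ≤ M) l →
           (q (k ++ l) *P prodP (map (λ p → oneP +P X ^ p) l)) ≋ q k
    q-++ k l pkl ps = ≋-trans (*P-congˡ (q (k ++ l)) (≋-sym (W-A l ps)))
      (≋-trans (W-+ (λ h → quot n h ∸ A h (k ++ l)) (λ h → A h l)) (W-cong λ h 1≤h _ → exponents h 1≤h))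
      where
      exponents : ∀ h → 1 ≤ h → quot n h ∸ A h (k ++ l) ℕ.+ A h l ≡ quot n h ∸ A h k
      exponents h 1≤h = ℕₚ.+-cancelʳ-≡ (A h k) _ _ (begin
        quot n h ∸ A h (k ++ l) ℕ.+ A h l ℕ.+ A h k   ≡⟨ ℕₚ.+-assoc (quot n h ∸ A h (k ++ l)) (A h l) (A h k) ⟩
        quot n h ∸ A h (k ++ l) ℕ.+ (A h l ℕ.+ A h k)
          ≡⟨ ≡.cong (quot n h ∸ A h (k ++ l) ℕ.+_) (≡.trans (ℕₚ.+-comm (A h l) (A h k)) (≡.sym (A-++ h k l))) ⟩
        quot n h ∸ A h (k ++ l) ℕ.+ A h (k ++ l)      ≡⟨ ℕₚ.m∸n+n≡m (A≤quot pkl h 1≤h) ⟩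
        quot n h                                      ≡⟨ ℕₚ.m∸n+n≡m (ℕₚ.≤-trans (≡.subst (A h k ≤_) (≡.sym (A-++ h k l))
                                                           (ℕₚ.m≤m+n (A h k) (A h l))) (A≤quot pkl h 1≤h)) ⟨
        quot n h ∸ A h k ℕ.+ A h k                    ∎)
        where open ≡.≡-Reasoning

    not-multiple : ∀ r s → ¬ 3 ∣ r → 3 ∣ s → ¬ 3 ∣ r ℕ.+ s
    not-multiple r s 3∤r 3∣s 3∣r+s = 3∤r (∣m+n∣m⇒∣n (≡.subst (3 ∣_) (ℕₚ.+-comm r s) 3∣r+s) 3∣s)

    3∣6* : ∀ i → 3 ∣ i ℕ.* 6
    3∣6* i = ∣n⇒∣m*n i (divides 2 ≡.refl)

    module _ (z³≈-1 : z T.^ 3 ≈ - 1#) (alt₃ : φ (alt 3 (X ^ 1)) ≈ 0#)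
             (N[1+z]  : N (1# + z T.^ 1) ≡ + 3) (N[1+z²] : N (1# + z T.^ 2) ≡ + 1)
             (N[1+z⁴] : N (1# + z T.^ 4) ≡ + 1) (N[1+z⁵] : N (1# + z T.^ 5) ≡ + 3) where

      z⁶≈1 : z T.^ 6 ≈ 1#
      z⁶≈1 = trans (sym (T.^-assocʳ z 3 2)) (T.-1^even z³≈-1 1)

      w₃≡ : Nφ (w 3) ≡ + 3
      w₃≡ = ≡.trans (N-cong (trans (φ-cong w₃≋1+X) (φ-1+X^ 1))) N[1+z]

      w-period : ∀ {m r i c} → m ≡ r ℕ.+ i ℕ.* 6 → N (1# + z T.^ r) ≡ c → 1 ≤ m → m ≤ M → ¬ 3 ◁ m → Nφ (w m) ≡ c
      w-period {m} {r} {i} m≡ Nr 1≤m m≤M ¬3◁m = ≡.trans (Nφ-w-other m 1≤m m≤M ¬3◁m)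
        (≡.trans (N-cong (+-congˡ (trans (T.^-congʳ z m≡) (z-period z⁶≈1 r i)))) Nr)

      norm-Q-odd : ∀ {m} j r i → m ≡ suc (2 ℕ.* j) → m ≡ r ℕ.+ i ℕ.* 6 → N (1# + z T.^ r) ≡ + 3 →
                   ¬ 3 ∣ r → m ≤ M → NormQ 3 m
      norm-Q-odd {m} j r i ≡.refl m≡ Nr 3∤r m≤M =
        (λ _ → ≡.trans (Nφ-cong (Q-odd j)) (w-period {m} {r} {i} m≡ Nr (s≤s z≤n) m≤M (λ 3◁m → 3∤m (◁⇒∣ 3◁m)))) ,
        λ k m≡3k → ⊥-elim (3∤m (divides k m≡3k))
        where
        3∤m : ¬ 3 ∣ m
        3∤m = ≡.subst (λ x → ¬ 3 ∣ x) (≡.sym m≡) (not-multiple r (i ℕ.* 6) 3∤r (3∣6* i))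

      norm-Q-even : ∀ {m} k r i → m ≡ 2 ℕ.* k → m ≡ r ℕ.+ i ℕ.* 6 → N (1# + z T.^ r) ≡ + 1 →
                    ¬ 3 ∣ r → 1 ≤ m → m ≤ M → (¬ 3 ∣ k → Nφ (Q k) ≡ + 3) → NormQ 3 m
      norm-Q-even {m} k r i ≡.refl m≡ Nr 3∤r 1≤m m≤M norm-Qk =
        (λ _ → ≡.trans (Nφ-cong (Q-even k)) (≡.trans (Nφ-* (w m) (Q k)) (≡.cong₂ ℤ._*_
          (w-period {m} {r} {i} m≡ Nr 1≤m m≤M (λ 3◁m → 3∤m (◁⇒∣ 3◁m)))
          (norm-Qk λ 3∣k → 3∤m (∣n⇒∣m*n 2 3∣k))))) ,
        λ k m≡3k → ⊥-elim (3∤m (divides k m≡3k))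
        where
        3∤m : ¬ 3 ∣ m
        3∤m = ≡.subst (λ x → ¬ 3 ∣ x) (≡.sym m≡) (not-multiple r (i ℕ.* 6) 3∤r (3∣6* i))

      -- By `m` modulo 6. Residues 1 and 5: `1 + z^m` has norm 3. Residues 2 and 4: it has norm 1,
      -- and `Q (m/2)` has norm 3. Residue 3: norm 3 from `w 3`, times `(m/3)^t` from the
      -- alternating sum. Residue 0: `1 + z^m = 2` doubles the factor `m/6` supplied by `Q (m/2)`.
      norm-Q₃ : ∀ b m → m ≤ b → 1 ≤ m → m ≤ M → NormQ 3 m
      norm-Q₃ zero    zero _ () _
      norm-Q₃ (suc b) m m≤b 1≤m m≤M with m DivMod.divMod 6
      ... | DivMod.result i (suc zero) m≡ =
        norm-Q-odd (3 ℕ.* i) 1 i (≡.trans m≡ (arith i)) m≡ N[1+z] (toWitnessFalse {a? = 3 ∣? 1} _) m≤M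
        where
        arith : ∀ i → 1 ℕ.+ i ℕ.* 6 ≡ 1 ℕ.+ 2 ℕ.* (3 ℕ.* i)
        arith = ℕSolver.solve-∀
      ... | DivMod.result i (suc (suc (suc (suc (suc zero))))) m≡ =
        norm-Q-odd (2 ℕ.+ 3 ℕ.* i) 5 i (≡.trans m≡ (arith i)) m≡ N[1+z⁵] (toWitnessFalse {a? = 3 ∣? 5} _) m≤M
        where
        arith : ∀ i → 5 ℕ.+ i ℕ.* 6 ≡ 1 ℕ.+ 2 ℕ.* (2 ℕ.+ 3 ℕ.* i)
        arith = ℕSolver.solve-∀
      ... | DivMod.result i (suc (suc zero)) m≡ =
        norm-Q-even k 2 i m≡2k m≡ N[1+z²] (toWitnessFalse {a? = 3 ∣? 2} _) 1≤m m≤M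
          (proj₁ (norm-Q₃ b k (proj₁ bounds) (proj₂ bounds) (ℕₚ.≤-trans (ℕₚ.m≤m+n k _) (≡.subst (_≤ M) m≡2k m≤M))))
        where
        k = 1 ℕ.+ 3 ℕ.* i
        arith : ∀ i → 2 ℕ.+ i ℕ.* 6 ≡ 2 ℕ.* (1 ℕ.+ 3 ℕ.* i)
        arith = ℕSolver.solve-∀
        m≡2k : m ≡ 2 ℕ.* k
        m≡2k = ≡.trans m≡ (arith i)
        bounds = half-bounds {b} {k} m≡2k m≤b 1≤m
      ... | DivMod.result i (suc (suc (suc (suc zero)))) m≡ =
        norm-Q-even k 4 i m≡2k m≡ N[1+z⁴] (toWitnessFalse {a? = 3 ∣? 4} _) 1≤m m≤M
          (proj₁ (norm-Q₃ b k (proj₁ bounds) (proj₂ bounds) (ℕₚ.≤-trans (ℕₚ.m≤m+n k _) (≡.subst (_≤ M) m≡2k m≤M))))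
        where
        k = 2 ℕ.+ 3 ℕ.* i
        arith : ∀ i → 4 ℕ.+ i ℕ.* 6 ≡ 2 ℕ.* (2 ℕ.+ 3 ℕ.* i)
        arith = ℕSolver.solve-∀
        m≡2k : m ≡ 2 ℕ.* k
        m≡2k = ≡.trans m≡ (arith i)
        bounds = half-bounds {b} {k} m≡2k m≤b 1≤m
      ... | DivMod.result i (suc (suc (suc zero))) m≡ =
        (λ 3∤m → ⊥-elim (3∤m (divides o (≡.trans m≡3o (ℕₚ.*-comm 3 o))))) , λ k m≡k3 → begin
        Nφ (Q m)                     ≡⟨ ≡.cong (λ x → Nφ (Q x)) m≡odd ⟩
        Nφ (Q (suc (2 ℕ.* j)))       ≡⟨ Nφ-cong (Q-odd j) ⟩
        Nφ (w (suc (2 ℕ.* j)))       ≡⟨ ≡.cong (λ x → Nφ (w x)) (≡.trans (≡.sym m≡odd) m≡3o) ⟩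
        Nφ (w (3 ℕ.* o))             ≡⟨ Nφ-w-odd-multiple z³≈-1 i (≡.subst (_≤ M) m≡3o m≤M) ⟩
        Nφ (w 3) ℤ.* + (o ℕ.^ t)     ≡⟨ ≡.cong (ℤ._* + (o ℕ.^ t)) w₃≡ ⟩
        + 3 ℤ.* + (o ℕ.^ t)          ≡⟨ ℤₚ.pos-* 3 (o ℕ.^ t) ⟨
        + (3 ℕ.* o ℕ.^ t)            ≡⟨ ≡.cong (λ x → + (3 ℕ.* x ℕ.^ t))
            (ℕₚ.*-cancelʳ-≡ o k 3 (≡.trans (ℕₚ.*-comm o 3) (≡.trans (≡.sym m≡3o) m≡k3))) ⟩
        + (3 ℕ.* k ℕ.^ t)            ∎
        where
        open ≡.≡-Reasoning
        j = 1 ℕ.+ 3 ℕ.* i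
        o = suc (2 ℕ.* i)
        odd : ∀ i → 3 ℕ.+ i ℕ.* 6 ≡ 1 ℕ.+ 2 ℕ.* (1 ℕ.+ 3 ℕ.* i)
        odd = ℕSolver.solve-∀
        triple : ∀ i → 3 ℕ.+ i ℕ.* 6 ≡ 3 ℕ.* (1 ℕ.+ 2 ℕ.* i)
        triple = ℕSolver.solve-∀
        m≡odd : m ≡ suc (2 ℕ.* j)
        m≡odd = ≡.trans m≡ (odd i)
        m≡3o : m ≡ 3 ℕ.* o
        m≡3o = ≡.trans m≡ (triple i)
      ... | DivMod.result i zero m≡ =
        (λ 3∤m → ⊥-elim (3∤m (≡.subst (3 ∣_) (≡.sym m≡) (3∣6* i)))) , λ k m≡k3 → begin
        Nφ (Q m)                              ≡⟨ ≡.cong (λ x → Nφ (Q x)) m≡2h ⟩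
        Nφ (Q (2 ℕ.* h))                      ≡⟨ Nφ-cong (Q-even h) ⟩
        Nφ (w (2 ℕ.* h) *P Q h)               ≡⟨ Nφ-* (w (2 ℕ.* h)) (Q h) ⟩
        Nφ (w (2 ℕ.* h)) ℤ.* Nφ (Q h)
          ≡⟨ ≡.cong₂ ℤ._*_ (≡.trans (≡.cong (λ x → Nφ (w x)) (≡.sym m≡2h))
               (≡.trans (Nφ-w-other m 1≤m m≤M ¬3◁m) (N-2 (trans (T.^-congʳ z m≡) (z-period z⁶≈1 0 i)))))
               (proj₂ (norm-Q₃ b h (proj₁ bounds) (proj₂ bounds) h≤M) i (ℕₚ.*-comm 3 i)) ⟩
        + (2 ℕ.^ t) ℤ.* + (3 ℕ.* i ℕ.^ t)     ≡⟨ ℤₚ.pos-* (2 ℕ.^ t) (3 ℕ.* i ℕ.^ t) ⟨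
        + (2 ℕ.^ t ℕ.* (3 ℕ.* i ℕ.^ t))       ≡⟨ ≡.cong +_ (arith (2 ℕ.^ t) (i ℕ.^ t)) ⟩
        + (3 ℕ.* (2 ℕ.^ t ℕ.* i ℕ.^ t))       ≡⟨ ≡.cong (λ x → + (3 ℕ.* x)) (^-distribʳ-* t 2 i) ⟨
        + (3 ℕ.* (2 ℕ.* i) ℕ.^ t)             ≡⟨ ≡.cong (λ x → + (3 ℕ.* x ℕ.^ t))
              (ℕₚ.*-cancelʳ-≡ (2 ℕ.* i) k 3 (≡.trans (six′ i) (≡.trans (≡.sym m≡) m≡k3))) ⟩
        + (3 ℕ.* k ℕ.^ t)                     ∎
        where
        open ≡.≡-Reasoning
        h = 3 ℕ.* i
        arith : ∀ a b → a ℕ.* (3 ℕ.* b) ≡ 3 ℕ.* (a ℕ.* b)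
        arith = ℕSolver.solve-∀
        six : ∀ i → i ℕ.* 6 ≡ 2 ℕ.* (3 ℕ.* i)
        six = ℕSolver.solve-∀
        six′ : ∀ i → 2 ℕ.* i ℕ.* 3 ≡ i ℕ.* 6
        six′ = ℕSolver.solve-∀
        triple-odd : ∀ j → 3 ℕ.* (1 ℕ.+ 2 ℕ.* j) ≡ 1 ℕ.+ 2 ℕ.* (1 ℕ.+ 3 ℕ.* j)
        triple-odd = ℕSolver.solve-∀
        m≡2h : m ≡ 2 ℕ.* h
        m≡2h = ≡.trans m≡ (six i)
        bounds = half-bounds {b} {h} m≡2h m≤b 1≤m
        h≤M : h ≤ M
        h≤M = ℕₚ.≤-trans (ℕₚ.m≤m+n h _) (≡.subst (_≤ M) m≡2h m≤M)
        ¬3◁m : ¬ 3 ◁ m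
        ¬3◁m (oddMultiple j eq) = even≢odd h (1 ℕ.+ 3 ℕ.* j) (≡.trans (≡.sym m≡2h) (≡.trans eq (triple-odd j)))

      private
        normQ : ∀ m → 1 ≤ m → m ≤ M → NormQ 3 m
        normQ m = norm-Q₃ m m ℕₚ.≤-refl

        root : φ (Ψ 3) ≈ 0#
        root = trans (φ-cong Ψ₃≋) alt₃

        w₁≡ : Nφ (w 1) ≡ + 3
        w₁≡ = ≡.trans (Nφ-w-other 1 (s≤s z≤n) 1≤M (λ 3◁1 → ℕₚ.<⇒≱ (s≤s (s≤s z≤n)) (◁⇒≤ 3◁1))) N[1+z]

        R : ℕ
        R = 3 ℕ.^ (2 ℕ.* K) ℕ.* (K !) ℕ.^ t

        -- Here `n = 3 K + r`. The norm 3 of `w 3` takes `3^K` out of `3^n`, and `r` parts 1, of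
        -- norm 3 each, take `3^r`.
        power : ∀ r → n % 3 ≡ r → 3 ℕ.^ n ℕ.* (K !) ℕ.^ t ≡ R ℕ.* (3 ℕ.^ K ℕ.* 3 ℕ.^ r)
        power r n%3≡r = begin
          3 ℕ.^ n ℕ.* F                                     ≡⟨ ≡.cong (λ x → 3 ℕ.^ x ℕ.* F) n≡ ⟩
          3 ℕ.^ (2 ℕ.* K ℕ.+ (K ℕ.+ r)) ℕ.* F
            ≡⟨ ≡.cong (ℕ._* F) (≡.trans (ℕₚ.^-distribˡ-+-* 3 (2 ℕ.* K) (K ℕ.+ r))
                 (≡.cong (3 ℕ.^ (2 ℕ.* K) ℕ.*_) (ℕₚ.^-distribˡ-+-* 3 K r))) ⟩
          3 ℕ.^ (2 ℕ.* K) ℕ.* (3 ℕ.^ K ℕ.* 3 ℕ.^ r) ℕ.* F  ≡⟨ arith (3 ℕ.^ (2 ℕ.* K)) (3 ℕ.^ K ℕ.* 3 ℕ.^ r) F ⟩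
          R ℕ.* (3 ℕ.^ K ℕ.* 3 ℕ.^ r)                       ∎
          where
          open ≡.≡-Reasoning
          F = (K !) ℕ.^ t
          split : ∀ k r → r ℕ.+ k ℕ.* 3 ≡ 2 ℕ.* k ℕ.+ (k ℕ.+ r)
          split = ℕSolver.solve-∀
          n≡ : n ≡ 2 ℕ.* K ℕ.+ (K ℕ.+ r)
          n≡ = ≡.trans (DivMod.m≡m%n+[m/n]*n n 3) (≡.trans (≡.cong (ℕ._+ K ℕ.* 3) n%3≡r) (split K r))
          arith : ∀ a b c → a ℕ.* b ℕ.* c ≡ a ℕ.* c ℕ.* b
          arith = ℕSolver.solve-∀

      norm-num₃ : ¬ (n % 3 ≡ 2) → Nφ (∑P q (partitions n)) ≡ + R
      norm-num₃ n%3≢2 = by-remainder (n % 3) ≡.refl (DivMod.m%n<n n 3)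
        where
        by-remainder : ∀ r → n % 3 ≡ r → r < 3 → Nφ (∑P q (partitions n)) ≡ + R
        by-remainder 0 eq _ = norm-single {3} {3} {1} {R} {[]} root normQ
          (≡.cong (λ r → partsLe r 2) eq) (s≤s z≤n) (s≤s z≤n) w₃≡ Nφ-1 (power 0 eq)
        by-remainder 1 eq _ = norm-single {3} {3} {3} {R} {1 ∷ []} root normQ
          (≡.cong (λ r → partsLe r 2) eq) (s≤s z≤n) (s≤s z≤n) w₃≡
          (≡.trans (Nφ-cong (𝐏.*-identityʳ (w 1))) w₁≡) (power 1 eq)
        by-remainder 2 eq _ = ⊥-elim (n%3≢2 eq)
        by-remainder (suc (suc (suc r))) _ (s≤s (s≤s (s≤s ())))

      -- For n ≡ 2 (mod 3) both 3ᴷ1² and 3ᴷ2 survive, and the second term is 3 times the first.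
      norm-num₃′ : (1# + z T.^ 1) * (1# + z T.^ 1) ≈ (3 T.⊗ 1#) * (1# + z T.^ 2) →
                   ∀ u → (1# + z T.^ 2) * u ≈ 1# → n % 3 ≡ 2 →
                   Nφ (∑P q (partitions n)) ≡ + (4 ℕ.^ t ℕ.* R)
      norm-num₃′ square u inverse n%3≡2 = ≡.trans (N-cong total) (≡.trans (N-* (4 T.⊗ 1#) x₁₁)
        (≡.trans (≡.cong₂ ℤ._*_ (N-⊗ 4) Nx₁₁) (≡.sym (ℤₚ.pos-* (4 ℕ.^ t) R))))
        where
        open SetoidReasoning setoid
        l₁₁ l₂ : List ℕ
        l₁₁ = replicate K 3 ++ 1 ∷ 1 ∷ []
        l₂  = replicate K 3 ++ 2 ∷ []
        x₁₁ x₂ : Carrier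
        x₁₁ = φ (q l₁₁)
        x₂  = φ (q l₂)
        partsLe≡ : partsLe (n % 3) 2 ≡ (1 ∷ 1 ∷ []) ∷ (2 ∷ []) ∷ []
        partsLe≡ = ≡.cong (λ r → partsLe r 2) n%3≡2
        remainders : All (Partition (n % 3) 2) ((1 ∷ 1 ∷ []) ∷ (2 ∷ []) ∷ [])
        remainders = ≡.subst (All (Partition (n % 3) 2)) partsLe≡ (partsLe-Partition (n % 3) 2)
        p₁₁ : Partition (n % 3) 2 (1 ∷ 1 ∷ [])
        p₁₁ = All.head remainders
        p₂ : Partition (n % 3) 2 (2 ∷ [])
        p₂ = All.head (All.tail remainders)
        2≤M : 2 ≤ M
        2≤M = ℕₚ.≤-trans (s≤s (s≤s z≤n)) 3≤M
        relation : x₂ * (1# + z T.^ 2) ≈ x₁₁ * ((1# + z T.^ 1) * (1# + z T.^ 1))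
        relation = begin
          x₂ * (1# + z T.^ 2)                          ≈⟨ *-congˡ (φ-1+X^ 2) ⟨
          x₂ * φ (oneP +P X ^ 2)                       ≈⟨ φ-* (q l₂) (oneP +P X ^ 2) ⟨
          φ (q l₂ *P (oneP +P X ^ 2))                  ≈⟨ φ-cong (*P-congˡ (q l₂) (𝐏.*-identityʳ (oneP +P X ^ 2))) ⟨
          φ (q l₂ *P ((oneP +P X ^ 2) *P oneP))        ≈⟨ φ-cong (q-++ (replicate K 3) (2 ∷ []) (remaining p₂) ((s≤s z≤n , 2≤M) ∷ [])) ⟩
          φ (q (replicate K 3))
            ≈⟨ φ-cong (q-++ (replicate K 3) (1 ∷ 1 ∷ []) (remaining p₁₁) ((s≤s z≤n , 1≤M) ∷ (s≤s z≤n , 1≤M) ∷ [])) ⟨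
          φ (q l₁₁ *P ((oneP +P X ^ 1) *P ((oneP +P X ^ 1) *P oneP)))
            ≈⟨ φ-cong (*P-congˡ (q l₁₁) (*P-congˡ (oneP +P X ^ 1) (𝐏.*-identityʳ (oneP +P X ^ 1)))) ⟩
          φ (q l₁₁ *P ((oneP +P X ^ 1) *P (oneP +P X ^ 1))) ≈⟨ φ-* (q l₁₁) ((oneP +P X ^ 1) *P (oneP +P X ^ 1)) ⟩
          x₁₁ * φ ((oneP +P X ^ 1) *P (oneP +P X ^ 1)) ≈⟨ *-congˡ (φ-* (oneP +P X ^ 1) (oneP +P X ^ 1)) ⟩
          x₁₁ * (φ (oneP +P X ^ 1) * φ (oneP +P X ^ 1)) ≈⟨ *-congˡ (*-cong (φ-1+X^ 1) (φ-1+X^ 1)) ⟩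
          x₁₁ * ((1# + z T.^ 1) * (1# + z T.^ 1))      ∎
        x₂≈3x₁₁ : x₂ ≈ x₁₁ * (3 T.⊗ 1#)
        x₂≈3x₁₁ = begin
          x₂                                           ≈⟨ *-identityʳ x₂ ⟨
          x₂ * 1#                                      ≈⟨ *-congˡ inverse ⟨
          x₂ * ((1# + z T.^ 2) * u)                    ≈⟨ *-assoc _ _ _ ⟨
          x₂ * (1# + z T.^ 2) * u                      ≈⟨ *-congʳ (trans relation (*-congˡ square)) ⟩
          x₁₁ * ((3 T.⊗ 1#) * (1# + z T.^ 2)) * u      ≈⟨ *-congʳ (sym (*-assoc _ _ _)) ⟩
          x₁₁ * (3 T.⊗ 1#) * (1# + z T.^ 2) * u        ≈⟨ *-assoc _ _ _ ⟩
          x₁₁ * (3 T.⊗ 1#) * ((1# + z T.^ 2) * u)      ≈⟨ *-congˡ inverse ⟩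
          x₁₁ * (3 T.⊗ 1#) * 1#                        ≈⟨ *-identityʳ _ ⟩
          x₁₁ * (3 T.⊗ 1#)                             ∎
        -- The factor 4 of the theorem arises as 1 + 3, one summand from each surviving partition.
        total : φ (∑P q (partitions n)) ≈ (4 T.⊗ 1#) * x₁₁
        total = begin
          φ (∑P q (partitions n))                      ≈⟨ sum-partitions root ⟩
          ∑ (λ l → φ (q (replicate K 3 ++ l))) (partsLe (n % 3) 2)
            ≡⟨ ≡.cong (∑ (λ l → φ (q (replicate K 3 ++ l)))) partsLe≡ ⟩
          x₁₁ + (x₂ + 0#)                              ≈⟨ +-congˡ (+-identityʳ x₂) ⟩
          x₁₁ + x₂                                     ≈⟨ +-cong (sym (*-identityʳ x₁₁)) x₂≈3x₁₁ ⟩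
          x₁₁ * 1# + x₁₁ * (3 T.⊗ 1#)                  ≈⟨ distribˡ x₁₁ 1# (3 T.⊗ 1#) ⟨
          x₁₁ * (4 T.⊗ 1#)                             ≈⟨ *-comm _ _ ⟩
          (4 T.⊗ 1#) * x₁₁                             ∎
        Nx₁₁ : N x₁₁ ≡ + R
        Nx₁₁ = cancel-norm (N x₁₁) 3 K 9 R (s≤s z≤n) (s≤s z≤n) (≡.trans
          (≡.cong (N x₁₁ ℤ.*_) (≡.sym (≡.cong₂ (λ x y → x ℤ.^ K ℤ.* y) w₃≡ w₁w₁)))
          (≡.trans (norm-q normQ p₁₁) (≡.cong +_ (power 2 n%3≡2))))
          where
          w₁w₁ : Nφ (prodP (map w (1 ∷ 1 ∷ []))) ≡ + 9
          w₁w₁ = ≡.trans (Nφ-* (w 1) (w 1 *P oneP))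
            (≡.cong₂ ℤ._*_ w₁≡ (≡.trans (Nφ-cong (𝐏.*-identityʳ (w 1))) w₁≡))

open RootsOfUnity

open import Data.Nat using (_^_; _*_)

-- Evaluation of polynomials in ℤ and in quadratic rings

module Eval (S : CommutativeRing 0ℓ 0ℓ) (ι : ℤ → CommutativeRing.Carrier S) where
  open CommutativeRing S hiding (zero) renaming (_*_ to _·_; _+_ to _⊕_)
  open RingTheory S using (solve; _:=_; _:+_; _:*_)
  open SetoidReasoning setoid

  module At (ι-0 : ι 0ℤ ≈ 0#) (ι-1 : ι 1ℤ ≈ 1#) (ι-+ : ∀ a b → ι (a ℤ.+ b) ≈ ι a ⊕ ι b)
            (ι-* : ∀ a b → ι (a ℤ.* b) ≈ ι a · ι b) (y : Carrier) where

    eval : Poly → Carrier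
    eval []      = 0#
    eval (a ∷ p) = ι a ⊕ y · eval p

    eval-+ : ∀ p q → eval (p +P q) ≈ eval p ⊕ eval q
    eval-+ []      q       = sym (+-identityˡ _)
    eval-+ (a ∷ p) []      = sym (+-identityʳ _)
    eval-+ (a ∷ p) (b ∷ q) = begin
      ι (a ℤ.+ b) ⊕ y · eval (p +P q)              ≈⟨ +-cong (ι-+ a b) (*-congˡ (eval-+ p q)) ⟩
      (ι a ⊕ ι b) ⊕ y · (eval p ⊕ eval q)
        ≈⟨ solve 5 (λ a b y p q → (a :+ b) :+ y :* (p :+ q) := (a :+ y :* p) :+ (b :+ y :* q)) refl
             (ι a) (ι b) y (eval p) (eval q) ⟩
      (ι a ⊕ y · eval p) ⊕ (ι b ⊕ y · eval q)      ∎

    eval-scale : ∀ a p → eval (scaleP a p) ≈ ι a · eval p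
    eval-scale a []      = sym (zeroʳ _)
    eval-scale a (b ∷ p) = begin
      ι (a ℤ.* b) ⊕ y · eval (scaleP a p)          ≈⟨ +-cong (ι-* a b) (*-congˡ (eval-scale a p)) ⟩
      ι a · ι b ⊕ y · (ι a · eval p)
        ≈⟨ solve 4 (λ a b y p → a :* b :+ y :* (a :* p) := a :* (b :+ y :* p)) refl (ι a) (ι b) y (eval p) ⟩
      ι a · (ι b ⊕ y · eval p)                     ∎

    eval-* : ∀ p q → eval (p *P q) ≈ eval p · eval q
    eval-* []      q = sym (zeroˡ _)
    eval-* (a ∷ p) q = begin
      eval (scaleP a q +P (0ℤ ∷ (p *P q)))         ≈⟨ eval-+ (scaleP a q) (0ℤ ∷ (p *P q)) ⟩
      eval (scaleP a q) ⊕ (ι 0ℤ ⊕ y · eval (p *P q))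
        ≈⟨ +-cong (eval-scale a q) (trans (+-congʳ ι-0) (+-identityˡ _)) ⟩
      ι a · eval q ⊕ y · eval (p *P q)             ≈⟨ +-congˡ (*-congˡ (eval-* p q)) ⟩
      ι a · eval q ⊕ y · (eval p · eval q)
        ≈⟨ solve 4 (λ a y p q → a :* q :+ y :* (p :* q) := (a :+ y :* p) :* q) refl (ι a) y (eval p) (eval q) ⟩
      (ι a ⊕ y · eval p) · eval q                  ∎

    eval-1 : eval oneP ≈ 1#
    eval-1 = trans (+-cong ι-1 (zeroʳ y)) (+-identityʳ 1#)

    -- Lists that are equal as polynomials may differ in length; the surplus of the longer one
    -- consists of zeros and must evaluate to 0.
    eval-≋[] : ∀ p → p ≋ [] → eval p ≈ 0#
    eval-≋[] []      _   = refl
    eval-≋[] (a ∷ p) p≋0 = begin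
      ι a ⊕ y · eval p
        ≈⟨ +-cong (trans (reflexive (≡.cong ι (coeff≡ p≋0 0))) ι-0)
             (*-congˡ (eval-≋[] p (coeffwise λ k → coeff≡ p≋0 (suc k)))) ⟩
      0# ⊕ y · 0#      ≈⟨ +-identityˡ _ ⟩
      y · 0#           ≈⟨ zeroʳ y ⟩
      0#               ∎
      where open _≋_

    eval-cong : ∀ {p q} → p ≋ q → eval p ≈ eval q
    eval-cong {[]}    {q}     p≋q = sym (eval-≋[] q (≋-sym p≋q))
    eval-cong {a ∷ p} {[]}    p≋q = eval-≋[] (a ∷ p) p≋q
    eval-cong {a ∷ p} {b ∷ q} p≋q = +-cong (reflexive (≡.cong ι (coeff≡ p≋q 0)))
      (*-congˡ (eval-cong {p} {q} (coeffwise λ k → coeff≡ p≋q (suc k))))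
      where open _≋_

integerEvaluation : ℤ → Evaluation
integerEvaluation y = record
  { ring   = ℤₚ.+-*-commutativeRing
  ; φ      = eval
  ; φ-cong = eval-cong
  ; φ-+    = eval-+
  ; φ-*    = eval-*
  ; φ-1    = eval-1
  ; N      = λ x → x
  ; N-cong = λ eq → eq
  ; N-*    = λ _ _ → ≡.refl
  ; t      = 1
  ; N-⊗    = λ k → ≡.trans (integer k) (≡.cong +_ (≡.sym (ℕₚ.*-identityʳ k)))
  }
  where
  module E = Eval ℤₚ.+-*-commutativeRing (λ a → a)
  open E.At ≡.refl ≡.refl (λ _ _ → ≡.refl) (λ _ _ → ≡.refl) y
  open RingTheory ℤₚ.+-*-commutativeRing using (_⊗_)
  integer : ∀ k → k ⊗ 1ℤ ≡ + k
  integer zero    = ≡.refl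
  integer (suc k) = ≡.cong (λ x → 1ℤ ℤ.+ x) (integer k)

-- The ring ℤ[θ]/(θ² - s θ + 1): s = 0 gives ℤ[i] and s = 1 gives ℤ[ζ₆].
module Quadratic (s : ℤ) where
  open import Data.Integer using (_+_; -_)

  infixl 6 _+Q_
  infixl 7 _*Q_

  _+Q_ _*Q_ : ℤ × ℤ → ℤ × ℤ → ℤ × ℤ
  (a , b) +Q (c , d) = a + c , b + d
  (a , b) *Q (c , d) = a ℤ.* c + - (b ℤ.* d) , a ℤ.* d + b ℤ.* c + s ℤ.* (b ℤ.* d)

  -Q_ : ℤ × ℤ → ℤ × ℤ
  -Q (a , b) = - a , - b

  -- The product of `a + b θ` with its conjugate `a + b (s - θ)`.
  normQ : ℤ × ℤ → ℤ
  normQ (a , b) = a ℤ.* a + s ℤ.* (a ℤ.* b) + b ℤ.* b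

  *Q-assoc : ∀ x y z → (x *Q y) *Q z ≡ x *Q (y *Q z)
  *Q-assoc (a , b) (c , d) (e , f) = ≡.cong₂ _,_ (first s a b c d e f) (second s a b c d e f)
    where
    first : ∀ s a b c d e f →
      (a ℤ.* c + - (b ℤ.* d)) ℤ.* e + - ((a ℤ.* d + b ℤ.* c + s ℤ.* (b ℤ.* d)) ℤ.* f)
      ≡ a ℤ.* (c ℤ.* e + - (d ℤ.* f)) + - (b ℤ.* (c ℤ.* f + d ℤ.* e + s ℤ.* (d ℤ.* f)))
    first = ℤSolver.solve-∀
    second : ∀ s a b c d e f →
      (a ℤ.* c + - (b ℤ.* d)) ℤ.* f + (a ℤ.* d + b ℤ.* c + s ℤ.* (b ℤ.* d)) ℤ.* e
        + s ℤ.* ((a ℤ.* d + b ℤ.* c + s ℤ.* (b ℤ.* d)) ℤ.* f)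
      ≡ a ℤ.* (c ℤ.* f + d ℤ.* e + s ℤ.* (d ℤ.* f)) + b ℤ.* (c ℤ.* e + - (d ℤ.* f))
        + s ℤ.* (b ℤ.* (c ℤ.* f + d ℤ.* e + s ℤ.* (d ℤ.* f)))
    second = ℤSolver.solve-∀

  *Q-comm : ∀ x y → x *Q y ≡ y *Q x
  *Q-comm (a , b) (c , d) = ≡.cong₂ _,_ (first a b c d) (second s a b c d)
    where
    first : ∀ a b c d → a ℤ.* c + - (b ℤ.* d) ≡ c ℤ.* a + - (d ℤ.* b)
    first = ℤSolver.solve-∀
    second : ∀ s a b c d → a ℤ.* d + b ℤ.* c + s ℤ.* (b ℤ.* d) ≡ c ℤ.* b + d ℤ.* a + s ℤ.* (d ℤ.* b)
    second = ℤSolver.solve-∀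

  *Q-identityˡ : ∀ x → (1ℤ , 0ℤ) *Q x ≡ x
  *Q-identityˡ (a , b) = ≡.cong₂ _,_ (first a b) (second s a b)
    where
    first : ∀ a b → 1ℤ ℤ.* a + - (0ℤ ℤ.* b) ≡ a
    first = ℤSolver.solve-∀
    second : ∀ s a b → 1ℤ ℤ.* b + 0ℤ ℤ.* a + s ℤ.* (0ℤ ℤ.* b) ≡ b
    second = ℤSolver.solve-∀

  *Q-distribˡ : ∀ x y z → x *Q (y +Q z) ≡ x *Q y +Q x *Q z
  *Q-distribˡ (a , b) (c , d) (e , f) = ≡.cong₂ _,_ (first a b c d e f) (second s a b c d e f)
    where
    first : ∀ a b c d e f → a ℤ.* (c + e) + - (b ℤ.* (d + f))
      ≡ a ℤ.* c + - (b ℤ.* d) + (a ℤ.* e + - (b ℤ.* f))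
    first = ℤSolver.solve-∀
    second : ∀ s a b c d e f → a ℤ.* (d + f) + b ℤ.* (c + e) + s ℤ.* (b ℤ.* (d + f))
      ≡ a ℤ.* d + b ℤ.* c + s ℤ.* (b ℤ.* d) + (a ℤ.* f + b ℤ.* e + s ℤ.* (b ℤ.* f))
    second = ℤSolver.solve-∀

  quadraticRing : CommutativeRing 0ℓ 0ℓ
  quadraticRing = record
    { Carrier = ℤ × ℤ ; _≈_ = _≡_ ; _+_ = _+Q_ ; _*_ = _*Q_ ; -_ = -Q_ ; 0# = 0ℤ , 0ℤ ; 1# = 1ℤ , 0ℤ
    ; isCommutativeRing = record
      { isRing = record
        { +-isAbelianGroup = record
          { isGroup = record
            { isMonoid = record
              { isSemigroup = record
                { isMagma = record { isEquivalence = ≡.isEquivalence ; ∙-cong = ≡.cong₂ _+Q_ }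
                ; assoc = λ (a , b) (c , d) (e , f) → ≡.cong₂ _,_ (ℤₚ.+-assoc a c e) (ℤₚ.+-assoc b d f) }
              ; identity = (λ (a , b) → ≡.cong₂ _,_ (ℤₚ.+-identityˡ a) (ℤₚ.+-identityˡ b))
                         , (λ (a , b) → ≡.cong₂ _,_ (ℤₚ.+-identityʳ a) (ℤₚ.+-identityʳ b)) }
            ; inverse = (λ (a , b) → ≡.cong₂ _,_ (ℤₚ.+-inverseˡ a) (ℤₚ.+-inverseˡ b))
                      , (λ (a , b) → ≡.cong₂ _,_ (ℤₚ.+-inverseʳ a) (ℤₚ.+-inverseʳ b))
            ; ⁻¹-cong = ≡.cong -Q_ }
          ; comm = λ (a , b) (c , d) → ≡.cong₂ _,_ (ℤₚ.+-comm a c) (ℤₚ.+-comm b d) }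
        ; *-cong = ≡.cong₂ _*Q_
        ; *-assoc = *Q-assoc
        ; *-identity = *Q-identityˡ , (λ x → ≡.trans (*Q-comm x _) (*Q-identityˡ x))
        ; distrib = *Q-distribˡ , (λ x y z → ≡.trans (*Q-comm (y +Q z) x)
            (≡.trans (*Q-distribˡ x y z) (≡.cong₂ _+Q_ (*Q-comm x y) (*Q-comm x z)))) }
      ; *-comm = *Q-comm } }

  normQ-* : ∀ x y → normQ (x *Q y) ≡ normQ x ℤ.* normQ y
  normQ-* (a , b) (c , d) = identity s a b c d
    where
    identity : ∀ s a b c d →
      (a ℤ.* c + - (b ℤ.* d)) ℤ.* (a ℤ.* c + - (b ℤ.* d))
        + s ℤ.* ((a ℤ.* c + - (b ℤ.* d)) ℤ.* (a ℤ.* d + b ℤ.* c + s ℤ.* (b ℤ.* d)))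
        + (a ℤ.* d + b ℤ.* c + s ℤ.* (b ℤ.* d)) ℤ.* (a ℤ.* d + b ℤ.* c + s ℤ.* (b ℤ.* d))
      ≡ (a ℤ.* a + s ℤ.* (a ℤ.* b) + b ℤ.* b) ℤ.* (c ℤ.* c + s ℤ.* (c ℤ.* d) + d ℤ.* d)
    identity = ℤSolver.solve-∀

  open RingTheory quadraticRing using (_⊗_)

  ⊗1≡ : ∀ k → k ⊗ (1ℤ , 0ℤ) ≡ (+ k , 0ℤ)
  ⊗1≡ zero    = ≡.refl
  ⊗1≡ (suc k) = ≡.cong ((1ℤ , 0ℤ) +Q_) (⊗1≡ k)

  normQ-⊗ : ∀ k → normQ (k ⊗ (1ℤ , 0ℤ)) ≡ + (k ^ 2)
  normQ-⊗ k = ≡.trans (≡.cong normQ (⊗1≡ k)) (≡.trans (square s (+ k))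
    (≡.trans (≡.sym (ℤₚ.pos-* k k)) (≡.cong (λ x → + (k * x)) (≡.sym (ℕₚ.*-identityʳ k)))))
    where
    square : ∀ s a → a ℤ.* a + s ℤ.* (a ℤ.* 0ℤ) + 0ℤ ℤ.* 0ℤ ≡ a ℤ.* a
    square = ℤSolver.solve-∀

  private
    ι : ℤ → ℤ × ℤ
    ι a = a , 0ℤ
    module E = Eval quadraticRing ι
    ι-* : ∀ a b → ι (a ℤ.* b) ≡ ι a *Q ι b
    ι-* a b = ≡.cong₂ _,_ (first a b) (second s a b)
      where
      first : ∀ a b → a ℤ.* b ≡ a ℤ.* b + - (0ℤ ℤ.* 0ℤ)
      first = ℤSolver.solve-∀
      second : ∀ s a b → 0ℤ ≡ a ℤ.* 0ℤ + 0ℤ ℤ.* b + s ℤ.* (0ℤ ℤ.* 0ℤ)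
      second = ℤSolver.solve-∀

  evalQ : ℤ × ℤ → Poly → ℤ × ℤ
  evalQ = E.At.eval ≡.refl ≡.refl (λ _ _ → ≡.refl) ι-*

  quadraticEvaluation : ℤ × ℤ → Evaluation
  quadraticEvaluation y = record
    { ring   = quadraticRing
    ; φ      = eval
    ; φ-cong = eval-cong
    ; φ-+    = eval-+
    ; φ-*    = eval-*
    ; φ-1    = eval-1
    ; N      = normQ
    ; N-cong = ≡.cong normQ
    ; N-*    = normQ-*
    ; t      = 2
    ; N-⊗    = normQ-⊗
    }
    where open E.At ≡.refl ≡.refl (λ _ _ → ≡.refl) ι-* y

module ℤ[i]′  = Quadratic 0ℤ
module ℤ[ζ₆]′ = Quadratic 1ℤ

-- Comparison with the evaluations of the statement, and assembly

evalℤ≡ : ∀ p → evalℤ p -1ℤ ≡ Evaluation.φ (integerEvaluation -1ℤ) p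
evalℤ≡ []      = ≡.refl
evalℤ≡ (a ∷ p) = ≡.cong (λ x → a ℤ.+ -1ℤ ℤ.* x) (evalℤ≡ p)

step-G : ∀ a z x → (a ℤ.+ proj₁ (z *G x) , proj₂ (z *G x)) ≡ (a , 0ℤ) ℤ[i]′.+Q z ℤ[i]′.*Q x
step-G a (c , d) (e , f) = ≡.cong₂ _,_ ≡.refl (second c d e f)
  where
  second : ∀ c d e f → c ℤ.* f ℤ.+ d ℤ.* e ≡ 0ℤ ℤ.+ (c ℤ.* f ℤ.+ d ℤ.* e ℤ.+ 0ℤ ℤ.* (d ℤ.* f))
  second = ℤSolver.solve-∀

step-E : ∀ a z x → (a ℤ.+ proj₁ (z *E x) , proj₂ (z *E x)) ≡ (a , 0ℤ) ℤ[ζ₆]′.+Q z ℤ[ζ₆]′.*Q x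
step-E a (c , d) (e , f) = ≡.cong₂ _,_ ≡.refl (second c d e f)
  where
  second : ∀ c d e f → c ℤ.* f ℤ.+ d ℤ.* e ℤ.+ d ℤ.* f
                     ≡ 0ℤ ℤ.+ (c ℤ.* f ℤ.+ d ℤ.* e ℤ.+ 1ℤ ℤ.* (d ℤ.* f))
  second = ℤSolver.solve-∀

evalG≡ : ∀ z p → evalG p z ≡ ℤ[i]′.evalQ z p
evalG≡ z []      = ≡.refl
evalG≡ z (a ∷ p) = ≡.trans
  (≡.cong (λ x → a ℤ.+ proj₁ (z *G x) , proj₂ (z *G x)) (evalG≡ z p)) (step-G a z (ℤ[i]′.evalQ z p))

evalE≡ : ∀ z p → evalE p z ≡ ℤ[ζ₆]′.evalQ z p
evalE≡ z []      = ≡.refl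
evalE≡ z (a ∷ p) = ≡.trans
  (≡.cong (λ x → a ℤ.+ proj₁ (z *E x) , proj₂ (z *E x)) (evalE≡ z p)) (step-E a z (ℤ[ζ₆]′.evalQ z p))

normG≡ : ∀ x → normG x ≡ ℤ[i]′.normQ x
normG≡ (a , b) = ≡.cong (ℤ._+ b ℤ.* b) (≡.sym (ℤₚ.+-identityʳ (a ℤ.* a)))

normE≡ : ∀ x → normE x ≡ ℤ[ζ₆]′.normQ x
normE≡ (a , b) = ≡.cong (λ y → a ℤ.* a ℤ.+ y ℤ.+ b ℤ.* b) (≡.sym (ℤₚ.*-identityˡ (a ℤ.* b)))

-- Presents the squared absolute values found above as the squares of the asserted absolute values.
^-double : ∀ c k f → c ^ (2 * k) * f ^ 2 ≡ (c ^ k * f) ^ 2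
^-double c k f = ≡.trans (≡.cong (_* f ^ 2) (≡.trans (≡.cong (c ^_) (ℕₚ.*-comm 2 k)) (≡.sym (ℕₚ.^-*-assoc c k 2))))
  (≡.sym (^-distribʳ-* 2 (c ^ k) f))

theorem3p21 : (n : ℕ) → 1 ≤ n → (G P : Poly) → IsMonicGcd G (hList n) → P *P G ≈P numStar n →
    (evalℤ P -1ℤ ≡ + (n !))
    × (normG (evalG P imagUnit) ≡ + ((2 ^ (n / 2) * (n / 2) !) ^ 2)
    × normG (evalG P negImagUnit) ≡ + ((2 ^ (n / 2) * (n / 2) !) ^ 2))
    × ((¬ (n % 3 ≡ 2) →
    normE (evalE P ζ₆) ≡ + ((3 ^ (n / 3) * (n / 3) !) ^ 2)
    × normE (evalE P ζ₆⁵) ≡ + ((3 ^ (n / 3) * (n / 3) !) ^ 2))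
    × (n % 3 ≡ 2 →
    normE (evalE P ζ₆) ≡ + ((4 * 3 ^ (n / 3) * (n / 3) !) ^ 2)
    × normE (evalE P ζ₆⁵) ≡ + ((4 * 3 ^ (n / 3) * (n / 3) !) ^ 2)))
theorem3p21 n 1≤n G P G-gcd PG≈num =
  -- The `refl` arguments are numerical facts about powers of the root, decided by computation with
  -- pairs of integers.
  part-a , (at-i imagUnit ≡.refl ≡.refl ≡.refl , at-i negImagUnit ≡.refl ≡.refl ≡.refl) ,
  (λ n%3≢2 → at-ζ ζ₆  ≡.refl ≡.refl ≡.refl ≡.refl ≡.refl ≡.refl n%3≢2 ,
             at-ζ ζ₆⁵ ≡.refl ≡.refl ≡.refl ≡.refl ≡.refl ≡.refl n%3≢2) ,
  -- Either root `y` satisfies `1 + y^2 = y` and `(1 + y)^2 = 3 y`. The pair passed as witness is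
  -- the inverse of `y`, which is the other primitive sixth root.
  (λ n%3≡2 → at-ζ′ ζ₆  ≡.refl ≡.refl ≡.refl ≡.refl ≡.refl ≡.refl ≡.refl (1ℤ , -1ℤ) ≡.refl n%3≡2 ,
             at-ζ′ ζ₆⁵ ≡.refl ≡.refl ≡.refl ≡.refl ≡.refl ≡.refl ≡.refl (0ℤ , 1ℤ) ≡.refl n%3≡2)
  where
  -- The polynomials `Ψ 1`, `Ψ 2` and `Ψ 3` must be available even when `n < 3`.
  M : ℕ
  M = n ℕ.+ 3
  n≤M : n ≤ M
  n≤M = ℕₚ.m≤m+n n 3
  3≤M : 3 ≤ M
  3≤M = ℕₚ.m≤n+m 3 n
  C : Cyclotomic M
  C = cyclotomic M
  open Gcd n M n≤M C using (q; num≋)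
  P≋ : P ≋ ∑P q (partitions n)
  P≋ = num≋ G-gcd 1≤n PG≈num

  part-a : evalℤ P -1ℤ ≡ + (n !)
  part-a = ≡.trans (evalℤ≡ P) (≡.trans (φ-cong P≋)
    (≡.trans (norm-num₁ ≡.refl) (≡.cong +_ (ℕₚ.*-identityʳ (n !)))))
    where
    open Evaluation (integerEvaluation -1ℤ) using (φ-cong)
    open One (integerEvaluation -1ℤ) n M n≤M C (ℕₚ.≤-trans (s≤s z≤n) 3≤M)

  module _ (y : ℤ[i]) where
    open Evaluation (ℤ[i]′.quadraticEvaluation y) using (φ-cong; z; _≈_; _+_; 1#; -_; N; module T)
    open Two (ℤ[i]′.quadraticEvaluation y) n M n≤M C (ℕₚ.≤-trans (s≤s (s≤s z≤n)) 3≤M)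

    at-i : z T.^ 2 ≈ - 1# → N (1# + z T.^ 1) ≡ + 2 → N (1# + z T.^ 3) ≡ + 2 →
           normG (evalG P y) ≡ + ((2 ^ (n / 2) * (n / 2) !) ^ 2)
    at-i z² N₁ N₃ = ≡.trans (normG≡ (evalG P y)) (≡.trans (≡.cong N (≡.trans (evalG≡ y P) (φ-cong P≋)))
      (≡.trans (norm-num₂ z² N₁ N₃) (≡.cong +_ (^-double 2 (n / 2) ((n / 2) !)))))

  module _ (y : ℤ[ζ₆]) where
    open Evaluation (ℤ[ζ₆]′.quadraticEvaluation y) using (φ; φ-cong; z; _≈_; 1#; 0#; -_; N; module T) renaming (_*_ to _·_; _+_ to _⊕_)
    open Three (ℤ[ζ₆]′.quadraticEvaluation y) n M n≤M C 3≤M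

    P-norm : normE (evalE P y) ≡ N (φ (∑P q (partitions n)))
    P-norm = ≡.trans (normE≡ (evalE P y)) (≡.cong N (≡.trans (evalE≡ y P) (φ-cong P≋)))

    at-ζ : z T.^ 3 ≈ - 1# → φ (𝐏.alt 3 (X 𝐏.^ 1)) ≈ 0# →
           N (1# ⊕ z T.^ 1) ≡ + 3 → N (1# ⊕ z T.^ 2) ≡ + 1 →
           N (1# ⊕ z T.^ 4) ≡ + 1 → N (1# ⊕ z T.^ 5) ≡ + 3 →
           ¬ (n % 3 ≡ 2) → normE (evalE P y) ≡ + ((3 ^ (n / 3) * (n / 3) !) ^ 2)
    at-ζ z³ alt₃ N₁ N₂ N₄ N₅ n%3≢2 = ≡.trans P-norm
      (≡.trans (norm-num₃ z³ alt₃ N₁ N₂ N₄ N₅ n%3≢2) (≡.cong +_ (^-double 3 (n / 3) ((n / 3) !))))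

    at-ζ′ : z T.^ 3 ≈ - 1# → φ (𝐏.alt 3 (X 𝐏.^ 1)) ≈ 0# →
            N (1# ⊕ z T.^ 1) ≡ + 3 → N (1# ⊕ z T.^ 2) ≡ + 1 →
            N (1# ⊕ z T.^ 4) ≡ + 1 → N (1# ⊕ z T.^ 5) ≡ + 3 →
            (1# ⊕ z T.^ 1) · (1# ⊕ z T.^ 1) ≈ (3 T.⊗ 1#) · (1# ⊕ z T.^ 2) →
            ∀ u → (1# ⊕ z T.^ 2) · u ≈ 1# →
            n % 3 ≡ 2 → normE (evalE P y) ≡ + ((4 * 3 ^ (n / 3) * (n / 3) !) ^ 2)
    at-ζ′ z³ alt₃ N₁ N₂ N₄ N₅ square u inverse n%3≡2 = ≡.trans P-norm
      (≡.trans (norm-num₃′ z³ alt₃ N₁ N₂ N₄ N₅ square u inverse n%3≡2) (≡.cong +_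
        (≡.trans (≡.cong (4 ^ 2 *_) (^-double 3 (n / 3) ((n / 3) !)))
        (≡.trans (≡.sym (^-distribʳ-* 2 4 (3 ^ (n / 3) * (n / 3) !)))
          (≡.cong (_^ 2) (≡.sym (ℕₚ.*-assoc 4 (3 ^ (n / 3)) ((n / 3) !))))))))
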